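{- The problem Uniform Cluster Edge Deletion (UCED) is solvable in $1.47^{k}\cdot n^{\mathcal{O}(1)}$ time, where $k$ is the solution size bound and $n$ is the number of vertices of the input graph.
   Context: All graphs are finite, simple and undirected. A uniform cluster graph is a graph that is a disjoint union of cliques, all of the same size. UCED: Input: a graph $G=(V,E)$ and a positive integer $k$. Question: is there a set $F\subseteq E$ with $|F|\le k$ such that $G-F=(V,E\setminus F)$ is a uniform cluster graph? -}

module Defs where

open import Data.Bool using (Bool; false; T; not; _∧_; if_then_else_)
open import Data.Bool.Properties using (T?)
open import Data.Fin using (Fin)
import Data.Fin as Fin
import Data.Fin.Properties as Fin
open import Data.List using (List; length; filter; cartesianProduct; cartesianProductWith; allFin; head; drop)
open import Data.Maybe using (Maybe; just; nothing; fromMaybe)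
open import Data.Nat using (ℕ; suc; pred; _≤_; _≡ᵇ_)
import Data.Vec as Vec
open import Data.Product using (_×_; _,_; ∃-syntax; Σ-syntax)
open import Data.Sum using (_⊎_)
open import Function using (_⇔_)
open import Relation.Binary.PropositionalEquality using (_≡_; _≢_; cong₂; cong)
open import Relation.Nullary using (¬_)
open import Relation.Unary using (Decidable)
open import Relation.Nullary.Decidable using (_×-dec_)

-- Finite simple undirected graphs on the vertex set Fin n.  A set of edges
-- on these vertices is the same data, so the type also serves for F ⊆ E.
record Graph (n : ℕ) : Set where
  field
    adj    : Fin n → Fin n → Bool
    sym    : ∀ u v → adj u v ≡ adj v u
    irrefl : ∀ v → adj v v ≡ false

open Graph public using (adj)

infix 4 _⊆_
infixl 6 _∖_

_⊆_ : ∀ {n} → Graph n → Graph n → Set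
F ⊆ G = ∀ u v → T (adj F u v) → T (adj G u v)

IsEdge : ∀ {n} → Graph n → Fin n × Fin n → Set
IsEdge G (u , v) = u Fin.< v × T (adj G u v)

isEdge? : ∀ {n} (G : Graph n) → Decidable (IsEdge G)
isEdge? G (u , v) = (u Fin.<? v) ×-dec T? (adj G u v)

-- Each edge {u , v} is counted once, as the pair with u < v.
edgeCount : ∀ {n} → Graph n → ℕ
edgeCount {n} G = length (filter (isEdge? G) (cartesianProduct (allFin n) (allFin n)))

_∖_ : ∀ {n} → Graph n → Graph n → Graph n
G ∖ F = record
  { adj    = λ u v → adj G u v ∧ not (adj F u v)
  ; sym    = λ u v → cong₂ (λ a b → a ∧ not b) (Graph.sym G u v) (Graph.sym F u v)
  ; irrefl = λ v → cong (_∧ not (adj F v v)) (Graph.irrefl G v)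
  }

-- A disjoint union of m cliques of size s; part v is the clique containing v.
UniformCluster : ∀ {n} → Graph n → Set
UniformCluster {n} G =
  ∃[ m ] ∃[ s ] Σ[ part ∈ (Fin n → Fin m) ]
    (∀ u v → T (adj G u v) ⇔ (u ≢ v × part u ≡ part v)) ×
    (∀ i → Vec.count (λ v → part v Fin.≟ i) (Vec.allFin n) ≡ s)

UCED : ∀ {n} → Graph n → ℕ → Set
UCED G k = ∃[ F ] F ⊆ G × edgeCount F ≤ k × UniformCluster (G ∖ F)

-- The unit-cost successor RAM.  No step raises the largest stored number by
-- more than one, so unit cost differs from logarithmic cost only by a factor
-- logarithmic in the input numbers and the running time; unit-cost addition
-- or multiplication would not have this property.

Reg Label : Set
Reg   = ℕ
Label = ℕ

data Instr : Set where
  clear : Reg → Instr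
  move  : Reg → Reg → Instr
  inc   : Reg → Instr
  dec   : Reg → Instr
  load  : Reg → Reg → Instr
  store : Reg → Reg → Instr
  jump  : Label → Instr
  jz    : Reg → Label → Instr

Program : Set
Program = List Instr

record Config : Set where
  constructor ⟨_,_,_⟩
  field
    pc  : ℕ
    reg : ℕ → ℕ
    mem : ℕ → ℕ

open Config public

_[_≔_] : (ℕ → ℕ) → ℕ → ℕ → (ℕ → ℕ)
(f [ a ≔ x ]) b = if a ≡ᵇ b then x else f b

exec : Instr → Config → Config
exec (clear r)   ⟨ p , R , M ⟩ = ⟨ suc p , R [ r ≔ 0 ] , M ⟩
exec (move r s)  ⟨ p , R , M ⟩ = ⟨ suc p , R [ r ≔ R s ] , M ⟩
exec (inc r)     ⟨ p , R , M ⟩ = ⟨ suc p , R [ r ≔ suc (R r) ] , M ⟩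
exec (dec r)     ⟨ p , R , M ⟩ = ⟨ suc p , R [ r ≔ pred (R r) ] , M ⟩
exec (load r s)  ⟨ p , R , M ⟩ = ⟨ suc p , R [ r ≔ M (R s) ] , M ⟩
exec (store r s) ⟨ p , R , M ⟩ = ⟨ suc p , R , M [ R r ≔ R s ] ⟩
exec (jump l)    ⟨ p , R , M ⟩ = ⟨ l , R , M ⟩
exec (jz r l)    ⟨ p , R , M ⟩ = ⟨ (if R r ≡ᵇ 0 then l else suc p) , R , M ⟩

fetch : Program → ℕ → Maybe Instr
fetch P p = head (drop p P)

infix 3 _⊢_⇓[_]_

-- P ⊢ x ⇓[ t ] y : from x, P halts in y after exactly t steps.  A machine
-- halts when its program counter leaves the program.
data _⊢_⇓[_]_ (P : Program) : Config → ℕ → Config → Set where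
  halt : ∀ {x} → fetch P (pc x) ≡ nothing → P ⊢ x ⇓[ 0 ] x
  step : ∀ {x y t i} → fetch P (pc x) ≡ just i →
         P ⊢ exec i x ⇓[ t ] y → P ⊢ x ⇓[ suc t ] y

-- Register 0 holds n, register 1 holds k, and the memory holds the adjacency
-- matrix, row by row from address 0; everything else is 0.
input : ∀ {n} → Graph n → ℕ → Config
input {n} G k = ⟨ 0 , registers , memory ⟩
  where
  registers : ℕ → ℕ
  registers 0 = n
  registers 1 = k
  registers _ = 0

  bits : List ℕ
  bits = cartesianProductWith (λ u v → if adj G u v then 1 else 0) (allFin n) (allFin n)

  memory : ℕ → ℕ
  memory a = fromMaybe 0 (head (drop a bits))

-- The answer is left in register 0: 1 for yes, 0 for no.
Answers : Config → Set → Set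
Answers x Q = (reg x 0 ≡ 1 × Q) ⊎ (reg x 0 ≡ 0 × ¬ Q)

{-# OPTIONS --safe #-}

-- Fix the clique size s.  If v has the least degree s - 1 + e among the vertices not yet assigned, its clique omits
-- exactly e of its neighbours, and each of the s vertices of that clique loses at least e edges to unassigned vertices.
-- Going through the neighbours of v in order, the omitted ones are encoded by e digits below s, each digit being the
-- number of neighbours kept since the previous omission.  So a solution with at most k deletions is encoded by at most
-- k/s digits, and there are s^(k/s) ≤ 3^(k/3) ≤ 1.47^k strings of that length.  For every s the program runs an odometer
-- through these strings, lets each of them guide a greedy labelling, and checks the labelling on its own; only
-- completeness depends on the encoding.  Replacing k by min(k, n²) first keeps the work per string polynomial in n.

module Submission where

-- The machine shapes the proof as much as the combinatorics does. It only has successor and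
-- predecessor, so adding a number takes a loop of that length, and every number used in the search
-- has to stay polynomial in `n`. A digit counts members of a single clique, which is why its base
-- is `s` and not `n`. How many digits a clique consumes is read off the degree of its first vertex,
-- so the codes of successive cliques are concatenated without separators, and zeros appended at the
-- end are never read. Hence strings of one fixed length suffice for each `s`. The edges that pay
-- for the digits of a clique lead to vertices still unassigned; later cliques are formed among
-- those vertices only, so no edge pays twice. The potential `Φ` records this. Running times are
-- bounded by monomials computed from the syntax of commands whose loops are all bounded. Only the
-- outermost loop has exponentially many rounds. Each of its rounds ends by clearing the scratch
-- variables, so that one and the same bound applies to every round.

open import Defs
open import Data.Bool using (Bool; T; _∧_; _∨_; false; if_then_else_; not; true)
open import Data.Empty using (⊥; ⊥-elim)
open import Data.List using (List; []; _++_; _∷_; allFin; cartesianProduct; cartesianProductWith; drop; filter; head; length; map; replicate; tabulate; upTo)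
open import Data.List.Membership.Propositional.Properties using (∈-upTo⁺)
open import Data.List.Properties using (filter-++; length-++; length-filter; length-map; length-replicate; length-tabulate; map-tabulate)
open import Data.List.Relation.Unary.All using (All; []; _∷_)
open import Data.List.Relation.Unary.All.Properties using (++⁺; replicate⁺)
open import Data.List.Relation.Unary.Any using (here; there)
open import Data.Maybe using (Maybe; fromMaybe; just; nothing)
open import Data.Nat
open import Data.Nat.Properties
open import Data.Nat.Tactic.RingSolver using (solve-∀)
open import Data.Product using (_,_; _×_; proj₁; proj₂; ∃-syntax)
open import Data.Sum using (_⊎_; inj₁; inj₂)
open import Data.Unit using (tt; ⊤)
open import Function using (Equivalence; _$_; _⇔_; _∘_; id; mk⇔)
open import Level using (0ℓ)
open import Relation.Binary.Definitions using (tri<; tri>; tri≈)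
open import Relation.Binary.PropositionalEquality
open import Relation.Nullary using (Dec; does; no; yes; ¬_)
open import Relation.Nullary.Decidable using (dec-false; dec-true)
open import Relation.Unary using (Decidable; Pred)
open import Data.Fin using (Fin; toℕ; fromℕ<) renaming (zero to fzero; suc to fsuc)
import Data.Fin as Fin
import Data.Fin.Properties as Fin
import Data.List.Relation.Unary.All as All
import Data.Vec as Vec

-- The structured machine language and its assembly

infix 3 _⊢_⟶[_]_

-- Halting runs do not compose, since `_⊢_⇓[_]_` ends only outside the program; these runs may stop
-- anywhere and are chained by `⟶-trans`.
data _⊢_⟶[_]_ (P : Program) : Config → ℕ → Config → Set where
  done : ∀ {x} → P ⊢ x ⟶[ 0 ] x
  next : ∀ {x y t i} → fetch P (pc x) ≡ just i →
         P ⊢ exec i x ⟶[ t ] y → P ⊢ x ⟶[ suc t ] y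

⟶-trans : ∀ {P x y z s t} → P ⊢ x ⟶[ s ] y → P ⊢ y ⟶[ t ] z → P ⊢ x ⟶[ s + t ] z
⟶-trans done       q = q
⟶-trans (next f p) q = next f (⟶-trans p q)

⟶-halt : ∀ {P x y t} → P ⊢ x ⟶[ t ] y → fetch P (pc y) ≡ nothing → P ⊢ x ⇓[ t ] y
⟶-halt done       h = halt h
⟶-halt (next f p) h = step f (⟶-halt p h)

At : Program → ℕ → Program → Set
At P p []      = ⊤
At P p (i ∷ c) = fetch P p ≡ just i × At P (suc p) c

At-++ˡ : ∀ {P p} c {d} → At P p (c ++ d) → At P p c
At-++ˡ []      _       = tt
At-++ˡ (i ∷ c) (f , a) = f , At-++ˡ c a

At-++ʳ : ∀ {P p} c {d} → At P p (c ++ d) → At P (p + length c) d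
At-++ʳ {P} {p} []      {d} a       = subst (λ q → At P q d) (sym (+-identityʳ p)) a
At-++ʳ {P} {p} (i ∷ c) {d} (_ , a) = subst (λ q → At P q d) (sym (+-suc p (length c))) (At-++ʳ c a)

fetch-++ : ∀ (pre : Program) i c → fetch (pre ++ i ∷ c) (length pre) ≡ just i
fetch-++ []        i c = refl
fetch-++ (_ ∷ pre) i c = fetch-++ pre i c

At-suffix : ∀ pre c → At (pre ++ c) (length pre) c
At-suffix pre []      = tt
At-suffix pre (i ∷ c) = fetch-++ pre i c ,
  subst₂ (λ P q → At P q c) (++-snoc pre) (trans (length-++ pre) (+-comm (length pre) 1))
    (At-suffix (pre ++ i ∷ []) c)
  where
  ++-snoc : ∀ (pre : Program) → (pre ++ i ∷ []) ++ c ≡ pre ++ i ∷ c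
  ++-snoc []        = refl
  ++-snoc (x ∷ pre) = cong (x ∷_) (++-snoc pre)

At-self : ∀ P → At P 0 P
At-self = At-suffix []

fetch-end : ∀ P → fetch P (length P) ≡ nothing
fetch-end []      = refl
fetch-end (_ ∷ P) = fetch-end P

record State : Set where
  constructor _▸_
  field
    rg : ℕ → ℕ
    mm : ℕ → ℕ

open State public

infix 5 _▸_

at : ℕ → State → Config
at p σ = ⟨ p , rg σ , mm σ ⟩

data Op : Set where
  clr    : Reg → Op
  mov    : Reg → Reg → Op
  incr   : Reg → Op
  decr   : Reg → Op
  ld     : Reg → Reg → Op
  st     : Reg → Reg → Op

instr : Op → Instr
instr (clr r)   = clear r
instr (mov r s) = move r s
instr (incr r)  = inc r
instr (decr r)  = dec r
instr (ld r s)  = load r s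
instr (st r s)  = store r s

-- The program counter 0 is arbitrary: an `Op` is never a jump, so registers and memory change in
-- the same way at every address.
effect : Op → State → State
effect o σ = reg (exec (instr o) (at 0 σ)) ▸ mem (exec (instr o) (at 0 σ))

infixr 5 _⨾_

data Code : Set where
  op    : Op → Code
  _⨾_   : Code → Code → Code
  if0   : Reg → Code → Code → Code
  while : Reg → Code → Code

infix 3 ⟪_⟫_⇓[_]_

data ⟪_⟫_⇓[_]_ : Code → State → ℕ → State → Set where
  b-op     : ∀ {o σ} → ⟪ op o ⟫ σ ⇓[ 1 ] effect o σ
  b-seq    : ∀ {a b σ τ υ s t} → ⟪ a ⟫ σ ⇓[ s ] τ → ⟪ b ⟫ τ ⇓[ t ] υ → ⟪ a ⨾ b ⟫ σ ⇓[ s + t ] υ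
  b-zero   : ∀ {r a b σ τ t} → rg σ r ≡ 0 → ⟪ a ⟫ σ ⇓[ t ] τ → ⟪ if0 r a b ⟫ σ ⇓[ 1 + t ] τ
  -- The extra step is the jump over `a`, which is assembled behind `b`; a zero test jumps straight
  -- to `a` and falls through at its end.
  b-suc    : ∀ {r a b σ τ t m} → rg σ r ≡ suc m → ⟪ b ⟫ σ ⇓[ t ] τ → ⟪ if0 r a b ⟫ σ ⇓[ 1 + (t + 1) ] τ
  b-exit   : ∀ {r a σ} → rg σ r ≡ 0 → ⟪ while r a ⟫ σ ⇓[ 1 ] σ
  b-loop   : ∀ {r a σ τ υ s t m} → rg σ r ≡ suc m → ⟪ a ⟫ σ ⇓[ s ] τ → ⟪ while r a ⟫ τ ⇓[ t ] υ →
             ⟪ while r a ⟫ σ ⇓[ 1 + (s + (1 + t)) ] υ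

size : Code → ℕ
size (op o)      = 1
size (a ⨾ b)     = size a + size b
size (if0 r a b) = suc (size b + suc (size a))
size (while r a) = suc (size a + 1)

-- Jump targets are absolute, so code is assembled for the address `p` at which it will stand.
asm : ℕ → Code → Program
asm p (op o)      = instr o ∷ []
asm p (a ⨾ b)     = asm p a ++ asm (p + size a) b
asm p (if0 r a b) = jz r (suc (suc p + size b)) ∷ asm (suc p) b ++
                    jump (p + size (if0 r a b)) ∷ asm (suc (suc p + size b)) a
asm p (while r a) = jz r (p + size (while r a)) ∷ asm (suc p) a ++ jump p ∷ []

length-asm : ∀ p c → length (asm p c) ≡ size c
length-asm p (op o)      = refl
length-asm p (a ⨾ b)     = trans (length-++ (asm p a)) (cong₂ _+_ (length-asm p a) (length-asm _ b))
length-asm p (if0 r a b) = cong suc (trans (length-++ (asm (suc p) b))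
                             (cong₂ (λ x y → x + suc y) (length-asm _ b) (length-asm _ a)))
length-asm p (while r a) = cong suc (trans (length-++ (asm (suc p) a)) (cong (_+ 1) (length-asm _ a)))

At-asmʳ : ∀ {P p q d} a → At P p (asm q a ++ d) → At P (p + size a) d
At-asmʳ {P} {p} {q} {d} a h = subst (λ l → At P (p + l) d) (length-asm q a) (At-++ʳ (asm q a) h)

arrive : ∀ {P p q σ t x} → p ≡ q → P ⊢ x ⟶[ t ] at p σ → P ⊢ x ⟶[ t ] at q σ
arrive refl r = r

-- The tested value is a separate argument `v`, so that the branch computes once a caller supplies
-- `0` or `suc _`.
jz-step : ∀ {P p r l σ t y} v → fetch P p ≡ just (jz r l) → rg σ r ≡ v →
          P ⊢ at (if v ≡ᵇ 0 then l else suc p) σ ⟶[ t ] y → P ⊢ at p σ ⟶[ suc t ] y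
jz-step v f refl h = next f h

asm-op : ∀ {P p} o σ → fetch P p ≡ just (instr o) → P ⊢ at p σ ⟶[ 1 ] at (suc p) (effect o σ)
asm-op (clr r)   σ f = next f done
asm-op (mov r s) σ f = next f done
asm-op (incr r)  σ f = next f done
asm-op (decr r)  σ f = next f done
asm-op (ld r s)  σ f = next f done
asm-op (st r s)  σ f = next f done

asm-correct : ∀ {P c σ t τ} p → ⟪ c ⟫ σ ⇓[ t ] τ → At P p (asm p c) →
              P ⊢ at p σ ⟶[ t ] at (p + size c) τ
asm-correct p (b-op {o} {σ}) (f , _) = arrive (+-comm 1 p) (asm-op o σ f)
asm-correct p (b-seq {a} {b} x y) h =
  arrive (+-assoc p (size a) (size b))
    (⟶-trans (asm-correct p x (At-++ˡ (asm p a) h)) (asm-correct (p + size a) y (At-asmʳ a h)))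
asm-correct p (b-zero {r} {a} {b} e x) (f , h) =
  arrive end (jz-step 0 f e (asm-correct _ x (proj₂ (At-asmʳ b h))))
  where
  end : suc (suc p + size b) + size a ≡ p + size (if0 r a b)
  end = trans (cong suc (cong suc (+-assoc p (size b) (size a))))
        (sym (trans (+-suc p _) (cong suc (trans (cong (p +_) (+-suc (size b) (size a))) (+-suc p _)))))
asm-correct p (b-suc {r} {a} {b} e x) (f , h) =
  jz-step (suc _) f e (⟶-trans (asm-correct (suc p) x (At-++ˡ (asm (suc p) b) h))
                      (next (proj₁ (At-asmʳ b h)) done))
asm-correct p (b-exit e) (f , h) = jz-step 0 f e done
asm-correct p (b-loop {r} {a} e x y) (f , h) =
  jz-step (suc _) f e (⟶-trans (asm-correct (suc p) x (At-++ˡ (asm (suc p) a) h))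
                      (next (proj₁ (At-asmʳ a h)) (asm-correct p y (f , h))))

asm-halts : ∀ c {σ t τ} → ⟪ c ⟫ σ ⇓[ t ] τ → asm 0 c ⊢ at 0 σ ⇓[ t ] at (size c) τ
asm-halts c r = ⟶-halt (asm-correct 0 r (At-self (asm 0 c)))
  (subst (λ p → fetch (asm 0 c) p ≡ nothing) (length-asm 0 c) (fetch-end (asm 0 c)))

-- Expressions, commands and their compilation

private variable A : Set

≔-same : ∀ a {x y : ℕ} → (if a ≡ᵇ a then x else y) ≡ x
≔-same a with a ≡ᵇ a | ≡⇒≡ᵇ a a refl
... | true | _ = refl

≔-other : ∀ {a b} {x y : ℕ} → a ≢ b → (if a ≡ᵇ b then x else y) ≡ y
≔-other {a} {b} a≢b with a ≡ᵇ b in eq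
... | true  = ⊥-elim (a≢b (≡ᵇ⇒≡ a b (subst T (sym eq) tt)))
... | false = refl

pick : ℕ → A → A → A
pick zero    a b = a
pick (suc _) a b = b

Σ[_] : ℕ → (ℕ → ℕ) → ℕ
Σ[ zero  ] g = 0
Σ[ suc n ] g = Σ[ n ] g + g n

iter : ℕ → (ℕ → A → A) → A → A
iter zero    f a = a
iter (suc n) f a = f n (iter n f a)

-- Registers below this number are program variables; those from it on serve compiled code as a
-- stack.
vars : ℕ
vars = 20

infixl 6 _⊕_ _⊖_

data Expr : Set where
  zero    : Expr
  suc     : Expr → Expr
  var     : (x : ℕ) {_ : T (x <ᵇ vars)} → Expr
  _⊕_ _⊖_ : Expr → Expr → Expr
  if0     : Expr → Expr → Expr → Expr
  rd      : Expr → Expr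
  sum     : (x : ℕ) {_ : T (x <ᵇ vars)} → Expr → Expr → Expr

_⟨_≔_⟩ : State → ℕ → ℕ → State
σ ⟨ x ≔ v ⟩ = rg σ [ x ≔ v ] ▸ mm σ

⟦_⟧ : Expr → State → ℕ
⟦ zero ⟧      σ = 0
⟦ suc e ⟧     σ = suc (⟦ e ⟧ σ)
⟦ var x ⟧     σ = rg σ x
⟦ e ⊕ f ⟧     σ = ⟦ e ⟧ σ + ⟦ f ⟧ σ
⟦ e ⊖ f ⟧     σ = ⟦ e ⟧ σ ∸ ⟦ f ⟧ σ
⟦ if0 e f g ⟧ σ = pick (⟦ e ⟧ σ) (⟦ f ⟧ σ) (⟦ g ⟧ σ)
⟦ rd e ⟧      σ = mm σ (⟦ e ⟧ σ)
⟦ sum x e f ⟧ σ = Σ[ ⟦ e ⟧ σ ] λ j → ⟦ f ⟧ (σ ⟨ x ≔ j ⟩)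

-- The cost of an iteration may depend on its number, hence the start `j`; the two ones are the test
-- and the jump back.
loopCost : ℕ → ℕ → (ℕ → ℕ) → ℕ
loopCost j zero    κ = 1
loopCost j (suc m) κ = 1 + (κ j + (1 + loopCost (suc j) m κ))

drainCost : ℕ → ℕ
drainCost m = loopCost 0 m λ _ → 2

cost : Expr → State → ℕ
cost zero        σ = 1
cost (suc e)     σ = cost e σ + 1
cost (var x)     σ = 1
cost (e ⊕ f)     σ = cost e σ + (cost f σ + drainCost (⟦ f ⟧ σ))
cost (e ⊖ f)     σ = cost e σ + (cost f σ + drainCost (⟦ f ⟧ σ))
cost (if0 e f g) σ = cost e σ + pick (⟦ e ⟧ σ) (1 + cost f σ) (1 + (cost g σ + 1))
cost (rd e)      σ = cost e σ + 1
cost (sum x e f) σ = cost e σ + (1 + (1 + (1 + (loopCost 0 (⟦ e ⟧ σ) (λ j →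
  1 + (cost f (σ ⟨ x ≔ j ⟩) + (drainCost (⟦ f ⟧ (σ ⟨ x ≔ j ⟩)) + 1))) + 1))))

evalCode : Expr → ℕ → Code
evalCode zero        t = op (clr t)
evalCode (suc e)     t = evalCode e t ⨾ op (incr t)
evalCode (var x)     t = op (mov t x)
evalCode (e ⊕ f)     t = evalCode e t ⨾ evalCode f (suc t) ⨾ while (suc t) (op (decr (suc t)) ⨾ op (incr t))
evalCode (e ⊖ f)     t = evalCode e t ⨾ evalCode f (suc t) ⨾ while (suc t) (op (decr (suc t)) ⨾ op (decr t))
evalCode (if0 e f g) t = evalCode e t ⨾ if0 t (evalCode f t) (evalCode g t)
evalCode (rd e)      t = evalCode e t ⨾ op (ld t t)
-- Register `t` accumulates, `1 + t` counts down from the value of `e`, `2 + t` saves the variable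
-- `x`, and `3 + t` receives each summand; `x` itself is the running index and is restored at the
-- end.
evalCode (sum x e f) t =
  evalCode e (1 + t) ⨾ op (mov (2 + t) x) ⨾ op (clr x) ⨾ op (clr t) ⨾
  while (1 + t) (op (decr (1 + t)) ⨾ evalCode f (3 + t) ⨾
                 while (3 + t) (op (decr (3 + t)) ⨾ op (incr t)) ⨾ op (incr x)) ⨾
  op (mov x (2 + t))

-- The register counts down while the index of the invariant counts up. Keeping `j + m ≡ N` allows
-- the invariant to speak of the number of completed iterations.
while-rule : ∀ {r c} N (I : ℕ → State → Set) (κ : ℕ → ℕ) →
  (∀ j m σ → j < N → I j σ → rg σ r ≡ suc m → ∃[ τ ] (⟪ c ⟫ σ ⇓[ κ j ] τ) × I (suc j) τ × rg τ r ≡ m) →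
  ∀ m j σ → j + m ≡ N → I j σ → rg σ r ≡ m →
  ∃[ τ ] (⟪ while r c ⟫ σ ⇓[ loopCost j m κ ] τ) × I N τ × rg τ r ≡ 0
while-rule N I κ body zero    j σ refl i e = σ , b-exit e , subst (λ l → I l σ) (sym (+-identityʳ j)) i , e
while-rule N I κ body (suc m) j σ refl i e
  with τ , x , i′ , e′ ← body j m σ (m<m+n j (s≤s z≤n)) i e
  with υ , y , i″ , z ← while-rule N I κ body m (suc j) τ (sym (+-suc j m)) i′ e′
  = υ , b-loop e x y , i″ , z

infix 4 _∼_

-- Relates a machine state to a state of the semantics; the stack registers are left free.
_∼_ : State → State → Set
S ∼ σ = (∀ x → x < vars → rg S x ≡ rg σ x) × mm S ≡ mm σ

record Evaluates (c : Code) (t τ v : ℕ) (S : State) : Set where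
  constructor evaluates
  field
    final : ℕ → ℕ
    runs  : ⟪ c ⟫ S ⇓[ τ ] (final ▸ mm S)
    value : final t ≡ v
    keeps : ∀ r → r < t → final r ≡ rg S r

∼-keep : ∀ {S R σ t} → vars ≤ t → (∀ r → r < t → R r ≡ rg S r) → S ∼ σ → R ▸ mm S ∼ σ
∼-keep V≤t k (a , m) = (λ x x<V → trans (k x (<-≤-trans x<V V≤t)) (a x x<V)) , m

∼-≔ : ∀ {S R σ} x j → R x ≡ j → (∀ r → r < vars → x ≢ r → R r ≡ rg S r) → S ∼ σ → R ▸ mm S ∼ σ ⟨ x ≔ j ⟩
∼-≔ {S} {R} {σ} x j e k (a , m) = f , m
  where
  f : ∀ r → r < vars → R r ≡ (rg σ [ x ≔ j ]) r
  f r r<V with x ≟ r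
  ... | yes refl = trans e (sym (≔-same x))
  ... | no x≢r   = trans (k r r<V x≢r) (trans (a r r<V) (sym (≔-other x≢r)))

t≢1+t : ∀ {t} → t ≢ suc t
t≢1+t {t} = <⇒≢ (n<1+n t)

-- One loop serves addition, truncated subtraction and the accumulation of sums: `r` is emptied
-- while `o` acts on `s` once per unit.
module Drain (o : ℕ → Op) (f : ℕ → ℕ) {s r : ℕ} (s<r : s < r)
             (eff : ∀ σ → effect (o s) σ ≡ σ ⟨ s ≔ f (rg σ s) ⟩) where

  private
    module _ (σ : State) where

      I : ℕ → State → Set
      I j τ = mm τ ≡ mm σ × rg τ s ≡ iter j (λ _ → f) (rg σ s) × (∀ q → q < r → q ≢ s → rg τ q ≡ rg σ q)

      body : ∀ j l τ → I j τ → rg τ r ≡ suc l →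
             ∃[ υ ] (⟪ op (decr r) ⨾ op (o s) ⟫ τ ⇓[ 2 ] υ) × I (suc j) υ × rg υ r ≡ l
      body j l τ (mq , v , k) e =
        υ , subst (λ ω → ⟪ op (decr r) ⨾ op (o s) ⟫ τ ⇓[ 2 ] ω) (eff _) (b-seq b-op b-op) ,
        (mq , trans (≔-same s) (cong f (trans (≔-other (>⇒≢ s<r)) v)) ,
         λ q q<r q≢s → trans (≔-other (≢-sym q≢s)) (trans (≔-other (>⇒≢ q<r)) (k q q<r q≢s))) ,
        trans (≔-other (<⇒≢ s<r)) (trans (≔-same r) (cong pred e))
        where
        υ : State
        υ = τ ⟨ r ≔ pred (rg τ r) ⟩ ⟨ s ≔ f ((rg τ [ r ≔ pred (rg τ r) ]) s) ⟩

  rule : ∀ m σ → rg σ r ≡ m →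
    ∃[ R ] (⟪ while r (op (decr r) ⨾ op (o s)) ⟫ σ ⇓[ drainCost m ] (R ▸ mm σ)) ×
           R s ≡ iter m (λ _ → f) (rg σ s) × (∀ q → q < r → q ≢ s → R q ≡ rg σ q)
  rule m σ e
    with τ , x , (refl , v , k) , _ ← while-rule m (I σ) (λ _ → 2) (λ j l τ _ → body σ j l τ)
                                        m 0 σ refl (refl , refl , λ _ _ _ → refl) e
    = rg τ , x , v , k

private
  iter-suc : ∀ m v → iter m (λ _ → suc) v ≡ v + m
  iter-suc zero    v = sym (+-identityʳ v)
  iter-suc (suc m) v = trans (cong suc (iter-suc m v)) (sym (+-suc v m))

  iter-pred : ∀ m v → iter m (λ _ → pred) v ≡ v ∸ m
  iter-pred zero    v = refl
  iter-pred (suc m) v = trans (cong pred (iter-pred m v)) (pred[m∸n]≡m∸[1+n] v m)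

module SumLoop (x : ℕ) (x<V : x < vars) (f : Expr) {t : ℕ} (V≤t : vars ≤ t) {S σ : State} (a : S ∼ σ)
               (f-correct : ∀ {T j} → T ∼ σ ⟨ x ≔ j ⟩ →
                 Evaluates (evalCode f (3 + t)) (3 + t) (cost f (σ ⟨ x ≔ j ⟩)) (⟦ f ⟧ (σ ⟨ x ≔ j ⟩)) T)
               (N : ℕ) {R₀ : ℕ → ℕ} (k₀ : ∀ r → r < suc t → R₀ r ≡ rg S r) where

  x<t : x < t
  x<t = <-≤-trans x<V V≤t

  g κ : ℕ → ℕ
  g j = ⟦ f ⟧ (σ ⟨ x ≔ j ⟩)
  κ j = 1 + (cost f (σ ⟨ x ≔ j ⟩) + (drainCost (g j) + 1))

  t≢ : ∀ d → t ≢ suc (d + t)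
  t≢ d = <⇒≢ (s≤s (m≤n+m t d))

  x≢t+ : ∀ d → x ≢ d + t
  x≢t+ d = <⇒≢ (<-≤-trans x<t (m≤n+m t d))

  I : ℕ → State → Set
  I j τ = mm τ ≡ mm S × rg τ t ≡ Σ[ j ] g × rg τ x ≡ j × rg τ (2 + t) ≡ R₀ x ×
          (∀ q → q < t → x ≢ q → rg τ q ≡ R₀ q)

  body : ∀ j m τ → j < N → I j τ → rg τ (1 + t) ≡ suc m →
    ∃[ υ ] (⟪ op (decr (1 + t)) ⨾ evalCode f (3 + t) ⨾
              while (3 + t) (op (decr (3 + t)) ⨾ op (incr t)) ⨾ op (incr x) ⟫ τ ⇓[ κ j ] υ) ×
           I (suc j) υ × rg υ (1 + t) ≡ m
  body j m τ _ (refl , acc , idx , saved , kept) e₁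
    with evaluates R₁ x₁ v₁ k₁ ← f-correct {τ ⟨ 1 + t ≔ pred (rg τ (1 + t)) ⟩} {j}
           (∼-≔ x j (trans (≔-other (≢-sym (x≢t+ 1))) idx)
             (λ r r<V x≢r → trans (≔-other (>⇒≢ (<-≤-trans r<V (m≤n⇒m≤1+n V≤t))))
                (trans (kept r (<-≤-trans r<V V≤t) x≢r) (k₀ r (m<n⇒m<1+n (<-≤-trans r<V V≤t))))) a)
    with R₂ , x₂ , v₂ , k₂ ← Drain.rule incr suc {t} {3 + t} (s≤s (m≤n+m t 2)) (λ _ → refl) _ (R₁ ▸ mm τ) v₁
    = _ , b-seq b-op (b-seq x₁ (b-seq x₂ b-op)) ,
      (refl ,
       trans (≔-other (<⇒≢ x<t)) (trans v₂ (trans (iter-suc (g j) (R₁ t))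
         (cong (_+ g j) (trans (low t (m≤n+m _ 2) (≢-sym (t≢ 0))) acc)))) ,
       trans (≔-same x) (cong suc (trans (k₂ x (<-≤-trans x<t (m≤n+m t 3)) (<⇒≢ x<t))
         (trans (low x (<-≤-trans x<t (m≤n+m t 3)) (≢-sym (x≢t+ 1))) idx))) ,
       trans (≔-other (x≢t+ 2)) (trans (k₂ (2 + t) (n<1+n _) (≢-sym (t≢ 1)))
         (trans (low (2 + t) (n<1+n _) (<⇒≢ (n<1+n _))) saved)) ,
       λ q q<t x≢q → trans (≔-other x≢q) (trans (k₂ q (<-≤-trans q<t (m≤n+m t 3)) (<⇒≢ q<t))
         (trans (low q (<-≤-trans q<t (m≤n+m t 3)) (>⇒≢ (m<n⇒m<1+n q<t))) (kept q q<t x≢q)))) ,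
      trans (≔-other (x≢t+ 1)) (trans (k₂ (1 + t) (m≤n+m _ 1) (≢-sym (t≢ 0)))
        (trans (k₁ (1 + t) (m≤n+m _ 1)) (trans (≔-same (1 + t)) (cong pred e₁))))
    where
    low : ∀ q → q < 3 + t → 1 + t ≢ q → R₁ q ≡ rg τ q
    low q q< ne = trans (k₁ q q<) (≔-other ne)

  rule : rg (R₀ ▸ mm S) (suc t) ≡ N →
    ∃[ R ] (⟪ op (mov (2 + t) x) ⨾ op (clr x) ⨾ op (clr t) ⨾
              while (1 + t) (op (decr (1 + t)) ⨾ evalCode f (3 + t) ⨾
                while (3 + t) (op (decr (3 + t)) ⨾ op (incr t)) ⨾ op (incr x)) ⨾
              op (mov x (2 + t)) ⟫ (R₀ ▸ mm S) ⇓[ 1 + (1 + (1 + (loopCost 0 N κ + 1))) ] (R ▸ mm S)) ×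
           R t ≡ Σ[ N ] g × (∀ r → r < t → R r ≡ rg S r)
  rule v
    with τ , r₂ , (refl , acc , idx , saved , kept) , _ ←
      while-rule N I κ body N 0 ((R₀ ▸ mm S) ⟨ 2 + t ≔ R₀ x ⟩ ⟨ x ≔ 0 ⟩ ⟨ t ≔ 0 ⟩) refl
        (refl , ≔-same t , trans (≔-other (>⇒≢ x<t)) (≔-same x) ,
         trans (≔-other (t≢ 1)) (trans (≔-other (x≢t+ 2)) (≔-same (2 + t))) ,
         λ q q<t x≢q → trans (≔-other (>⇒≢ q<t)) (trans (≔-other x≢q)
           (≔-other (>⇒≢ (<-≤-trans q<t (m≤n+m t 2))))))
        (trans (≔-other (t≢ 0)) (trans (≔-other (x≢t+ 1)) (trans (≔-other {2 + t} {1 + t} (≢-sym t≢1+t)) v)))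
    = _ , b-seq b-op (b-seq b-op (b-seq b-op (b-seq r₂ b-op))) , trans (≔-other (<⇒≢ x<t)) acc , restored
    where
    restored : ∀ r → r < t → (rg τ [ x ≔ rg τ (2 + t) ]) r ≡ rg S r
    restored r r<t with x ≟ r
    ... | yes refl = trans (≔-same x) (trans saved (k₀ x (m<n⇒m<1+n r<t)))
    ... | no x≢r   = trans (≔-other x≢r) (trans (kept r r<t x≢r) (k₀ r (m<n⇒m<1+n r<t)))

eval-correct : ∀ e {t S σ} → vars ≤ t → S ∼ σ → Evaluates (evalCode e t) t (cost e σ) (⟦ e ⟧ σ) S
eval-correct zero {t} V≤t a =
  evaluates _ b-op (≔-same t) λ r r<t → ≔-other (>⇒≢ r<t)
eval-correct (suc e) {t} V≤t a with evaluates R x v k ← eval-correct e V≤t a =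
  evaluates _ (b-seq x b-op) (trans (≔-same t) (cong suc v))
    λ r r<t → trans (≔-other (>⇒≢ r<t)) (k r r<t)
eval-correct (var x {p}) {t} V≤t a =
  evaluates _ b-op (trans (≔-same t) (proj₁ a x (<ᵇ⇒< x vars p))) λ r r<t → ≔-other (>⇒≢ r<t)
eval-correct (e ⊕ f) {t} {S} {σ} V≤t a
  with evaluates R x v k ← eval-correct e V≤t a
  with evaluates R′ x′ v′ k′ ← eval-correct f {suc t} (m≤n⇒m≤1+n V≤t) (∼-keep {S} V≤t k a)
  with R″ , x″ , v″ , k″ ← Drain.rule incr suc (n<1+n t) (λ _ → refl) _ (R′ ▸ mm S) v′
  = evaluates R″ (b-seq x (b-seq x′ x″))
      (trans v″ (trans (iter-suc (⟦ f ⟧ σ) (R′ t)) (cong (_+ ⟦ f ⟧ σ) (trans (k′ t (n<1+n t)) v))))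
      λ r r<t → trans (k″ r (m<n⇒m<1+n r<t) (<⇒≢ r<t)) (trans (k′ r (m<n⇒m<1+n r<t)) (k r r<t))
eval-correct (e ⊖ f) {t} {S} {σ} V≤t a
  with evaluates R x v k ← eval-correct e V≤t a
  with evaluates R′ x′ v′ k′ ← eval-correct f {suc t} (m≤n⇒m≤1+n V≤t) (∼-keep {S} V≤t k a)
  with R″ , x″ , v″ , k″ ← Drain.rule decr pred (n<1+n t) (λ _ → refl) _ (R′ ▸ mm S) v′
  = evaluates R″ (b-seq x (b-seq x′ x″))
      (trans v″ (trans (iter-pred (⟦ f ⟧ σ) (R′ t)) (cong (_∸ ⟦ f ⟧ σ) (trans (k′ t (n<1+n t)) v))))
      λ r r<t → trans (k″ r (m<n⇒m<1+n r<t) (<⇒≢ r<t)) (trans (k′ r (m<n⇒m<1+n r<t)) (k r r<t))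
eval-correct (if0 e f g) {t} {S} {σ} V≤t a
  with evaluates R x v k ← eval-correct e V≤t a
  with ⟦ e ⟧ σ | v
... | zero  | v₀ with evaluates R′ x′ v′ k′ ← eval-correct f V≤t (∼-keep {S} V≤t k a)
  = evaluates R′ (b-seq x (b-zero v₀ x′)) v′ λ r r<t → trans (k′ r r<t) (k r r<t)
... | suc _ | v₁ with evaluates R′ x′ v′ k′ ← eval-correct g V≤t (∼-keep {S} V≤t k a)
  = evaluates R′ (b-seq x (b-suc v₁ x′)) v′ λ r r<t → trans (k′ r r<t) (k r r<t)
eval-correct (rd e) {t} V≤t a with evaluates R x v k ← eval-correct e V≤t a =
  evaluates _ (b-seq x b-op) (trans (≔-same t) (cong₂ (λ f → f) (proj₂ a) v))
    λ r r<t → trans (≔-other (>⇒≢ r<t)) (k r r<t)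
eval-correct (sum x {p} e f) {t} {S} {σ} V≤t a
  with evaluates R r₁ v k ← eval-correct e {suc t} (m≤n⇒m≤1+n V≤t) a
  with R′ , r₂ , v′ , k′ ←
    SumLoop.rule x (<ᵇ⇒< x vars p) f V≤t {S} {σ} a (eval-correct f (≤-trans V≤t (m≤n+m t 3))) (⟦ e ⟧ σ) {R} k v
  = evaluates R′ (b-seq r₁ r₂) v′ k′

-- Commands with bounded loops.

infixr 5 _⨟_

data Cmd : Set where
  skip : Cmd
  set  : (x : ℕ) {_ : T (x <ᵇ vars)} → Expr → Cmd
  put  : Expr → Expr → Cmd
  _⨟_  : Cmd → Cmd → Cmd
  if0  : Expr → Cmd → Cmd → Cmd
  for  : (i : ℕ) {_ : T (i <ᵇ vars)} (x : ℕ) {_ : T (x <ᵇ vars)} → Cmd → Cmd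

run : Cmd → State → State
run skip        σ = σ
run (set x e)   σ = σ ⟨ x ≔ ⟦ e ⟧ σ ⟩
run (put a e)   σ = rg σ ▸ mm σ [ ⟦ a ⟧ σ ≔ ⟦ e ⟧ σ ]
run (c ⨟ d)     σ = run d (run c σ)
run (if0 e c d) σ = pick (⟦ e ⟧ σ) (run c σ) (run d σ)
run (for i x c) σ = iter (rg σ x) (λ j τ → run c (τ ⟨ i ≔ j ⟩)) σ

forState : ℕ → Cmd → State → ℕ → State
forState i c σ j = iter j (λ j τ → run c (τ ⟨ i ≔ j ⟩)) σ

runCost : Cmd → State → ℕ
runCost skip        σ = 1
runCost (set x e)   σ = cost e σ + 1
runCost (put a e)   σ = cost a σ + (cost e σ + 1)
runCost (c ⨟ d)     σ = runCost c σ + runCost d (run c σ)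
runCost (if0 e c d) σ = cost e σ + pick (⟦ e ⟧ σ) (1 + runCost c σ) (1 + (runCost d σ + 1))
runCost (for i x c) σ = 1 + (1 + loopCost 0 (rg σ x) (λ j →
  1 + (1 + (runCost c (forState i c σ j ⟨ i ≔ j ⟩) + 1))))

compile : Cmd → ℕ → Code
-- There is no empty `Code`; clearing a free stack register stands in for it.
compile skip        t = op (clr t)
compile (set x e)   t = evalCode e t ⨾ op (mov x t)
compile (put a e)   t = evalCode a t ⨾ evalCode e (suc t) ⨾ op (st t (suc t))
compile (c ⨟ d)     t = compile c t ⨾ compile d t
compile (if0 e c d) t = evalCode e t ⨾ if0 t (compile c t) (compile d t)
-- The bound is copied to the stack and the counter lives there too, so the number of iterations is
-- fixed even if the body overwrites `x` or `i`, as in `run`.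
compile (for i x c) t = op (mov t x) ⨾ op (clr (1 + t)) ⨾
  while t (op (decr t) ⨾ op (mov i (1 + t)) ⨾ compile c (2 + t) ⨾ op (incr (1 + t)))

record Executes (c : Code) (t τ : ℕ) (σ : State) (S : State) : Set where
  constructor executes
  field
    {final} : State
    runs    : ⟪ c ⟫ S ⇓[ τ ] final
    agrees  : final ∼ σ
    keeps   : ∀ r → vars ≤ r → r < t → rg final r ≡ rg S r

module ForLoop (i : ℕ) (i<V : i < vars) (c : Cmd) {t : ℕ} (V≤t : vars ≤ t) (N : ℕ) {S σ : State}
               (c-correct : ∀ {T τ} → T ∼ τ → Executes (compile c (2 + t)) (2 + t) (runCost c τ) (run c τ) T) where

  κ : ℕ → ℕ
  κ j = 1 + (1 + (runCost c (forState i c σ j ⟨ i ≔ j ⟩) + 1))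

  I : ℕ → State → Set
  I j T = T ∼ forState i c σ j × rg T (1 + t) ≡ j × (∀ r → vars ≤ r → r < t → rg T r ≡ rg S r)

  i≢t+ : ∀ d → i ≢ d + t
  i≢t+ d = <⇒≢ (<-≤-trans i<V (≤-trans V≤t (m≤n+m t d)))

  body : ∀ j m T → j < N → I j T → rg T t ≡ suc m →
    ∃[ U ] (⟪ op (decr t) ⨾ op (mov i (1 + t)) ⨾ compile c (2 + t) ⨾ op (incr (1 + t)) ⟫ T ⇓[ κ j ] U) ×
           I (suc j) U × rg U t ≡ m
  body j m T _ (a , idx , k) e
    with executes {U} r a′ k′ ← c-correct
           {T ⟨ t ≔ pred (rg T t) ⟩ ⟨ i ≔ rg (T ⟨ t ≔ pred (rg T t) ⟩) (1 + t) ⟩} {forState i c σ j ⟨ i ≔ j ⟩}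
           (∼-≔ {T} i j (trans (≔-same i) (trans (≔-other {t} {1 + t} t≢1+t) idx))
             (λ r r<V i≢r → trans (≔-other i≢r) (≔-other (>⇒≢ (<-≤-trans r<V V≤t)))) a)
    = _ , b-seq b-op (b-seq b-op (b-seq r b-op)) ,
      (((λ r r<V → trans (≔-other (>⇒≢ (<-≤-trans r<V (m≤n⇒m≤1+n V≤t)))) (proj₁ a′ r r<V)) , proj₂ a′) ,
       trans (≔-same (1 + t)) (cong suc (trans (k′ (1 + t) (m≤n⇒m≤1+n V≤t) (n<1+n _))
         (trans (≔-other (i≢t+ 1)) (trans (≔-other {t} {1 + t} t≢1+t) idx)))) ,
       λ r V≤r r<t → trans (≔-other (>⇒≢ (m<n⇒m<1+n r<t))) (trans (k′ r V≤r (<-≤-trans r<t (m≤n+m t 2)))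
         (trans (≔-other (<⇒≢ (<-≤-trans i<V V≤r))) (trans (≔-other (>⇒≢ r<t)) (k r V≤r r<t))))) ,
      trans (≔-other {1 + t} {t} (≢-sym t≢1+t)) (trans (k′ t V≤t (m≤n+m _ 1))
        (trans (≔-other (i≢t+ 0)) (trans (≔-same t) (cong pred e))))

run-correct : ∀ c {t S σ} → vars ≤ t → S ∼ σ → Executes (compile c t) t (runCost c σ) (run c σ) S
run-correct skip {t} V≤t (a , m) = executes b-op
  ((λ x x<V → trans (≔-other (>⇒≢ (<-≤-trans x<V V≤t))) (a x x<V)) , m) λ r _ r<t → ≔-other (>⇒≢ r<t)
run-correct (set x {p} e) {t} {S} V≤t a with evaluates R r v k ← eval-correct e V≤t a =
  executes (b-seq r b-op)
    (∼-≔ {S} x _ (trans (≔-same x) v)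
      (λ r r<V x≢r → trans (≔-other x≢r) (k r (<-≤-trans r<V V≤t))) a)
    λ r V≤r r<t → trans (≔-other (<⇒≢ (<-≤-trans (<ᵇ⇒< x vars p) V≤r))) (k r r<t)
run-correct (put e f) {t} {S} {σ} V≤t a
  with evaluates R r v k ← eval-correct e V≤t a
  with evaluates R′ r′ v′ k′ ← eval-correct f {suc t} (m≤n⇒m≤1+n V≤t) (∼-keep {S} V≤t k a)
  = executes (b-seq r (b-seq r′ b-op))
      ((λ x x<V → trans (k′ x (<-≤-trans x<V (m≤n⇒m≤1+n V≤t))) (trans (k x (<-≤-trans x<V V≤t)) (proj₁ a x x<V))) ,
       trans (cong₂ (λ l w → mm S [ l ≔ w ]) (trans (k′ t (n<1+n t)) v) v′) (cong (λ M → M [ ⟦ e ⟧ σ ≔ ⟦ f ⟧ σ ]) (proj₂ a)))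
      λ r _ r<t → trans (k′ r (m<n⇒m<1+n r<t)) (k r r<t)
run-correct (c ⨟ d) V≤t a
  with executes r a′ k ← run-correct c V≤t a
  with executes r′ a″ k′ ← run-correct d V≤t a′
  = executes (b-seq r r′) a″ λ q V≤q q<t → trans (k′ q V≤q q<t) (k q V≤q q<t)
run-correct (if0 e c d) {t} {S} {σ} V≤t a
  with evaluates R x v k ← eval-correct e V≤t a
  with ⟦ e ⟧ σ | v
... | zero  | v₀ with executes r a′ k′ ← run-correct c V≤t (∼-keep {S} V≤t k a)
  = executes (b-seq x (b-zero v₀ r)) a′ λ q V≤q q<t → trans (k′ q V≤q q<t) (k q q<t)
... | suc _ | v₁ with executes r a′ k′ ← run-correct d V≤t (∼-keep {S} V≤t k a)
  = executes (b-seq x (b-suc v₁ r)) a′ λ q V≤q q<t → trans (k′ q V≤q q<t) (k q q<t)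
run-correct (for i {p} x {q} c) {t} {S} {σ} V≤t (a , m)
  with U , r , (a′ , _ , k) , _ ← while-rule (rg σ x) (ForLoop.I i (<ᵇ⇒< i vars p) c V≤t (rg σ x) {S} {σ} (run-correct c (m≤n⇒m≤o+n 2 V≤t)))
         (ForLoop.κ i (<ᵇ⇒< i vars p) c V≤t (rg σ x) {S} {σ} (run-correct c (m≤n⇒m≤o+n 2 V≤t)))
         (ForLoop.body i (<ᵇ⇒< i vars p) c V≤t (rg σ x) {S} {σ} (run-correct c (m≤n⇒m≤o+n 2 V≤t)))
         (rg σ x) 0 (S ⟨ t ≔ rg S x ⟩ ⟨ 1 + t ≔ 0 ⟩) refl
         (((λ r r<V → trans (≔-other (>⇒≢ (<-≤-trans r<V (m≤n⇒m≤1+n V≤t))))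
                       (trans (≔-other (>⇒≢ (<-≤-trans r<V V≤t))) (a r r<V))) , m) ,
          ≔-same (1 + t) ,
          λ r V≤r r<t → trans (≔-other (>⇒≢ (m<n⇒m<1+n r<t))) (≔-other (>⇒≢ r<t)))
         (trans (≔-other {1 + t} {t} (≢-sym t≢1+t)) (trans (≔-same t) (a x (<ᵇ⇒< x vars q))))
  = executes (b-seq b-op (b-seq b-op r)) a′ k

-- Static bounds on running times

-- Stands for `C * (1 + b) ^ d`. As the base is at least 1, adding exponents dominates both summands
-- of a sum; hence single monomials are closed under sum, product and composition, at the price of
-- generous exponents.
record Mono : Set where
  constructor _·B^_
  field
    coeff degree : ℕ

infixl 6 _⊞_
infixl 7 _⊠_
infixr 8 _⊚_

atMost : Mono → ℕ → ℕ
atMost (C ·B^ d) b = C * suc b ^ d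

const : ℕ → Mono
const k = k ·B^ 0

idᵐ : Mono
idᵐ = 1 ·B^ 1

_⊞_ _⊠_ _⊚_ : Mono → Mono → Mono
(C ·B^ d) ⊞ (D ·B^ e) = (C + D) ·B^ (d + e)
(C ·B^ d) ⊠ (D ·B^ e) = (C * D) ·B^ (d + e)
(C ·B^ d) ⊚ (D ·B^ e) = (C * suc D ^ d) ·B^ (e * d)

^-suc-pos : ∀ b d → 1 ≤ suc b ^ d
^-suc-pos b d = m^n>0 (suc b) d

≤-const : ∀ k {x} → x ≤ k → x ≤ k * 1
≤-const k x≤k = ≤-trans x≤k (≤-reflexive (sym (*-identityʳ k)))

≤-id : ∀ {x b} → x ≤ b → x ≤ atMost idᵐ b
≤-id {x} {b} x≤b = ≤-trans (m≤n⇒m≤1+n x≤b)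
  (≤-reflexive (trans (sym (^-identityʳ (suc b))) (sym (+-identityʳ _))))

≤-⊞ : ∀ p q {x y b} → x ≤ atMost p b → y ≤ atMost q b → x + y ≤ atMost (p ⊞ q) b
≤-⊞ (C ·B^ d) (D ·B^ e) {b = b} x≤ y≤ = ≤-trans (+-mono-≤ x≤ y≤) $ begin
  C * B ^ d + D * B ^ e               ≤⟨ +-mono-≤ (*-monoʳ-≤ C (^-monoʳ-≤ B (m≤m+n d e)))
                                                  (*-monoʳ-≤ D (^-monoʳ-≤ B (m≤n+m e d))) ⟩
  C * B ^ (d + e) + D * B ^ (d + e)   ≡⟨ *-distribʳ-+ (B ^ (d + e)) C D ⟨
  (C + D) * B ^ (d + e)               ∎
  where open ≤-Reasoning
        B = suc b

*-swap-mid : ∀ a b c d → a * b * (c * d) ≡ a * c * (b * d)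
*-swap-mid = solve-∀

≤-⊠ : ∀ p q {x y b} → x ≤ atMost p b → y ≤ atMost q b → x * y ≤ atMost (p ⊠ q) b
≤-⊠ (C ·B^ d) (D ·B^ e) {b = b} x≤ y≤ = ≤-trans (*-mono-≤ x≤ y≤) $ ≤-reflexive $
  trans (*-swap-mid C (suc b ^ d) D (suc b ^ e)) (cong (C * D *_) (sym (^-distribˡ-+-* (suc b) d e)))

atMost-mono : ∀ p {b c} → b ≤ c → atMost p b ≤ atMost p c
atMost-mono (C ·B^ d) b≤c = *-monoʳ-≤ C (^-monoˡ-≤ d (s≤s b≤c))

≤-⊚ : ∀ p q {x y b} → x ≤ atMost p y → y ≤ atMost q b → x ≤ atMost (p ⊚ q) b
≤-⊚ p@(C ·B^ d) q@(D ·B^ e) {x} {y} {b} x≤ y≤ = begin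
  x                                  ≤⟨ x≤ ⟩
  C * suc y ^ d                      ≤⟨ *-monoʳ-≤ C (^-monoˡ-≤ d (s≤s y≤)) ⟩
  -- Since `B ^ e` is at least 1 it absorbs the added 1, which makes the inner bound a monomial
  -- again.
  C * (1 + D * B ^ e) ^ d            ≤⟨ *-monoʳ-≤ C (^-monoˡ-≤ d (+-monoˡ-≤ (D * B ^ e) (^-suc-pos b e))) ⟩
  C * (suc D * B ^ e) ^ d            ≡⟨ cong (C *_) (^-distrib-* (suc D) (B ^ e) d) ⟩
  C * (suc D ^ d * (B ^ e) ^ d)      ≡⟨ *-assoc C _ _ ⟨
  C * suc D ^ d * (B ^ e) ^ d        ≡⟨ cong (C * suc D ^ d *_) (^-*-assoc B e d) ⟩
  C * suc D ^ d * B ^ (e * d)        ∎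
  where
  open ≤-Reasoning
  B = suc b
  ^-distrib-* : ∀ m n k → (m * n) ^ k ≡ m ^ k * n ^ k
  ^-distrib-* m n zero    = refl
  ^-distrib-* m n (suc k) = trans (cong (m * n *_) (^-distrib-* m n k)) (*-swap-mid m n (m ^ k) (n ^ k))

record Bounded (b : ℕ) (σ : State) : Set where
  constructor bounded
  field
    regs  : ∀ x → x < vars → rg σ x ≤ b
    cells : ∀ a → mm σ a ≤ b

open Bounded

≔-≤ : ∀ {b} a v c (f : ℕ → ℕ) → v ≤ b → f c ≤ b → (f [ a ≔ v ]) c ≤ b
≔-≤ a v c f v≤b f≤b with a ≟ c
... | yes refl = ≤-trans (≤-reflexive (≔-same a)) v≤b
... | no a≢c   = ≤-trans (≤-reflexive (≔-other a≢c)) f≤b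

bounded-≔ : ∀ {b σ} x {v} → Bounded b σ → v ≤ b → Bounded b (σ ⟨ x ≔ v ⟩)
bounded-≔ {σ = σ} x β v≤b = bounded (λ y y<V → ≔-≤ x _ y (rg σ) v≤b (regs β y y<V)) (cells β)

bounded-put : ∀ {b σ} a {v} → Bounded b σ → v ≤ b → Bounded b (rg σ ▸ mm σ [ a ≔ v ])
bounded-put {σ = σ} a β v≤b = bounded (regs β) λ c → ≔-≤ a _ c (mm σ) v≤b (cells β c)

bounded-mono : ∀ {b c σ} → b ≤ c → Bounded b σ → Bounded c σ
bounded-mono b≤c β = bounded (λ x x<V → ≤-trans (regs β x x<V) b≤c) λ a → ≤-trans (cells β a) b≤c

valueᵐ : Expr → Mono
valueᵐ zero        = const 0
valueᵐ (suc e)     = const 1 ⊞ valueᵐ e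
valueᵐ (var x)     = idᵐ
valueᵐ (e ⊕ f)     = valueᵐ e ⊞ valueᵐ f
valueᵐ (e ⊖ f)     = valueᵐ e
valueᵐ (if0 e f g) = valueᵐ f ⊞ valueᵐ g
valueᵐ (rd e)      = idᵐ
-- The index stays below the value of `e`, so the body is evaluated in a state bounded by `b` plus
-- that value.
valueᵐ (sum x e f) = valueᵐ e ⊠ valueᵐ f ⊚ (idᵐ ⊞ valueᵐ e)

Σ-≤ : ∀ n {g B} → (∀ i → i < n → g i ≤ B) → Σ[ n ] g ≤ n * B
Σ-≤ zero    h = z≤n
Σ-≤ (suc n) {g} {B} h = ≤-trans (+-mono-≤ (Σ-≤ n λ i i<n → h i (m<n⇒m<1+n i<n)) (h n (n<1+n n)))
  (≤-reflexive (+-comm (n * B) B))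

pick-≤ : ∀ n {a b a′ b′} → a ≤ a′ → b ≤ b′ → pick n a b ≤ a′ + b′
pick-≤ zero    a≤ b≤ = ≤-trans a≤ (m≤m+n _ _)
pick-≤ (suc n) a≤ b≤ = ≤-trans b≤ (m≤n+m _ _)

loopCost-≤ : ∀ j m {κ B} → (∀ i → i < j + m → κ i ≤ B) → loopCost j m κ ≤ 1 + m * (2 + B)
loopCost-≤ j zero    h = ≤-refl
loopCost-≤ j (suc m) {κ} {B} h = s≤s $ begin
  κ j + suc (loopCost (suc j) m κ)  ≤⟨ +-mono-≤ (h j (m<m+n j (s≤s z≤n)))
                                         (s≤s (loopCost-≤ (suc j) m λ i i< → h i (subst (i <_) (sym (+-suc j m)) i<))) ⟩
  B + suc (suc (m * (2 + B)))       ≡⟨ trans (+-suc B _) (cong suc (+-suc B _)) ⟩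
  suc (suc (B + m * (2 + B)))       ∎
  where open ≤-Reasoning

value-≤ : ∀ e {b σ} → Bounded b σ → ⟦ e ⟧ σ ≤ atMost (valueᵐ e) b
value-≤ zero        β = z≤n
value-≤ (suc e)     β = ≤-⊞ (const 1) (valueᵐ e) (≤-const 1 ≤-refl) (value-≤ e β)
value-≤ (var x {p}) β = ≤-id (regs β x (<ᵇ⇒< x vars p))
value-≤ (e ⊕ f)     β = ≤-⊞ (valueᵐ e) (valueᵐ f) (value-≤ e β) (value-≤ f β)
value-≤ (e ⊖ f) {σ = σ} β = ≤-trans (m∸n≤m _ (⟦ f ⟧ σ)) (value-≤ e β)
value-≤ (if0 e f g) {b} {σ} β = ≤-trans (pick-≤ (⟦ e ⟧ σ) ≤-refl ≤-refl)
  (≤-⊞ (valueᵐ f) (valueᵐ g) (value-≤ f β) (value-≤ g β))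
value-≤ (rd e)      β = ≤-id (cells β _)
value-≤ (sum x e f) {b} {σ} β = ≤-trans (Σ-≤ (⟦ e ⟧ σ) λ i i<N → value-≤ f
    (bounded-≔ x (bounded-mono (m≤m+n b (⟦ e ⟧ σ)) β) (≤-trans (<⇒≤ i<N) (m≤n+m _ b))))
  (≤-⊠ (valueᵐ e) (valueᵐ f ⊚ (idᵐ ⊞ valueᵐ e)) (value-≤ e β)
    (≤-⊚ (valueᵐ f) (idᵐ ⊞ valueᵐ e) ≤-refl (≤-⊞ idᵐ (valueᵐ e) (≤-id ≤-refl) (value-≤ e β))))

drainᵐ : Mono → Mono
drainᵐ p = const 1 ⊞ p ⊠ const 4

drain-≤ : ∀ p {m b} → m ≤ atMost p b → drainCost m ≤ atMost (drainᵐ p) b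
drain-≤ p {m} m≤ = ≤-trans (loopCost-≤ 0 m λ _ _ → ≤-refl)
  (≤-⊞ (const 1) (p ⊠ const 4) (≤-const 1 ≤-refl) (≤-⊠ p (const 4) m≤ (≤-const 4 ≤-refl)))

costᵐ : Expr → Mono
costᵐ zero        = const 1
costᵐ (suc e)     = costᵐ e ⊞ const 1
costᵐ (var x)     = const 1
costᵐ (e ⊕ f)     = costᵐ e ⊞ (costᵐ f ⊞ drainᵐ (valueᵐ f))
costᵐ (e ⊖ f)     = costᵐ e ⊞ (costᵐ f ⊞ drainᵐ (valueᵐ f))
costᵐ (if0 e f g) = costᵐ e ⊞ ((const 1 ⊞ costᵐ f) ⊞ (const 1 ⊞ (costᵐ g ⊞ const 1)))
costᵐ (rd e)      = costᵐ e ⊞ const 1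
costᵐ (sum x e f) = costᵐ e ⊞ (const 3 ⊞ ((const 1 ⊞ valueᵐ e ⊠ (const 2 ⊞ (const 1 ⊞
  ((costᵐ f ⊚ (idᵐ ⊞ valueᵐ e)) ⊞ ((drainᵐ (valueᵐ f) ⊚ (idᵐ ⊞ valueᵐ e)) ⊞ const 1))))) ⊞ const 1))

cost-≤ : ∀ e {b σ} → Bounded b σ → cost e σ ≤ atMost (costᵐ e) b
cost-≤ zero        β = ≤-refl
cost-≤ (suc e)     β = ≤-⊞ (costᵐ e) (const 1) (cost-≤ e β) (≤-const 1 ≤-refl)
cost-≤ (var x)     β = ≤-refl
cost-≤ (e ⊕ f)     β = ≤-⊞ (costᵐ e) (costᵐ f ⊞ drainᵐ (valueᵐ f)) (cost-≤ e β)
  (≤-⊞ (costᵐ f) (drainᵐ (valueᵐ f)) (cost-≤ f β) (drain-≤ (valueᵐ f) (value-≤ f β)))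
cost-≤ (e ⊖ f)     β = ≤-⊞ (costᵐ e) (costᵐ f ⊞ drainᵐ (valueᵐ f)) (cost-≤ e β)
  (≤-⊞ (costᵐ f) (drainᵐ (valueᵐ f)) (cost-≤ f β) (drain-≤ (valueᵐ f) (value-≤ f β)))
cost-≤ (if0 e f g) {b} {σ} β = ≤-⊞ (costᵐ e) ((const 1 ⊞ costᵐ f) ⊞ (const 1 ⊞ (costᵐ g ⊞ const 1))) (cost-≤ e β)
  (≤-trans (pick-≤ (⟦ e ⟧ σ) ≤-refl ≤-refl)
    (≤-⊞ (const 1 ⊞ costᵐ f) (const 1 ⊞ (costᵐ g ⊞ const 1))
      (≤-⊞ (const 1) (costᵐ f) (≤-const 1 ≤-refl) (cost-≤ f β))
      (≤-⊞ (const 1) (costᵐ g ⊞ const 1) (≤-const 1 ≤-refl)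
        (≤-⊞ (costᵐ g) (const 1) (cost-≤ g β) (≤-const 1 ≤-refl)))))
cost-≤ (rd e)      β = ≤-⊞ (costᵐ e) (const 1) (cost-≤ e β) (≤-const 1 ≤-refl)
cost-≤ (sum x e f) {b} {σ} β =
  ≤-⊞ (costᵐ e) (const 3 ⊞ (loop ⊞ const 1)) (cost-≤ e β)
  (≤-⊞ (const 3) (loop ⊞ const 1) {3} (≤-const 3 ≤-refl)
  (≤-⊞ loop (const 1) loop-≤ (≤-const 1 ≤-refl)))
  where
  N : ℕ
  N = ⟦ e ⟧ σ
  up iteration loop : Mono
  up = idᵐ ⊞ valueᵐ e
  iteration = const 1 ⊞ ((costᵐ f ⊚ up) ⊞ ((drainᵐ (valueᵐ f) ⊚ up) ⊞ const 1))
  loop = const 1 ⊞ valueᵐ e ⊠ (const 2 ⊞ iteration)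
  b+N≤ : b + N ≤ atMost up b
  b+N≤ = ≤-⊞ idᵐ (valueᵐ e) (≤-id ≤-refl) (value-≤ e β)
  β+ : ∀ i → i < N → Bounded (b + N) (σ ⟨ x ≔ i ⟩)
  β+ i i<N = bounded-≔ x (bounded-mono (m≤m+n b N) β) (≤-trans (<⇒≤ i<N) (m≤n+m _ b))
  loop-≤ : loopCost 0 N (λ j → 1 + (cost f (σ ⟨ x ≔ j ⟩) + (drainCost (⟦ f ⟧ (σ ⟨ x ≔ j ⟩)) + 1))) ≤ atMost loop b
  loop-≤ = ≤-trans
    (loopCost-≤ 0 N {B = atMost iteration b} λ i i<N →
      ≤-⊞ (const 1) ((costᵐ f ⊚ up) ⊞ ((drainᵐ (valueᵐ f) ⊚ up) ⊞ const 1)) (≤-const 1 ≤-refl)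
      (≤-⊞ (costᵐ f ⊚ up) ((drainᵐ (valueᵐ f) ⊚ up) ⊞ const 1)
        (≤-⊚ (costᵐ f) up (cost-≤ f (β+ i i<N)) b+N≤)
      (≤-⊞ (drainᵐ (valueᵐ f) ⊚ up) (const 1)
        (≤-⊚ (drainᵐ (valueᵐ f)) up (drain-≤ (valueᵐ f) (value-≤ f (β+ i i<N))) b+N≤)
        (≤-const 1 ≤-refl))))
    (≤-⊞ (const 1) (valueᵐ e ⊠ (const 2 ⊞ iteration)) (≤-const 1 ≤-refl)
    (≤-⊠ (valueᵐ e) (const 2 ⊞ iteration) (value-≤ e β)
    (≤-⊞ (const 2) iteration {2} (≤-const 2 ≤-refl) ≤-refl)))

-- Expressions whose value exceeds the bound on the stored numbers by at most a constant.
Bit Small : Expr → Set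
Bit zero        = ⊤
Bit (suc zero)  = ⊤
Bit (if0 _ f g) = Bit f × Bit g
Bit _           = ⊥

Small zero        = ⊤
Small (suc e)     = Small e
Small (var _)     = ⊤
Small (_ ⊕ _)     = ⊥
Small (e ⊖ _)     = Small e
Small (if0 _ f g) = Small f × Small g
Small (rd _)      = ⊤
Small (sum _ e f) = Small e × Bit f

growth : Expr → ℕ
growth (suc e)     = suc (growth e)
growth (e ⊖ _)     = growth e
growth (if0 _ f g) = growth f + growth g
growth (sum _ e _) = growth e
growth _           = 0

bit-≤ : ∀ e {σ} → Bit e → ⟦ e ⟧ σ ≤ 1
bit-≤ zero        _ = z≤n
bit-≤ (suc zero)  _ = ≤-refl
bit-≤ (if0 e f g) {σ} (p , q) with ⟦ e ⟧ σ
... | zero  = bit-≤ f p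
... | suc _ = bit-≤ g q

-- That the excess is additive is the point: loops repeat assignments, and an unrestricted `_⊕_`
-- could double the stored numbers in each iteration.
small-≤ : ∀ e {b σ} → Small e → Bounded b σ → ⟦ e ⟧ σ ≤ b + growth e
small-≤ zero        _ β = z≤n
small-≤ (suc e) {b} s β = ≤-trans (s≤s (small-≤ e s β)) (≤-reflexive (sym (+-suc b (growth e))))
small-≤ (var x {p}) _ β = ≤-trans (regs β x (<ᵇ⇒< x vars p)) (m≤m+n _ 0)
small-≤ (e ⊖ f) {σ = σ} s β = ≤-trans (m∸n≤m _ (⟦ f ⟧ σ)) (small-≤ e s β)
small-≤ (if0 e f g) {b} {σ} (s , t) β with ⟦ e ⟧ σ
... | zero  = ≤-trans (small-≤ f s β) (+-monoʳ-≤ b (m≤m+n _ _))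
... | suc _ = ≤-trans (small-≤ g t β) (+-monoʳ-≤ b (m≤n+m _ _))
small-≤ (rd e)      _ β = ≤-trans (cells β _) (m≤m+n _ 0)
small-≤ (sum x e f) {b} {σ} (s , t) β = ≤-trans (Σ-≤ (⟦ e ⟧ σ) {B = 1} λ i _ → bit-≤ f t)
  (≤-trans (≤-reflexive (*-identityʳ _)) (small-≤ e s β))

-- Only variables 0 and 2 bound loops, and no loop body writes to them.
limit? : ℕ → Bool
limit? x = (x ≡ᵇ 0) ∨ (x ≡ᵇ 2)

Limit Other : ℕ → Set
Limit x = T (limit? x)
Other x = T (not (limit? x))

Static : Cmd → Set
Static skip        = ⊤
Static (set x e)   = Other x × Small e
Static (put _ e)   = Small e
Static (c ⨟ d)     = Static c × Static d
Static (if0 _ c d) = Static c × Static d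
Static (for i x c) = Other i × Limit x × Static c

growthᵐ : Cmd → Mono
growthᵐ skip        = const 0
growthᵐ (set x e)   = const (growth e)
growthᵐ (put _ e)   = const (growth e)
growthᵐ (c ⨟ d)     = growthᵐ c ⊞ growthᵐ d
growthᵐ (if0 _ c d) = growthᵐ c ⊞ growthᵐ d
growthᵐ (for _ _ c) = idᵐ ⊠ growthᵐ c

-- Two bounds are kept apart: `l` for the loop limits, which stays fixed, and `b` for all numbers,
-- which grows. Since a command raises `b` by an amount depending on `l` alone, the increases of a
-- loop add up instead of compounding.
record Tame (l b : ℕ) (σ : State) : Set where
  constructor tame
  field
    l≤b : l ≤ b
    at0  : rg σ 0 ≤ l
    at2  : rg σ 2 ≤ l
    bds : Bounded b σ

open Tame

tame-mono : ∀ {l b c σ} → b ≤ c → Tame l b σ → Tame l c σ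
tame-mono b≤c (tame l≤b at0 at2 β) = tame (≤-trans l≤b b≤c) at0 at2 (bounded-mono b≤c β)

tame-≔ : ∀ {l b σ} x {v} → Other x → v ≤ b → Tame l b σ → Tame l b (σ ⟨ x ≔ v ⟩)
tame-≔ 1                   o v≤b (tame l≤b at0 at2 β) = tame l≤b at0 at2 (bounded-≔ 1 β v≤b)
tame-≔ (suc (suc (suc x))) o v≤b (tame l≤b at0 at2 β) = tame l≤b at0 at2 (bounded-≔ (suc (suc (suc x))) β v≤b)

limit-≤ : ∀ {l b σ} x → Limit x → Tame l b σ → rg σ x ≤ l
limit-≤ 0 _ T = at0 T
limit-≤ 2 _ T = at2 T

mutual
  run-tame : ∀ c {l b σ} → Static c → Tame l b σ → Tame l (b + atMost (growthᵐ c) l) (run c σ)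
  run-tame skip        _ T = tame-mono (m≤m+n _ _) T
  run-tame (set x e) {b = b} (o , s) T = tame-≔ x o
    (≤-trans (small-≤ e s (bds T)) (+-monoʳ-≤ b (≤-const (growth e) ≤-refl))) (tame-mono (m≤m+n _ _) T)
  run-tame (put a e) {b = b} {σ} s T with tame l≤ at0 at2 β ← tame-mono (m≤m+n b _) T =
    tame l≤ at0 at2 (bounded-put (⟦ a ⟧ σ) β (≤-trans (small-≤ e s (bds T)) (+-monoʳ-≤ b (≤-const (growth e) ≤-refl))))
  run-tame (c ⨟ d) {l} {b} (s , t) T = tame-mono
    (≤-trans (≤-reflexive (+-assoc b _ _)) (+-monoʳ-≤ b (≤-⊞ (growthᵐ c) (growthᵐ d) ≤-refl ≤-refl)))
    (run-tame d t (run-tame c s T))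
  run-tame (if0 e c d) {l} {b} {σ} (s , t) T with ⟦ e ⟧ σ
  ... | zero  = tame-mono (+-monoʳ-≤ b (≤-trans (m≤m+n _ (atMost (growthᵐ d) l))
                  (≤-⊞ (growthᵐ c) (growthᵐ d) ≤-refl ≤-refl))) (run-tame c s T)
  ... | suc _ = tame-mono (+-monoʳ-≤ b (≤-trans (m≤n+m _ (atMost (growthᵐ c) l))
                  (≤-⊞ (growthᵐ c) (growthᵐ d) ≤-refl ≤-refl))) (run-tame d t T)
  run-tame (for i x c) {l} {b} {σ} (o , m , s) T = tame-mono
    (+-monoʳ-≤ b (≤-⊠ idᵐ (growthᵐ c) (≤-id (limit-≤ x m T)) ≤-refl))
    (for-tame i c o s T (rg σ x) (limit-≤ x m T))

  for-tame : ∀ i c {l b σ} → Other i → Static c → Tame l b σ → ∀ j → j ≤ l →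
             Tame l (b + j * atMost (growthᵐ c) l) (forState i c σ j)
  for-tame i c o s T zero    _   = tame-mono (m≤m+n _ 0) T
  for-tame i c {l} {b} o s T (suc j) j<l = tame-mono
    (≤-reflexive (trans (+-assoc b _ _) (cong (b +_) (+-comm (j * atMost (growthᵐ c) l) _))))
    (run-tame c s (for-tame-index i c o s T j j<l))

  for-tame-index : ∀ i c {l b σ} → Other i → Static c → Tame l b σ → ∀ j → j < l →
             Tame l (b + j * atMost (growthᵐ c) l) (forState i c σ j ⟨ i ≔ j ⟩)
  for-tame-index i c o s T j j<l =
    tame-≔ i o (≤-trans (<⇒≤ j<l) (≤-trans (l≤b T) (m≤m+n _ _))) (for-tame i c o s T j (<⇒≤ j<l))

runCostᵐ : Cmd → Mono
runCostᵐ skip        = const 1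
runCostᵐ (set x e)   = costᵐ e ⊞ const 1
runCostᵐ (put a e)   = costᵐ a ⊞ (costᵐ e ⊞ const 1)
runCostᵐ (c ⨟ d)     = runCostᵐ c ⊞ runCostᵐ d ⊚ (idᵐ ⊞ growthᵐ c)
runCostᵐ (if0 e c d) = costᵐ e ⊞ ((const 1 ⊞ runCostᵐ c) ⊞ (const 1 ⊞ (runCostᵐ d ⊞ const 1)))
runCostᵐ (for i x c) = const 2 ⊞ (const 1 ⊞ idᵐ ⊠ (const 2 ⊞ (const 2 ⊞
  ((runCostᵐ c ⊚ (idᵐ ⊞ idᵐ ⊠ growthᵐ c)) ⊞ const 1))))

runCost-≤ : ∀ c {l b σ} → Static c → Tame l b σ → runCost c σ ≤ atMost (runCostᵐ c) b
runCost-≤ skip        _ T = ≤-refl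
runCost-≤ (set x e)   _ T = ≤-⊞ (costᵐ e) (const 1) (cost-≤ e (bds T)) (≤-const 1 ≤-refl)
runCost-≤ (put a e)   _ T = ≤-⊞ (costᵐ a) (costᵐ e ⊞ const 1) (cost-≤ a (bds T))
  (≤-⊞ (costᵐ e) (const 1) (cost-≤ e (bds T)) (≤-const 1 ≤-refl))
runCost-≤ (c ⨟ d) (s , t) T = ≤-⊞ (runCostᵐ c) (runCostᵐ d ⊚ (idᵐ ⊞ growthᵐ c)) (runCost-≤ c s T)
  (≤-⊚ (runCostᵐ d) (idᵐ ⊞ growthᵐ c) (runCost-≤ d t (run-tame c s T))
    (≤-⊞ idᵐ (growthᵐ c) (≤-id ≤-refl) (atMost-mono (growthᵐ c) (l≤b T))))
runCost-≤ (if0 e c d) {σ = σ} (s , t) T =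
  ≤-⊞ (costᵐ e) ((const 1 ⊞ runCostᵐ c) ⊞ (const 1 ⊞ (runCostᵐ d ⊞ const 1))) (cost-≤ e (bds T))
  (≤-trans (pick-≤ (⟦ e ⟧ σ) ≤-refl ≤-refl)
    (≤-⊞ (const 1 ⊞ runCostᵐ c) (const 1 ⊞ (runCostᵐ d ⊞ const 1))
      (≤-⊞ (const 1) (runCostᵐ c) (≤-const 1 ≤-refl) (runCost-≤ c s T))
      (≤-⊞ (const 1) (runCostᵐ d ⊞ const 1) (≤-const 1 ≤-refl)
        (≤-⊞ (runCostᵐ d) (const 1) (runCost-≤ d t T) (≤-const 1 ≤-refl)))))
runCost-≤ (for i x c) {l} {b} {σ} (o , m , s) T =
  ≤-⊞ (const 2) (const 1 ⊞ idᵐ ⊠ (const 2 ⊞ iteration)) {2} (≤-const 2 ≤-refl)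
  (≤-trans (loopCost-≤ 0 (rg σ x) λ j j<x → iteration-≤ j (<-≤-trans j<x (limit-≤ x m T)))
  (≤-⊞ (const 1) (idᵐ ⊠ (const 2 ⊞ iteration)) (≤-const 1 ≤-refl)
  (≤-⊠ idᵐ (const 2 ⊞ iteration) (≤-id (≤-trans (limit-≤ x m T) (l≤b T)))
  (≤-⊞ (const 2) iteration {2} (≤-const 2 ≤-refl) ≤-refl))))
  where
  up iteration : Mono
  up = idᵐ ⊞ idᵐ ⊠ growthᵐ c
  iteration = const 2 ⊞ ((runCostᵐ c ⊚ up) ⊞ const 1)
  iteration-≤ : ∀ j → j < l → 2 + (runCost c (forState i c σ j ⟨ i ≔ j ⟩) + 1) ≤ atMost iteration b
  iteration-≤ j j<l =
    ≤-⊞ (const 2) ((runCostᵐ c ⊚ up) ⊞ const 1) {2} (≤-const 2 ≤-refl)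
    (≤-⊞ (runCostᵐ c ⊚ up) (const 1)
      (≤-⊚ (runCostᵐ c) up (runCost-≤ c s (for-tame-index i c o s T j j<l))
        (≤-⊞ idᵐ (idᵐ ⊠ growthᵐ c) (≤-id ≤-refl)
          (≤-⊠ idᵐ (growthᵐ c) (≤-id (≤-trans (<⇒≤ j<l) (l≤b T))) (atMost-mono (growthᵐ c) (l≤b T)))))
      (≤-const 1 ≤-refl))

-- Opaque because the coefficient of a concrete program is far too large to be evaluated.
opaque

  runMono : Cmd → Mono
  runMono = runCostᵐ

  runMono-≤ : ∀ c {l b σ} → Static c → Tame l b σ → runCost c σ ≤ atMost (runMono c) b
  runMono-≤ = runCost-≤

run-within : ∀ c {S σ B} → S ∼ σ → runCost c σ ≤ B →
  ∃[ t ] ∃[ T ] (⟪ compile c vars ⟫ S ⇓[ t ] T) × T ∼ run c σ × t ≤ B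
run-within c a h with executes {T} r a₁ _ ← run-correct c ≤-refl a = _ , T , r , a₁ , h

-- Finite sums

Σ-cong : ∀ n {f g} → (∀ i → i < n → f i ≡ g i) → Σ[ n ] f ≡ Σ[ n ] g
Σ-cong zero    h = refl
Σ-cong (suc n) h = cong₂ _+_ (Σ-cong n λ i i<n → h i (m<n⇒m<1+n i<n)) (h n (n<1+n n))

Σ-mono : ∀ n {f g} → (∀ i → i < n → f i ≤ g i) → Σ[ n ] f ≤ Σ[ n ] g
Σ-mono zero    h = z≤n
Σ-mono (suc n) h = +-mono-≤ (Σ-mono n λ i i<n → h i (m<n⇒m<1+n i<n)) (h n (n<1+n n))

+-swap-mid : ∀ a b c d → (a + b) + (c + d) ≡ (a + c) + (b + d)
+-swap-mid = solve-∀

Σ-+ : ∀ n f g → Σ[ n ] (λ i → f i + g i) ≡ Σ[ n ] f + Σ[ n ] g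
Σ-+ zero    f g = refl
Σ-+ (suc n) f g = trans (cong (_+ (f n + g n)) (Σ-+ n f g)) (+-swap-mid (Σ[ n ] f) (Σ[ n ] g) (f n) (g n))

Σ-*ˡ : ∀ n c f → Σ[ n ] (λ i → c * f i) ≡ c * Σ[ n ] f
Σ-*ˡ zero    c f = sym (*-zeroʳ c)
Σ-*ˡ (suc n) c f = trans (cong (_+ c * f n) (Σ-*ˡ n c f)) (sym (*-distribˡ-+ c (Σ[ n ] f) (f n)))

Σ-zero : ∀ n {f} → (∀ i → i < n → f i ≡ 0) → Σ[ n ] f ≡ 0
Σ-zero zero    h = refl
Σ-zero (suc n) h = cong₂ _+_ (Σ-zero n λ i i<n → h i (m<n⇒m<1+n i<n)) (h n (n<1+n n))

Σ-const : ∀ n c → Σ[ n ] (λ _ → c) ≡ n * c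
Σ-const zero    c = refl
Σ-const (suc n) c = trans (cong (_+ c) (Σ-const n c)) (+-comm (n * c) c)

Σ-swap : ∀ m n (f : ℕ → ℕ → ℕ) → Σ[ m ] (λ i → Σ[ n ] (f i)) ≡ Σ[ n ] (λ j → Σ[ m ] λ i → f i j)
Σ-swap zero    n f = sym (Σ-zero n λ _ _ → refl)
Σ-swap (suc m) n f = trans (cong (_+ Σ[ n ] (f m)) (Σ-swap m n f)) (sym (Σ-+ n (λ j → Σ[ m ] λ i → f i j) (f m)))

Σ-term : ∀ n f {i} → i < n → f i ≤ Σ[ n ] f
Σ-term (suc n) f {i} i<1+n with i ≟ n
... | yes refl = m≤n+m (f i) _
... | no i≢n   = ≤-trans (Σ-term n f (≤∧≢⇒< (s≤s⁻¹ i<1+n) i≢n)) (m≤m+n _ (f n))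

Σ≡0 : ∀ n f → Σ[ n ] f ≡ 0 → ∀ i → i < n → f i ≡ 0
Σ≡0 n f e i i<n = n≤0⇒n≡0 (≤-trans (Σ-term n f i<n) (≤-reflexive e))

Σ-front : ∀ n f → Σ[ suc n ] f ≡ f 0 + Σ[ n ] (λ i → f (suc i))
Σ-front zero    f = +-comm 0 (f 0)
Σ-front (suc n) f = trans (cong (_+ f (suc n)) (Σ-front n f)) (+-assoc (f 0) _ _)

Σ-search : ∀ n f → Σ[ n ] f ≢ 0 → ∃[ i ] i < n × f i ≢ 0
Σ-search zero    f h = ⊥-elim (h refl)
Σ-search (suc n) f h with f n ≟ 0
... | no  f≢0 = n , n<1+n n , f≢0
... | yes f≡0 with i , i<n , g ← Σ-search n f (λ e → h (cong₂ _+_ e f≡0)) = i , m<n⇒m<1+n i<n , g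

-- The distance of two numbers, written so that it is definitionally the value of the program
-- expression `differ`.
apart : ℕ → ℕ → ℕ
apart x y = (x ∸ y) + (y ∸ x)

apart-refl : ∀ x → apart x x ≡ 0
apart-refl x = cong₂ _+_ (n∸n≡0 x) (n∸n≡0 x)

apart≡0 : ∀ x y → apart x y ≡ 0 → x ≡ y
apart≡0 x y e = ≤-antisym (m∸n≡0⇒m≤n (m+n≡0⇒m≡0 (x ∸ y) e)) (m∸n≡0⇒m≤n (m+n≡0⇒n≡0 (x ∸ y) e))

module _ {A : Set} {a b : A} where

  pick-zero : ∀ {n} → n ≡ 0 → pick n a b ≡ a
  pick-zero refl = refl

  pick-nonzero : ∀ {n} → n ≢ 0 → pick n a b ≡ b
  pick-nonzero {zero}  h = ⊥-elim (h refl)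
  pick-nonzero {suc n} h = refl

  pick-≡ : ∀ {x y} → x ≡ y → pick (apart x y) a b ≡ a
  pick-≡ {x} refl = pick-zero (apart-refl x)

  pick-≢ : ∀ {x y} → x ≢ y → pick (apart x y) a b ≡ b
  pick-≢ {x} {y} x≢y = pick-nonzero λ e → x≢y (apart≡0 x y e)

  pick-∸-≤ : ∀ {x y} → x ≤ y → pick (x ∸ y) a b ≡ a
  pick-∸-≤ x≤y = pick-zero (m≤n⇒m∸n≡0 x≤y)

  pick-∸-> : ∀ {x y} → y < x → pick (x ∸ y) a b ≡ b
  pick-∸-> {x} {y} y<x = pick-nonzero λ e → <⇒≱ y<x (m∸n≡0⇒m≤n e)

-- Clusterings of a graph

bit : Bool → ℕ
bit b = if b then 1 else 0

nth : ∀ {A : Set} → ℕ → List A → Maybe A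
nth a xs = head (drop a xs)

nth-++ˡ : ∀ {A : Set} {x : A} a xs {ys} → nth a xs ≡ just x → nth a (xs ++ ys) ≡ just x
nth-++ˡ zero    (x ∷ xs) e = e
nth-++ˡ (suc a) (x ∷ xs) e = nth-++ˡ a xs e

nth-++ʳ : ∀ {A : Set} a (xs : List A) {ys} → nth (length xs + a) (xs ++ ys) ≡ nth a ys
nth-++ʳ a []       = refl
nth-++ʳ a (x ∷ xs) = nth-++ʳ a xs

nth-tabulate : ∀ {A : Set} {n} (f : Fin n → A) i → nth (toℕ i) (tabulate f) ≡ just (f i)
nth-tabulate f fzero    = refl
nth-tabulate f (fsuc i) = nth-tabulate (f ∘ fsuc) i

nth-end : ∀ {A : Set} a (xs : List A) → length xs ≤ a → nth a xs ≡ nothing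
nth-end zero    []       _       = refl
nth-end (suc a) []       _       = refl
nth-end (suc a) (x ∷ xs) (s≤s h) = nth-end a xs h

length-product : ∀ {A B C : Set} (f : A → B → C) xs ys →
                 length (cartesianProductWith f xs ys) ≡ length xs * length ys
length-product f []       ys = refl
length-product f (x ∷ xs) ys = trans (length-++ (map (f x) ys))
  (cong₂ _+_ (length-map (f x) ys) (length-product f xs ys))

module _ {n : ℕ} (G : Graph n) (k : ℕ) where

  private
    f : Fin n → Fin n → ℕ
    f u v = if adj G u v then 1 else 0

    row : ∀ u v ys → nth (toℕ v) (map (f u) (allFin n) ++ ys) ≡ just (f u v)
    row u v ys = nth-++ˡ (toℕ v) (map (f u) (allFin n))
      (trans (cong (nth (toℕ v)) (map-tabulate id (f u))) (nth-tabulate (f u) v))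

    -- The rows are generalised to a family `g` over `Fin m`, because the tail of a tabulation has
    -- fewer rows but rows of the same length.
    matrix : ∀ {m} (g : Fin m → Fin n) i v →
             nth (toℕ i * n + toℕ v) (cartesianProductWith f (tabulate g) (allFin n)) ≡ just (f (g i) v)
    matrix g fzero    v = row (g fzero) v _
    matrix g (fsuc i) v = trans
      (cong (λ a → nth a (cartesianProductWith f (tabulate g) (allFin n)))
        (trans (+-assoc n (toℕ i * n) (toℕ v)) (cong (_+ (toℕ i * n + toℕ v)) (sym len))))
      (trans (nth-++ʳ (toℕ i * n + toℕ v) (map (f (g fzero)) (allFin n))) (matrix (g ∘ fsuc) i v))
      where
      len : length (map (f (g fzero)) (allFin n)) ≡ n
      len = trans (length-map _ (allFin n)) (length-tabulate id)

    bits-≤ : ∀ {m} (g : Fin m → Fin n) ys a → fromMaybe 0 (nth a (cartesianProductWith f (tabulate g) ys)) ≤ 1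
    bits-≤ {zero}  g ys zero    = z≤n
    bits-≤ {zero}  g ys (suc a) = z≤n
    bits-≤ {suc m} g ys a = go ys a
      where
      go : ∀ zs a → fromMaybe 0 (nth a (map (f (g fzero)) zs ++ cartesianProductWith f (tabulate (g ∘ fsuc)) ys)) ≤ 1
      go []       a       = bits-≤ (g ∘ fsuc) ys a
      go (z ∷ zs) zero with adj G (g fzero) z
      ... | true  = ≤-refl
      ... | false = z≤n
      go (z ∷ zs) (suc a) = go zs a

  input-adj : ∀ u v → mem (input G k) (toℕ u * n + toℕ v) ≡ bit (adj G u v)
  input-adj u v = cong (fromMaybe 0) (matrix id u v)

  input-≤ : ∀ a → mem (input G k) a ≤ 1
  input-≤ = bits-≤ id (allFin n)

  input-end : ∀ a → n * n ≤ a → mem (input G k) a ≡ 0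
  input-end a h = cong (fromMaybe 0) (nth-end a _
    (≤-trans (≤-reflexive (trans (length-product f (allFin n) (allFin n))
      (cong₂ _*_ (length-tabulate {n = n} id) (length-tabulate {n = n} id)))) h))

module _ {A : Set} {P : Pred A 0ℓ} (P? : Decidable P) where

  count-tabulate : ∀ {n} (f : Fin n → A) g → (∀ i → g (toℕ i) ≡ bit (does (P? (f i)))) →
                   Vec.count P? (Vec.tabulate f) ≡ Σ[ n ] g
  count-tabulate {zero}  f g h = refl
  count-tabulate {suc n} f g h with does (P? (f fzero)) | h fzero
  ... | true  | g0 = trans (cong₂ _+_ (sym g0) (count-tabulate (f ∘ fsuc) (g ∘ suc) (h ∘ fsuc))) (sym (Σ-front n g))
  ... | false | g0 = trans (cong₂ _+_ (sym g0) (count-tabulate (f ∘ fsuc) (g ∘ suc) (h ∘ fsuc))) (sym (Σ-front n g))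

  filter-tabulate : ∀ {n} (f : Fin n → A) g → (∀ i → g (toℕ i) ≡ bit (does (P? (f i)))) →
                    length (filter P? (tabulate f)) ≡ Σ[ n ] g
  filter-tabulate {zero}  f g h = refl
  filter-tabulate {suc n} f g h with does (P? (f fzero)) | h fzero
  ... | true  | g0 = trans (cong₂ _+_ (sym g0) (filter-tabulate (f ∘ fsuc) (g ∘ suc) (h ∘ fsuc))) (sym (Σ-front n g))
  ... | false | g0 = trans (cong₂ _+_ (sym g0) (filter-tabulate (f ∘ fsuc) (g ∘ suc) (h ∘ fsuc))) (sym (Σ-front n g))

filter-product : ∀ {n} {P : Pred (Fin n × Fin n) 0ℓ} (P? : Decidable P) {m} (f : Fin m → Fin n) (g : ℕ → ℕ → ℕ) →
  (∀ i j → g (toℕ i) (toℕ j) ≡ bit (does (P? (f i , j)))) →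
  length (filter P? (cartesianProduct (tabulate f) (allFin n))) ≡ Σ[ m ] (λ u → Σ[ n ] (g u))
filter-product P? {zero}  f g h = refl
filter-product {n} P? {suc m} f g h = begin
  length (filter P? (row ++ rest))                        ≡⟨ cong length (filter-++ P? row rest) ⟩
  length (filter P? row ++ filter P? rest)                ≡⟨ length-++ (filter P? row) ⟩
  length (filter P? row) + length (filter P? rest)
    ≡⟨ cong₂ _+_ (trans (cong (length ∘ filter P?) (map-tabulate id (f fzero ,_)))
                        (filter-tabulate P? (f fzero ,_) (g 0) (h fzero)))
                 (filter-product P? (f ∘ fsuc) (g ∘ suc) (h ∘ fsuc)) ⟩
  Σ[ n ] (g 0) + Σ[ m ] (λ u → Σ[ n ] (g (suc u)))         ≡⟨ Σ-front m _ ⟨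
  Σ[ suc m ] (λ u → Σ[ n ] (g u))                          ∎
  where
  open ≡-Reasoning
  row = map (f fzero ,_) (allFin n)
  rest = cartesianProduct (tabulate (f ∘ fsuc)) (allFin n)

-- Graphs as functions on numbers.

ΣΣ : ℕ → (ℕ → ℕ → ℕ) → ℕ
ΣΣ n h = Σ[ n ] λ u → Σ[ n ] (h u)

ΣΣ-cong : ∀ n {f g} → (∀ u v → u < n → v < n → f u v ≡ g u v) → ΣΣ n f ≡ ΣΣ n g
ΣΣ-cong n h = Σ-cong n λ u u<n → Σ-cong n λ v v<n → h u v u<n v<n

ΣΣ-+ : ∀ n f g → ΣΣ n (λ u v → f u v + g u v) ≡ ΣΣ n f + ΣΣ n g
ΣΣ-+ n f g = trans (Σ-cong n λ u _ → Σ-+ n (f u) (g u)) (Σ-+ n _ _)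

Represents : ∀ {n} → (Fin n → Fin n → Bool) → (ℕ → ℕ → ℕ) → Set
Represents A h = ∀ u v → h (toℕ u) (toℕ v) ≡ bit (A u v)

at-Fin : ∀ {n} {P : ℕ → Set} → (∀ (i : Fin n) → P (toℕ i)) → ∀ i → i < n → P i
at-Fin {P = P} h i i<n = subst P (Fin.toℕ-fromℕ< i<n) (h (fromℕ< i<n))

-- Exchanging the two summations turns the pairs with `u < v` into those with `v < u`, and the
-- diagonal contributes nothing. Working with twice the count avoids a division.
2*edgeCount : ∀ {n} (F : Graph n) h → Represents (adj F) h → edgeCount F + edgeCount F ≡ ΣΣ n h
2*edgeCount {n} F h rep = begin
  edgeCount F + edgeCount F                              ≡⟨ cong₂ _+_ half half ⟩
  ΣΣ n up + ΣΣ n up                                      ≡⟨ cong (ΣΣ n up +_) (trans (Σ-swap n n up) (ΣΣ-cong n flip)) ⟩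
  ΣΣ n up + ΣΣ n down                                    ≡⟨ ΣΣ-+ n up down ⟨
  ΣΣ n (λ u v → up u v + down u v)                       ≡⟨ ΣΣ-cong n both ⟩
  ΣΣ n h                                                 ∎
  where
  open ≡-Reasoning
  up down : ℕ → ℕ → ℕ
  up u v   = bit (u <ᵇ v) * h u v
  down u v = bit (v <ᵇ u) * h u v
  half : edgeCount F ≡ ΣΣ n up
  half = filter-product (isEdge? F) id up λ u v → edge u v (adj F u v) (rep u v)
    where
    edge : ∀ u v b → h (toℕ u) (toℕ v) ≡ bit b →
           up (toℕ u) (toℕ v) ≡ bit ((toℕ u <ᵇ toℕ v) ∧ b)
    edge u v b e with toℕ u <ᵇ toℕ v
    ... | true  = trans (+-identityʳ _) e
    ... | false = refl
  sym-h : ∀ u v → u < n → v < n → h u v ≡ h v u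
  sym-h u v u<n v<n = at-Fin {P = λ u → h u v ≡ h v u} (λ i →
    at-Fin {P = λ v → h (toℕ i) v ≡ h v (toℕ i)} (λ j →
      trans (rep i j) (trans (cong bit (Graph.sym F i j)) (sym (rep j i)))) v v<n) u u<n
  flip : ∀ u v → u < n → v < n → up v u ≡ down u v
  flip u v u<n v<n = cong (bit (v <ᵇ u) *_) (sym-h v u v<n u<n)
  diagonal : ∀ u → u < n → h u u ≡ 0
  diagonal = at-Fin λ i → trans (rep i i) (cong bit (Graph.irrefl F i))
  both : ∀ u v → u < n → v < n → up u v + down u v ≡ h u v
  both u v u<n v<n with u <ᵇ v in e₁ | v <ᵇ u in e₂
  ... | true  | true  = ⊥-elim (<-asym (<ᵇ⇒< u v (subst T (sym e₁) tt)) (<ᵇ⇒< v u (subst T (sym e₂) tt)))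
  ... | true  | false = trans (+-identityʳ _) (+-identityʳ _)
  ... | false | true  = +-identityʳ _
  ... | false | false with refl ← ≤-antisym {u} {v} (≮⇒≥ λ v<u → subst T e₂ (<⇒<ᵇ v<u)) (≮⇒≥ λ u<v → subst T e₁ (<⇒<ᵇ u<v))
    = sym (diagonal u u<n)

-- Indicator of an edge between different parts, that is, of an edge which the partition `π`
-- deletes.
split : (ℕ → ℕ → ℕ) → (ℕ → ℕ) → ℕ → ℕ → ℕ
split a π u v = pick (a u v) 0 (pick (apart (π u) (π v)) 0 1)

record Clustering (n : ℕ) (a : ℕ → ℕ → ℕ) (K s m : ℕ) (π : ℕ → ℕ) : Set where
  field
    range  : ∀ v → v < n → π v < m
    sizes  : ∀ i → i < m → Σ[ n ] (λ v → pick (apart (π v) i) 1 0) ≡ s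
    clique : ∀ u v → u < n → v < n → u ≢ v → π u ≡ π v → a u v ≢ 0
    -- The sum runs over ordered pairs and counts every deleted edge twice.
    budget : ΣΣ n (split a π) ≤ K + K

open Clustering

does-≟ : ∀ {m} (x y : Fin m) → pick (apart (toℕ x) (toℕ y)) 1 0 ≡ bit (does (x Fin.≟ y))
does-≟ x y with x Fin.≟ y
... | yes p = pick-≡ (cong toℕ p)
... | no ¬p = pick-≢ (¬p ∘ Fin.toℕ-injective)

edgeCount-≤ : ∀ {n} (F : Graph n) → edgeCount F ≤ n * n
edgeCount-≤ {n} F = ≤-trans (length-filter (isEdge? F) (cartesianProduct (allFin n) (allFin n)))
  (≤-reflexive (trans (length-product _,_ (allFin n) (allFin n))
    (cong₂ _*_ (length-tabulate {n = n} id) (length-tabulate {n = n} id))))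

module _ {n : ℕ} (G : Graph n) (a : ℕ → ℕ → ℕ) (rep : Represents (adj G) a) where

  clustering⇒UCED : ∀ {k s m π} → Clustering n a k s m π → UCED G k
  clustering⇒UCED {k} {s} {m} {π} C = F , F⊆G , few , m , s , part , iff , counts
    where
    part : Fin n → Fin m
    part v = fromℕ< (range C (toℕ v) (Fin.toℕ<n v))
    toℕ-part : ∀ v → toℕ (part v) ≡ π (toℕ v)
    toℕ-part v = Fin.toℕ-fromℕ< _
    part-≡ : ∀ u v → part u ≡ part v → π (toℕ u) ≡ π (toℕ v)
    part-≡ u v e = trans (sym (toℕ-part u)) (trans (cong toℕ e) (toℕ-part v))
    ≡-part : ∀ u v → π (toℕ u) ≡ π (toℕ v) → part u ≡ part v
    ≡-part u v e = Fin.toℕ-injective (trans (toℕ-part u) (trans e (sym (toℕ-part v))))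
    same : Fin n → Fin n → Bool
    same u v = does (part u Fin.≟ part v)
    same-sym : ∀ u v → same u v ≡ same v u
    same-sym u v with part u Fin.≟ part v
    ... | yes p = sym (dec-true (part v Fin.≟ part u) (sym p))
    ... | no ¬p = sym (dec-false (part v Fin.≟ part u) (¬p ∘ sym))
    F : Graph n
    F = record
      { adj    = λ u v → adj G u v ∧ not (same u v)
      ; sym    = λ u v → cong₂ (λ x y → x ∧ not y) (Graph.sym G u v) (same-sym u v)
      ; irrefl = λ v → cong (_∧ not (same v v)) (Graph.irrefl G v)
      }
    F⊆G : F ⊆ G
    F⊆G u v t with adj G u v
    ... | true = tt
    rep-F : Represents (adj F) (split a π)
    rep-F u v with adj G u v | rep u v
    ... | false | e = pick-zero e
    ... | true  | e with part u Fin.≟ part v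
    ...   | yes p = trans (cong (λ x → pick x 0 (pick (apart (π (toℕ u)) (π (toℕ v))) 0 1)) e) (pick-≡ (part-≡ u v p))
    ...   | no ¬p = trans (cong (λ x → pick x 0 (pick (apart (π (toℕ u)) (π (toℕ v))) 0 1)) e) (pick-≢ (¬p ∘ ≡-part u v))
    few : edgeCount F ≤ k
    few = *-cancelˡ-≤ 2 (≤-trans (≤-reflexive
      (trans (cong (edgeCount F +_) (+-identityʳ _)) (2*edgeCount F _ rep-F)))
      (≤-trans (budget C) (≤-reflexive (cong (k +_) (sym (+-identityʳ k))))))
    iff : ∀ u v → T (adj (G ∖ F) u v) ⇔ (u ≢ v × part u ≡ part v)
    iff u v = mk⇔ to from
      where
      to : T (adj (G ∖ F) u v) → u ≢ v × part u ≡ part v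
      to t with u Fin.≟ v
      ... | yes refl with adj G u u | Graph.irrefl G u
      ...   | false | _ = ⊥-elim t
      to t | no u≢v with adj G u v
      ...   | false = ⊥-elim t
      ...   | true with part u Fin.≟ part v
      ...     | yes p = u≢v , p
      ...     | no _ = ⊥-elim t
      from : u ≢ v × part u ≡ part v → T (adj (G ∖ F) u v)
      from (u≢v , p) with adj G u v | rep u v
      ... | false | e = clique C (toℕ u) (toℕ v) (Fin.toℕ<n u) (Fin.toℕ<n v) (u≢v ∘ Fin.toℕ-injective) (part-≡ u v p) e
      ... | true  | _ with part u Fin.≟ part v
      ...   | yes _ = tt
      ...   | no ¬p = ¬p p
    counts : ∀ i → Vec.count (λ v → part v Fin.≟ i) (Vec.allFin n) ≡ s
    counts i = trans (count-tabulate (λ v → part v Fin.≟ i) id _ λ v →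
      trans (cong (λ x → pick (apart x (toℕ i)) 1 0) (sym (toℕ-part v))) (does-≟ (part v) i))
      (sizes C (toℕ i) (Fin.toℕ<n i))

  UCED⇒clustering : ∀ {k} → UCED G k → ∃[ s ] ∃[ m ] ∃[ π ] Clustering n a (k ⊓ (n * n)) s m π
  UCED⇒clustering {k} (F , F⊆G , few , m , s , part , iff , counts) = s , m , π , record
    { range  = at-Fin λ v → subst (_< m) (sym (π-toℕ v)) (Fin.toℕ<n (part v))
    ; sizes  = at-Fin λ i → trans (sym (count-tabulate (λ v → part v Fin.≟ i) id
        (λ v → pick (apart (π v) (toℕ i)) 1 0) λ v →
        trans (cong (λ x → pick (apart x (toℕ i)) 1 0) (π-toℕ v)) (does-≟ (part v) i))) (counts i)
    ; clique = λ u v u<n v<n → at-Fin {P = λ u → u ≢ v → π u ≡ π v → a u v ≢ 0} (λ i →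
        at-Fin {P = λ v → toℕ i ≢ v → π (toℕ i) ≡ π v → a (toℕ i) v ≢ 0} (adjacent i) v v<n) u u<n
    -- No edge set has more than `n * n` elements, which is what permits replacing `k` by
    -- `k ⊓ (n * n)`.
    ; budget = ≤-trans (≤-reflexive (sym (2*edgeCount F (split a π) rep-F)))
        (+-mono-≤ (⊓-glb few (edgeCount-≤ F)) (⊓-glb few (edgeCount-≤ F)))
    }
    where
    π : ℕ → ℕ
    π v with v <? n
    ... | yes v<n = toℕ (part (fromℕ< v<n))
    ... | no _    = 0
    π-toℕ : ∀ v → π (toℕ v) ≡ toℕ (part v)
    π-toℕ v with toℕ v <? n
    ... | yes v<n = cong (toℕ ∘ part) (Fin.fromℕ<-toℕ v v<n)
    ... | no v≮n  = ⊥-elim (v≮n (Fin.toℕ<n v))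
    π-part : ∀ u v → π (toℕ u) ≡ π (toℕ v) → part u ≡ part v
    π-part u v e = Fin.toℕ-injective (trans (sym (π-toℕ u)) (trans e (π-toℕ v)))
    adjacent : ∀ i j → toℕ i ≢ toℕ j → π (toℕ i) ≡ π (toℕ j) → a (toℕ i) (toℕ j) ≢ 0
    adjacent i j i≢j e z with adj G i j | rep i j | Equivalence.from (iff i j) ((i≢j ∘ cong toℕ) , π-part i j e)
    ... | true | e | _ with () ← trans (sym z) e
    rep-F : Represents (adj F) (split a π)
    rep-F u v with adj F u v in f | adj G u v in g | rep u v | F⊆G u v | iff u v
    ... | true  | false | e | sub | _  = ⊥-elim (sub tt)
    ... | true  | true  | e | _   | eq = trans (cong (λ x → pick x 0 (pick (apart (π (toℕ u)) (π (toℕ v))) 0 1)) e)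
      (pick-≢ λ p → Equivalence.from eq (u≢v , π-part u v p))
      where
      u≢v : u ≢ v
      u≢v refl with () ← trans (sym g) (Graph.irrefl G u)
    ... | false | false | e | _   | eq = pick-zero e
    ... | false | true  | e | _   | eq = trans (cong (λ x → pick x 0 (pick (apart (π (toℕ u)) (π (toℕ v))) 0 1)) e)
      (pick-≡ (trans (π-toℕ u) (trans (cong toℕ (proj₂ (Equivalence.to eq tt))) (sym (π-toℕ v)))))

-- The digit string that produces a given clustering

Σ-delta : ∀ n {w} → w < n → Σ[ n ] (λ u → pick (apart u w) 1 0) ≡ 1
Σ-delta (suc n) {w} w<1+n with w ≟ n
... | yes refl = cong₂ _+_ (Σ-zero n λ u u<n → pick-≢ (<⇒≢ u<n)) (pick-≡ {x = n} refl)
... | no w≢n   = cong₂ _+_ (Σ-delta n (≤∧≢⇒< (s≤s⁻¹ w<1+n) w≢n)) (pick-≢ (≢-sym w≢n))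

-- The graph a on {0,…,n-1} with its vertices partitioned by π into cliques of size s; a label 0 means unlabelled.
module Partition (n : ℕ) (a : ℕ → ℕ → ℕ) (s : ℕ) (π : ℕ → ℕ)
  (a-sym  : ∀ u v → u < n → v < n → a u v ≡ a v u)
  (a-irr  : ∀ u → u < n → a u u ≡ 0)
  (size   : ∀ w → w < n → Σ[ n ] (λ u → pick (apart (π u) (π w)) 1 0) ≡ s)
  (clique : ∀ u v → u < n → v < n → u ≢ v → π u ≡ π v → a u v ≢ 0)
  where

  deg : (ℕ → ℕ) → ℕ → ℕ
  deg l v = Σ[ n ] λ u → pick (l u) (pick (a v u) 0 1) 0

  minStep : (ℕ → ℕ) → ℕ → ℕ × ℕ → ℕ × ℕ
  minStep l v (b , w) = pick (l v) (pick (suc (deg l v) ∸ b) (deg l v , v) (b , w)) (b , w)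

  -- By `deg-<` the initial value `n` acts as infinity: the first component is still `n` at the end
  -- exactly when all vertices are labelled.
  argmin : (ℕ → ℕ) → ℕ × ℕ
  argmin l = iter n (minStep l) (n , 0)

  -- A vertex is not its own neighbour, so adding the indicator of `v` to the sum leaves every term
  -- at most 1.
  deg-< : ∀ l v → v < n → deg l v < n
  deg-< l v v<n = begin-strict
    Σ[ n ] (f)                             <⟨ m<m+n _ (s≤s z≤n) ⟩
    Σ[ n ] f + 1                           ≡⟨ cong (Σ[ n ] f +_) (Σ-delta n v<n) ⟨
    Σ[ n ] f + Σ[ n ] δ                    ≡⟨ Σ-+ n f δ ⟨
    Σ[ n ] (λ u → f u + δ u)               ≤⟨ Σ-≤ n (λ u u<n → term u u<n) ⟩
    n * 1                                  ≡⟨ *-identityʳ n ⟩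
    n                                      ∎
    where
    open ≤-Reasoning
    f δ : ℕ → ℕ
    f u = pick (l u) (pick (a v u) 0 1) 0
    δ u = pick (apart u v) 1 0
    f-≤ : ∀ u → f u ≤ 1
    f-≤ u with l u | a v u
    ... | zero  | zero  = z≤n
    ... | zero  | suc _ = ≤-refl
    ... | suc _ | _     = z≤n
    f-v : f v ≡ 0
    f-v with l v | a v v | a-irr v v<n
    ... | zero  | zero | _ = refl
    ... | suc _ | _    | _ = refl
    term : ∀ u → u < n → f u + δ u ≤ 1
    term u u<n with u ≟ v
    ... | yes refl = ≤-reflexive (cong₂ _+_ f-v (pick-≡ {x = u} refl))
    ... | no u≢v   = ≤-trans (≤-reflexive (trans (cong (f u +_) (pick-≢ u≢v)) (+-identityʳ _))) (f-≤ u)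

  MinUpTo : (ℕ → ℕ) → ℕ → ℕ × ℕ → Set
  MinUpTo l j (b , w) = (b ≡ n ⊎ (w < j × l w ≡ 0 × b ≡ deg l w)) × (∀ v → v < j → l v ≡ 0 → b ≤ deg l v)

  private
    extend : ∀ l j b w → MinUpTo l j (b , w) → (l j ≡ 0 → b ≤ deg l j) → MinUpTo l (suc j) (b , w)
    extend l j b w (x , y) h = widen x , y′
      where
      widen : b ≡ n ⊎ (w < j × l w ≡ 0 × b ≡ deg l w) → b ≡ n ⊎ (w < suc j × l w ≡ 0 × b ≡ deg l w)
      widen (inj₁ e)           = inj₁ e
      widen (inj₂ (w<j , r))   = inj₂ (m<n⇒m<1+n w<j , r)
      y′ : ∀ v → v < suc j → l v ≡ 0 → b ≤ deg l v
      y′ v v<1+j e with v ≟ j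
      ... | yes refl = h e
      ... | no v≢j   = y v (≤∧≢⇒< (s≤s⁻¹ v<1+j) v≢j) e

    minStep-spec : ∀ l j b w → MinUpTo l j (b , w) → MinUpTo l (suc j) (minStep l j (b , w))
    minStep-spec l j b w I with l j in e
    ... | suc _ = extend l j b w I λ z → ⊥-elim (0≢1+n (trans (sym z) e))
    ... | zero with suc (deg l j) ∸ b in d
    ...   | suc k = extend l j b w I λ _ → ≮⇒≥ λ dj<b → 0≢1+n (trans (sym (m≤n⇒m∸n≡0 dj<b)) d)
    ...   | zero  = inj₂ (n<1+n j , e , refl) , least
      where
      least : ∀ v → v < suc j → l v ≡ 0 → deg l j ≤ deg l v
      least v v<1+j lv with v ≟ j
      ... | yes refl = ≤-refl
      ... | no v≢j   = ≤-trans (<⇒≤ (m∸n≡0⇒m≤n d)) (proj₂ I v (≤∧≢⇒< (s≤s⁻¹ v<1+j) v≢j) lv)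

    min-spec : ∀ l j → MinUpTo l j (iter j (minStep l) (n , 0))
    min-spec l zero    = inj₁ refl , λ _ ()
    min-spec l (suc j) = minStep-spec l j _ _ (min-spec l j)

  argmin-spec : ∀ l → MinUpTo l n (argmin l)
  argmin-spec l = min-spec l n

  -- w is the centre of the clique being formed: omitted and taken are the neighbours of w left out and put in.
  module Centre (l : ℕ → ℕ) (w : ℕ) where

    omitted taken : ℕ → ℕ
    omitted u = pick (l u) (pick (apart u w) 0 (pick (a w u) 0 (pick (apart (π u) (π w)) 0 1))) 0
    taken   u = pick (l u) (pick (apart u w) 0 (pick (a w u) 0 (pick (apart (π u) (π w)) 1 0))) 0

    -- A neighbour that is taken counts towards the next omission, the head of the remaining code.
    -- After the last omission nothing is recorded, as all further neighbours are taken.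
    raise : List ℕ → List ℕ
    raise []       = []
    raise (d ∷ ds) = suc d ∷ ds

    -- For each omitted neighbour, the number of neighbours taken since the previous omission.
    code : ℕ → ℕ → List ℕ
    code j zero    = []
    code j (suc r) = pick (l j) (pick (apart j w) (code (suc j) r) (pick (a w j) (code (suc j) r)
      (pick (apart (π j) (π w)) (raise (code (suc j) r)) (0 ∷ code (suc j) r)))) (code (suc j) r)

    private
      Σ-shift : ∀ f j r → Σ[ suc r ] (λ i → f (j + i)) ≡ f j + Σ[ r ] (λ i → f (suc j + i))
      Σ-shift f j r = trans (Σ-front r _)
        (cong₂ _+_ (cong f (+-identityʳ j)) (Σ-cong r λ i _ → cong f (+-suc j i)))

      length-raise : ∀ ds → length (raise ds) ≡ length ds
      length-raise []       = refl
      length-raise (d ∷ ds) = refl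

      raise-≤ : ∀ {B ds} → All (_≤ B) ds → All (_≤ suc B) (raise ds)
      raise-≤ []       = []
      raise-≤ (p ∷ ps) = s≤s p ∷ All.map m≤n⇒m≤1+n ps

    length-code : ∀ j r → length (code j r) ≡ Σ[ r ] (λ i → omitted (j + i))
    length-code j zero    = refl
    length-code j (suc r) = trans step′ (sym (Σ-shift omitted j r))
      where
      ih = length-code (suc j) r
      step′ : length (code j (suc r)) ≡ omitted j + Σ[ r ] (λ i → omitted (suc j + i))
      step′ with l j
      ... | suc _ = ih
      ... | zero with apart j w
      ...   | zero = ih
      ...   | suc _ with a w j
      ...     | zero = ih
      ...     | suc _ with apart (π j) (π w)
      ...       | zero  = trans (length-raise (code (suc j) r)) ih
      ...       | suc _ = cong suc ih

    -- A digit counts some of the neighbours taken from `j` on, so their total bounds it. By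
    -- `Σ-taken` the total over all vertices is `s - 1`, which gives digits below `s`.
    code-≤ : ∀ j r → All (_≤ Σ[ r ] (λ i → taken (j + i))) (code j r)
    code-≤ j zero    = []
    code-≤ j (suc r) = subst (λ B → All (_≤ B) (code j (suc r))) (sym (Σ-shift taken j r)) step′
      where
      ih = code-≤ (suc j) r
      step′ : All (_≤ taken j + Σ[ r ] (λ i → taken (suc j + i))) (code j (suc r))
      step′ with l j
      ... | suc _ = ih
      ... | zero with apart j w
      ...   | zero = ih
      ...   | suc _ with a w j
      ...     | zero = ih
      ...     | suc _ with apart (π j) (π w)
      ...       | zero  = raise-≤ ih
      ...       | suc _ = z≤n ∷ ih

    module _ (w<n : w < n) (lw : l w ≡ 0) (whole : ∀ u v → u < n → v < n → π u ≡ π v → l u ≡ l v) where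

      -- The class of `w` is a clique, and by `whole` none of it is labelled; hence its members
      -- other than `w` are exactly the neighbours taken.
      Σ-taken : suc (Σ[ n ] taken) ≡ s
      Σ-taken = begin
        suc (Σ[ n ] taken)                                   ≡⟨ +-comm 1 _ ⟩
        Σ[ n ] taken + 1                                     ≡⟨ cong (Σ[ n ] taken +_) (Σ-delta n w<n) ⟨
        Σ[ n ] taken + Σ[ n ] δ                              ≡⟨ Σ-+ n taken δ ⟨
        Σ[ n ] (λ u → taken u + δ u)                         ≡⟨ Σ-cong n term ⟩
        Σ[ n ] (λ u → pick (apart (π u) (π w)) 1 0)          ≡⟨ size w w<n ⟩
        s                                                    ∎
        where
        open ≡-Reasoning
        δ : ℕ → ℕ
        δ u = pick (apart u w) 1 0
        in-class : ∀ u → u < n → u ≢ w → π u ≡ π w → taken u ≡ 1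
        in-class u u<n u≢w e = trans (pick-zero (trans (whole u w u<n w<n e) lw)) (trans (pick-≢ u≢w)
          (trans (pick-nonzero (clique w u w<n u<n (≢-sym u≢w) (sym e))) (pick-≡ e)))
        outside : ∀ u → π u ≢ π w → taken u ≡ 0
        outside u ne with l u
        ... | suc _ = refl
        ... | zero with apart u w
        ...   | zero = refl
        ...   | suc _ with a w u
        ...     | zero = refl
        ...     | suc _ = pick-≢ ne
        term : ∀ u → u < n → taken u + δ u ≡ pick (apart (π u) (π w)) 1 0
        term u u<n with u ≟ w
        ... | yes refl = trans (cong₂ _+_ (trans (pick-zero lw) (pick-≡ {x = u} refl)) (pick-≡ {x = u} refl))
                           (sym (pick-≡ {x = π u} refl))
        ... | no u≢w with π u ≟ π w
        ...   | yes e = trans (cong₂ _+_ (in-class u u<n u≢w e) (pick-≢ u≢w)) (sym (pick-≡ e))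
        ...   | no ne = trans (cong₂ _+_ (outside u ne) (pick-≢ u≢w)) (sym (pick-≢ ne))

      Σ-omitted : Σ[ n ] omitted ≡ deg l w ∸ (s ∸ 1)
      Σ-omitted = begin
        Σ[ n ] omitted                                  ≡⟨ m+n∸n≡m _ (Σ[ n ] taken) ⟨
        Σ[ n ] omitted + Σ[ n ] taken ∸ Σ[ n ] taken     ≡⟨ cong (_∸ Σ[ n ] taken) (Σ-+ n omitted taken) ⟨
        Σ[ n ] (λ u → omitted u + taken u) ∸ Σ[ n ] taken ≡⟨ cong₂ _∸_ (Σ-cong n term) (cong (_∸ 1) Σ-taken) ⟩
        deg l w ∸ (s ∸ 1)                               ∎
        where
        open ≡-Reasoning
        term : ∀ u → u < n → omitted u + taken u ≡ pick (l u) (pick (a w u) 0 1) 0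
        term u u<n with l u
        ... | suc _ = refl
        ... | zero with u ≟ w
        ...   | yes refl = trans (cong₂ _+_ (pick-≡ {x = u} refl) (pick-≡ {x = u} refl)) (sym (pick-zero (a-irr u u<n)))
        ...   | no u≢w = trans (cong₂ _+_ (pick-≢ u≢w) (pick-≢ u≢w)) rest
          where
          rest : pick (a w u) 0 (pick (apart (π u) (π w)) 0 1) + pick (a w u) 0 (pick (apart (π u) (π w)) 1 0) ≡ pick (a w u) 0 1
          rest with a w u | apart (π u) (π w)
          ... | zero  | _     = refl
          ... | suc _ | zero  = refl
          ... | suc _ | suc _ = refl

      -- The right-hand side involves the labelling and `s` but not `π`, so the program can compute
      -- it and knows how many digits belong to this clique.
      length-code₀ : length (code 0 n) ≡ deg l w ∸ (s ∸ 1)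
      length-code₀ = trans (length-code 0 n) Σ-omitted

      code-<s : All (_< s) (code 0 n)
      code-<s = All.map (λ d≤ → ≤-trans (s≤s d≤) (≤-reflexive Σ-taken)) (code-≤ 0 n)

  -- The intended result of one round. It consults `π`, which the program does not have; the digits
  -- take its place.
  relabel : (ℕ → ℕ) → ℕ → ℕ → ℕ → ℕ
  relabel l w m v = pick (l v) (pick (apart (π v) (π w)) m 0) (l v)

  record Consistent (l : ℕ → ℕ) (m : ℕ) : Set where
    field
      below  : ∀ v → v < n → l v ≤ m
      whole  : ∀ u v → u < n → v < n → π u ≡ π v → l u ≡ l v
      pure   : ∀ u v → u < n → v < n → l u ≡ l v → l u ≢ 0 → π u ≡ π v
      -- Excludes empty cliques, for which the size check would fail.
      used   : ∀ i → i < m → ∃[ v ] v < n × l v ≡ suc i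

  open Consistent

  relabel-old : ∀ l w m v → l v ≢ 0 → relabel l w m v ≡ l v
  relabel-old l w m v h = pick-nonzero h

  relabel-new : ∀ l w m v → l v ≡ 0 → π v ≡ π w → relabel l w m v ≡ m
  relabel-new l w m v h e = trans (pick-zero h) (pick-≡ e)

  relabel-out : ∀ l w m v → l v ≡ 0 → π v ≢ π w → relabel l w m v ≡ 0
  relabel-out l w m v h e = trans (pick-zero h) (pick-≢ e)

  relabel-consistent : ∀ {l w m} → w < n → l w ≡ 0 → Consistent l m → Consistent (relabel l w (suc m)) (suc m)
  relabel-consistent {l} {w} {m} w<n lw C = record { below = below′ ; whole = whole′ ; pure = pure′ ; used = used′ }
    where
    l′ : ℕ → ℕ
    l′ = relabel l w (suc m)
    data View (v : ℕ) : Set where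
      old : l v ≢ 0 → l′ v ≡ l v → View v
      new : l v ≡ 0 → π v ≡ π w → l′ v ≡ suc m → View v
      out : l v ≡ 0 → π v ≢ π w → l′ v ≡ 0 → View v
    view : ∀ v → View v
    view v with l v ≟ 0
    ... | no  h = old h (relabel-old l w (suc m) v h)
    ... | yes h with π v ≟ π w
    ...   | yes e = new h e (relabel-new l w (suc m) v h e)
    ...   | no  e = out h e (relabel-out l w (suc m) v h e)
    below′ : ∀ v → v < n → l′ v ≤ suc m
    below′ v v<n with view v
    ... | old _ e   = ≤-trans (≤-reflexive e) (m≤n⇒m≤1+n (below C v v<n))
    ... | new _ _ e = ≤-reflexive e
    ... | out _ _ e = ≤-trans (≤-reflexive e) z≤n
    whole′ : ∀ u v → u < n → v < n → π u ≡ π v → l′ u ≡ l′ v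
    whole′ u v u<n v<n e = cong₂ (λ x y → pick x (pick (apart y (π w)) (suc m) 0) x) (whole C u v u<n v<n e) e
    pure′ : ∀ u v → u < n → v < n → l′ u ≡ l′ v → l′ u ≢ 0 → π u ≡ π v
    pure′ u v u<n v<n e h with view u | view v
    ... | out _ _ x | _         = ⊥-elim (h x)
    ... | _         | out _ _ y = ⊥-elim (h (trans e y))
    ... | old p x   | old q y   = pure C u v u<n v<n (trans (sym x) (trans e y)) p
    ... | old p x   | new _ _ y = ⊥-elim (<⇒≢ (s≤s (below C u u<n)) (trans (sym x) (trans e y)))
    ... | new _ _ x | old q y   = ⊥-elim (<⇒≢ (s≤s (below C v v<n)) (trans (sym y) (trans (sym e) x)))
    ... | new _ p _ | new _ q _ = trans p (sym q)
    used′ : ∀ i → i < suc m → ∃[ v ] v < n × l′ v ≡ suc i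
    used′ i i<1+m with i ≟ m
    ... | yes refl = w , w<n , relabel-new l w (suc m) w lw refl
    ... | no i≢m with v , v<n , e ← used C i (≤∧≢⇒< (s≤s⁻¹ i<1+m) i≢m) =
      v , v<n , trans (relabel-old l w (suc m) v λ z → 0≢1+n (trans (sym z) e)) e

  unlabelled : (ℕ → ℕ) → ℕ → ℕ
  unlabelled l v = pick (l v) 1 0

  caught : (ℕ → ℕ) → ℕ → ℕ → ℕ
  caught l w v = pick (l v) (pick (apart (π v) (π w)) 1 0) 0

  unlabelled-split : ∀ l w m v → unlabelled l v ≡ unlabelled (relabel l w (suc m)) v + caught l w v
  unlabelled-split l w m v with l v
  ... | suc _ = refl
  ... | zero with apart (π v) (π w)
  ...   | zero  = refl
  ...   | suc _ = refl

  -- Twice the number of deleted edges with both ends unlabelled. It starts as twice the size of the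
  -- solution, and each digit consumes `s + s` of it.
  Φ : (ℕ → ℕ) → ℕ
  Φ l = ΣΣ n λ u v → unlabelled l u * (unlabelled l v * split a π u v)

  split-sym : ∀ u v → u < n → v < n → split a π u v ≡ split a π v u
  split-sym u v u<n v<n = cong₂ (λ x y → pick x 0 (pick y 0 1)) (a-sym u v u<n v<n) (+-comm (π u ∸ π v) (π v ∸ π u))

  private
    expand : ∀ p q r t x → (p + q) * ((r + t) * x) ≡ p * (r * x) + (p * (t * x) + (q * (r * x) + q * (t * x)))
    expand = solve-∀

    swap₃ : ∀ p t x → p * (t * x) ≡ t * (p * x)
    swap₃ = solve-∀

  -- Every vertex of the new clique has degree at least that of w, hence at least e edges to unlabelled vertices outside it.
  Φ-drop : ∀ {l w m} → w < n → l w ≡ 0 → Consistent l m → (∀ v → v < n → l v ≡ 0 → deg l w ≤ deg l v) →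
           Φ (relabel l w (suc m)) + (s + s) * (deg l w ∸ (s ∸ 1)) ≤ Φ l
  Φ-drop {l} {w} {m} w<n lw C least = begin
    -- Vertices unlabelled before the round either stay so (`p`) or join the new clique (`q`). The
    -- sums `out` and `into` count the same edges in their two orientations, whence the factor
    -- `s + s`.
    Φ l′ + (s + s) * e                                    ≡⟨ cong (Φ l′ +_) (*-distribʳ-+ e s s) ⟩
    Φ l′ + (s * e + s * e)                                ≤⟨ +-monoʳ-≤ (Φ l′) (+-mono-≤ out-≥ out-≥) ⟩
    Φ l′ + (ΣΣ n out + ΣΣ n out)                          ≤⟨ +-monoʳ-≤ (Φ l′) (+-monoʳ-≤ (ΣΣ n out) (m≤m+n _ (ΣΣ n inside))) ⟩
    Φ l′ + (ΣΣ n out + (ΣΣ n out + ΣΣ n inside))          ≡⟨ cong (λ z → Φ l′ + (z + (ΣΣ n out + ΣΣ n inside))) swapped ⟩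
    Φ l′ + (ΣΣ n into + (ΣΣ n out + ΣΣ n inside))         ≡⟨ cong (λ z → Φ l′ + (ΣΣ n into + z)) (ΣΣ-+ n out inside) ⟨
    Φ l′ + (ΣΣ n into + ΣΣ n (λ u v → out u v + inside u v)) ≡⟨ cong (Φ l′ +_) (ΣΣ-+ n into (λ u v → out u v + inside u v)) ⟨
    Φ l′ + ΣΣ n (λ u v → into u v + (out u v + inside u v)) ≡⟨ ΣΣ-+ n rest (λ u v → into u v + (out u v + inside u v)) ⟨
    ΣΣ n (λ u v → rest u v + (into u v + (out u v + inside u v))) ≡⟨ ΣΣ-cong n (λ u v _ _ → sym (expand (p u) (q u) (p v) (q v) (x u v))) ⟩
    ΣΣ n (λ u v → (p u + q u) * ((p v + q v) * x u v))    ≡⟨ ΣΣ-cong n (λ u v _ _ → cong₂ (λ y z → y * (z * x u v))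
                                                               (sym (unlabelled-split l w m u)) (sym (unlabelled-split l w m v))) ⟩
    Φ l                                                   ∎
    where
    open ≤-Reasoning
    l′ p q : ℕ → ℕ
    l′ = relabel l w (suc m)
    p = unlabelled l′
    q = caught l w
    x rest into out inside : ℕ → ℕ → ℕ
    x = split a π
    rest   u v = p u * (p v * x u v)
    into   u v = p u * (q v * x u v)
    out    u v = q u * (p v * x u v)
    inside u v = q u * (q v * x u v)
    e : ℕ
    e = deg l w ∸ (s ∸ 1)
    swapped : ΣΣ n out ≡ ΣΣ n into
    swapped = trans (Σ-swap n n out) (ΣΣ-cong n λ u v u<n v<n →
      trans (swap₃ (q v) (p u) (x v u)) (cong (λ z → p u * (q v * z)) (split-sym v u v<n u<n)))
    caught-class : ∀ v → v < n → q v ≡ pick (apart (π v) (π w)) 1 0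
    caught-class v v<n with π v ≟ π w
    ... | yes eq = pick-zero (trans (whole C v w v<n w<n eq) lw)
    ... | no ne with l v
    ...   | zero  = refl
    ...   | suc _ = sym (pick-≢ ne)
    omit-≤ : ∀ u → π u ≡ π w → ∀ v → Centre.omitted l u v ≤ p v * x u v
    omit-≤ u πu v with l v
    ... | suc _ = z≤n
    ... | zero with apart v u
    ...   | zero = z≤n
    ...   | suc _ with a u v
    ...     | zero = z≤n
    ...     | suc _ with π v ≟ π u
    ...       | yes eq = ≤-trans (≤-reflexive (pick-≡ eq)) z≤n
    ...       | no ne = ≤-trans (≤-reflexive (pick-≢ ne)) (≤-reflexive (sym (cong₂ _*_
                  (cong (λ z → pick z 1 0) (pick-≢ {x = π v} (λ r → ne (trans r (sym πu))))) (pick-≢ (≢-sym ne)))))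
    row : ∀ u → u < n → q u * e ≤ Σ[ n ] (out u)
    row u u<n = ≤-trans (go u u<n) (≤-reflexive (sym (Σ-*ˡ n (q u) (λ v → p v * x u v))))
      where
      go : ∀ u → u < n → q u * e ≤ q u * Σ[ n ] (λ v → p v * x u v)
      go u u<n with l u in lu
      ... | suc _ = z≤n
      ... | zero with π u ≟ π w
      ...   | no ne = subst (λ z → z * e ≤ z * Σ[ n ] (λ v → p v * x u v)) (sym (pick-≢ ne)) z≤n
      ...   | yes eq = *-monoʳ-≤ (pick (apart (π u) (π w)) 1 0)
        (≤-trans (∸-monoˡ-≤ (s ∸ 1) (least u u<n lu))
        -- Here `u` itself is regarded as a centre: its degree exceeds `s - 1` by the number of its
        -- unlabelled neighbours outside the class.
        (≤-trans (≤-reflexive (sym (Centre.Σ-omitted l u u<n lu (whole C))))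
                 (Σ-mono n λ v _ → omit-≤ u eq v)))
    out-≥ : s * e ≤ ΣΣ n out
    out-≥ = begin
      s * e                           ≡⟨ cong (_* e) (trans (sym (size w w<n)) (Σ-cong n λ v v<n → sym (caught-class v v<n))) ⟩
      Σ[ n ] q * e                    ≡⟨ *-comm _ e ⟩
      e * Σ[ n ] q                    ≡⟨ Σ-*ˡ n e q ⟨
      Σ[ n ] (λ u → e * q u)          ≤⟨ Σ-mono n (λ u u<n → ≤-trans (≤-reflexive (*-comm e (q u))) (row u u<n)) ⟩
      ΣΣ n out                        ∎

  -- The first argument is the number of rounds left. Once everything is labelled, the rounds that
  -- remain contribute no digits.
  plan : ℕ → (ℕ → ℕ) → ℕ → List ℕ
  plan zero    l m = []
  plan (suc r) l m = pick (suc (proj₁ (argmin l)) ∸ n)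
    (Centre.code l (proj₂ (argmin l)) 0 n ++ plan r (relabel l (proj₂ (argmin l)) (suc m)) (suc m))
    (plan r l m)

  data Next (l : ℕ → ℕ) : Set where
    finished : (∀ v → v < n → l v ≢ 0) → proj₁ (argmin l) ≡ n → Next l
    centre   : proj₂ (argmin l) < n → l (proj₂ (argmin l)) ≡ 0 → proj₁ (argmin l) ≡ deg l (proj₂ (argmin l)) →
               (∀ v → v < n → l v ≡ 0 → deg l (proj₂ (argmin l)) ≤ deg l v) → Next l

  next-centre : ∀ l → Next l
  next-centre l with argmin l in eq | argmin-spec l
  ... | b , w | inj₁ refl , least = finished
    (λ v v<n lv → <⇒≱ (deg-< l v v<n) (least v v<n lv)) (cong proj₁ eq)
  ... | b , w | inj₂ (w<n , lw , e) , least = centre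
    (subst (_< n) (sym (cong proj₂ eq)) w<n) (trans (cong (l ∘ proj₂) eq) lw)
    (trans (cong proj₁ eq) (trans e (cong (deg l ∘ proj₂) (sym eq))))
    λ v v<n lv → ≤-trans (≤-reflexive (trans (cong (deg l ∘ proj₂) eq) (sym e))) (least v v<n lv)

  plan-digits : ∀ r {l m} → Consistent l m → All (_< s) (plan r l m)
  plan-digits zero    C = []
  plan-digits (suc r) {l} {m} C with next-centre l
  ... | finished _ e = subst (All (_< s)) (sym (pick-∸-> (s≤s (≤-reflexive (sym e))))) (plan-digits r C)
  ... | centre w<n lw e _ = subst (All (_< s))
    (sym (pick-∸-≤ (subst (_< n) (sym e) (deg-< l _ w<n))))
    (++⁺ (Centre.code-<s l _ w<n lw (whole C)) (plan-digits r (relabel-consistent w<n lw C)))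

  -- Telescopes `Φ-drop` over the rounds.
  plan-length : ∀ r {l m} → Consistent l m → (s + s) * length (plan r l m) ≤ Φ l
  plan-length zero    C = ≤-trans (≤-reflexive (*-zeroʳ (s + s))) z≤n
  plan-length (suc r) {l} {m} C with next-centre l
  ... | finished _ e = subst (λ ds → (s + s) * length ds ≤ Φ l)
    (sym (pick-∸-> (s≤s (≤-reflexive (sym e))))) (plan-length r C)
  ... | centre w<n lw e least = subst (λ ds → (s + s) * length ds ≤ Φ l)
    (sym (pick-∸-≤ (subst (_< n) (sym e) (deg-< l _ w<n))))
    (begin
      (s + s) * length (ds₁ ++ ds₂)                ≡⟨ cong ((s + s) *_) (length-++ ds₁) ⟩
      (s + s) * (length ds₁ + length ds₂)          ≡⟨ *-distribˡ-+ (s + s) (length ds₁) (length ds₂) ⟩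
      (s + s) * length ds₁ + (s + s) * length ds₂  ≤⟨ +-mono-≤
        (≤-reflexive (cong ((s + s) *_) (Centre.length-code₀ l w w<n lw (whole C))))
        (plan-length r (relabel-consistent w<n lw C)) ⟩
      (s + s) * (deg l w ∸ (s ∸ 1)) + Φ (relabel l w (suc m)) ≡⟨ +-comm _ (Φ (relabel l w (suc m))) ⟩
      Φ (relabel l w (suc m)) + (s + s) * (deg l w ∸ (s ∸ 1)) ≤⟨ Φ-drop w<n lw C least ⟩
      Φ l                                          ∎)
    where
    open ≤-Reasoning
    w : ℕ
    w = proj₂ (argmin l)
    ds₁ ds₂ : List ℕ
    ds₁ = Centre.code l w 0 n
    ds₂ = plan r (relabel l w (suc m)) (suc m)

  -- At least the centre itself gets labelled; this is why `n` rounds are enough.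
  Σ-unlabelled-drop : ∀ {l w m} → w < n → l w ≡ 0 →
    suc (Σ[ n ] (unlabelled (relabel l w (suc m)))) ≤ Σ[ n ] (unlabelled l)
  Σ-unlabelled-drop {l} {w} {m} w<n lw = begin
    suc (Σ[ n ] p)                   ≡⟨ +-comm 1 _ ⟩
    Σ[ n ] p + 1                     ≤⟨ +-monoʳ-≤ (Σ[ n ] p) (≤-trans (≤-reflexive (sym caught-w)) (Σ-term n (caught l w) w<n)) ⟩
    Σ[ n ] p + Σ[ n ] (caught l w)   ≡⟨ Σ-+ n p (caught l w) ⟨
    Σ[ n ] (λ v → p v + caught l w v) ≡⟨ Σ-cong n (λ v _ → sym (unlabelled-split l w m v)) ⟩
    Σ[ n ] (unlabelled l)            ∎
    where
    open ≤-Reasoning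
    p : ℕ → ℕ
    p = unlabelled (relabel l w (suc m))
    caught-w : caught l w w ≡ 1
    caught-w = trans (pick-zero lw) (pick-≡ {x = π w} refl)

-- The program

-- Variables: 0 is n, 2 is min(k, n²), 3 the clique size s, 4 the number of digits, 5 is zero at the end, 6 is the answer,
-- 7 the number of cliques so far, 8 the position of the current digit, 9 its unread part, 10 the number of omissions to
-- come, 11 and 12 the least degree and its vertex, 13 the carry, 17 and 19 the addresses n² and n² + n of the labels and
-- the digits; 1 is k at first and then a loop index, like the others.  A condition holds if its value is zero: x ⊖ y
-- stands for x ≤ y and differ x y for x = y.

one : Expr
one = suc zero

cell-label cell-digit label digit : Expr → Expr
cell-label x = var 17 ⊕ x
cell-digit i = var 19 ⊕ i
label x = rd (cell-label x)
digit i = rd (cell-digit i)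

-- There is no multiplication, so the address `x * n + y` of a matrix entry is formed by adding up
-- `n` over an index below `x`.
edge differ : Expr → Expr → Expr
edge x y = rd (sum 18 x (var 0) ⊕ y)
differ x y = (x ⊖ y) ⊕ (y ⊖ x)

degree : Expr → Expr
degree x = sum 1 (var 0) (if0 (label (var 1)) (if0 (edge x (var 1)) zero one) zero)

pickMin findMin take omit place spread round guess : Cmd
pickMin = if0 (label (var 15)) (if0 (suc (degree (var 15)) ⊖ var 11)
            (set 11 (degree (var 15)) ⨟ set 12 (var 15)) skip) skip
findMin = set 11 (var 0) ⨟ set 12 zero ⨟ for 15 0 pickMin
take    = put (cell-label (var 16)) (var 7) ⨟ set 9 (var 9 ⊖ one)
omit    = set 10 (var 10 ⊖ one) ⨟ set 8 (suc (var 8)) ⨟ set 9 (digit (var 8))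
-- The centre is labelled without reading a digit. A neighbour of it is omitted only if an omission
-- is still due and the current digit is used up.
place   = if0 (label (var 16))
            (if0 (differ (var 16) (var 12)) (put (cell-label (var 16)) (var 7))
              (if0 (edge (var 12) (var 16)) skip (if0 (var 10) take (if0 (var 9) omit take)))) skip
spread  = set 7 (suc (var 7)) ⨟ set 10 (var 11 ⊖ (var 3 ⊖ one)) ⨟ set 9 (digit (var 8)) ⨟ for 16 0 place
round   = findMin ⨟ if0 (suc (var 11) ⊖ var 0) spread skip
guess   = for 14 0 round

-- These values are tested but never stored, so they may exceed what `Small` allows for assignments.
-- As `cut` counts ordered pairs, `check` compares it with twice the budget.
bad-range bad-size bad-clique cut : Expr
bad-range  = sum 15 (var 0) (if0 (label (var 15)) one (label (var 15) ⊖ var 7))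
bad-size   = sum 15 (var 7) (differ (sum 16 (var 0)
               (if0 (differ (label (var 16)) (suc (var 15))) one zero)) (var 3))
bad-clique = sum 15 (var 0) (sum 16 (var 0) (if0 (differ (label (var 15)) (label (var 16)))
               (if0 (differ (var 15) (var 16)) zero (if0 (edge (var 15) (var 16)) one zero)) zero))
cut        = sum 15 (var 0) (sum 16 (var 0) (if0 (edge (var 15) (var 16)) zero
               (if0 (differ (label (var 15)) (label (var 16))) zero one)))

check erase bump odometer advance reset body : Cmd
check    = if0 (bad-range ⊕ bad-size ⊕ bad-clique ⊕ (cut ⊖ (var 2 ⊕ var 2))) (set 6 one) skip
erase    = for 15 0 (put (cell-label (var 15)) zero)
bump     = if0 (suc (var 14) ⊖ var 4) (if0 (var 13) skip
             (if0 (var 3 ⊖ suc (digit (var 14))) (put (cell-digit (var 14)) zero)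
               (put (cell-digit (var 14)) (suc (digit (var 14))) ⨟ set 13 zero))) skip
-- Only variables 0 and 2 may bound loops. Variable 2 is at least the number of digits by `quot-≤`,
-- and `bump` passes over positions beyond the last digit.
odometer = set 13 one ⨟ for 14 2 bump
advance  = if0 (var 13) skip
             (set 3 (suc (var 3)) ⨟
              -- The rounded-down quotient of `K` by the new size, found by counting the multiples
              -- `(j + 1) * s` that do not exceed `K`.
              set 4 (sum 1 (var 2) (if0 (sum 18 (suc (var 1)) (var 3) ⊖ var 2) one zero)) ⨟
              -- The search ends when the size reaches `n + 2`. Going up to `n + 1` makes the
              -- initial size 1 admissible even for `n = 0`.
              if0 (suc (suc (var 0)) ⊖ var 3) (set 5 zero) skip)
-- Brings every number back below `limit`; otherwise the growth permitted by `run-tame` would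
-- accumulate over exponentially many rounds.
reset    = set 1 zero ⨟ set 7 zero ⨟ set 8 zero ⨟ set 9 zero ⨟ set 10 zero ⨟ set 11 zero ⨟ set 12 zero ⨟
           set 13 zero ⨟ set 14 zero ⨟ set 15 zero ⨟ set 16 zero ⨟ set 18 zero
body     = guess ⨟ check ⨟ erase ⨟ odometer ⨟ advance ⨟ reset

tally count extend settle prelude : Cmd
tally   = set 17 (suc (var 17)) ⨟ if0 (var 1) skip (set 1 (var 1 ⊖ one) ⨟ set 2 (suc (var 2)))
count   = for 15 0 (for 16 0 tally)
extend  = for 15 0 (set 19 (suc (var 19)))
settle  = set 1 zero ⨟ set 15 zero ⨟ set 16 zero ⨟ set 3 one ⨟ set 4 (var 2) ⨟ set 5 one
prelude = count ⨟ set 19 (var 17) ⨟ extend ⨟ settle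

main : Code
-- The outer loop is not a `Cmd`: the loops of commands are bounded by a variable, and the number of
-- strings is too large for that.
main = compile prelude vars ⨾ while 5 (compile body vars) ⨾ compile (set 0 (var 6)) vars

program : Program
program = asm 0 main

-- For a concrete command `Static`, like `Fixes` and `Pure` below, computes to nested pairs of `⊤`,
-- so an underscore is a proof.
body-static : Static body
body-static = _

-- What the phases of the program leave unchanged

Fixes : ℕ → Cmd → Set
Fixes x skip        = ⊤
Fixes x (set y _)   = T (not (y ≡ᵇ x))
Fixes x (put _ _)   = ⊤
Fixes x (c ⨟ d)     = Fixes x c × Fixes x d
Fixes x (if0 _ c d) = Fixes x c × Fixes x d
Fixes x (for i _ c) = T (not (i ≡ᵇ x)) × Fixes x c

≔-fixes : ∀ {x y} {v w : ℕ} → T (not (y ≡ᵇ x)) → (if y ≡ᵇ x then v else w) ≡ w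
≔-fixes {x} {y} t with y ≡ᵇ x
... | false = refl

mutual
  run-fixes : ∀ x c {σ} → Fixes x c → rg (run c σ) x ≡ rg σ x
  run-fixes x skip        _       = refl
  run-fixes x (set y e)   f       = ≔-fixes {x} {y} f
  run-fixes x (put a e)   _       = refl
  run-fixes x (c ⨟ d)     (f , g) = trans (run-fixes x d g) (run-fixes x c f)
  run-fixes x (if0 e c d) {σ} (f , g) with ⟦ e ⟧ σ
  ... | zero  = run-fixes x c f
  ... | suc _ = run-fixes x d g
  run-fixes x (for i y c) {σ} f = for-fixes x i c f (rg σ y)

  for-fixes : ∀ x i c {σ} → T (not (i ≡ᵇ x)) × Fixes x c → ∀ j → rg (forState i c σ j) x ≡ rg σ x
  for-fixes x i c f       zero    = refl
  for-fixes x i c (t , f) (suc j) =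
    trans (run-fixes x c f) (trans (≔-fixes {x} {i} t) (for-fixes x i c (t , f) j))

Pure : Cmd → Set
Pure skip        = ⊤
Pure (set _ _)   = ⊤
Pure (put _ _)   = ⊥
Pure (c ⨟ d)     = Pure c × Pure d
Pure (if0 _ c d) = Pure c × Pure d
Pure (for _ _ c) = Pure c

mutual
  run-pure : ∀ c {σ} → Pure c → mm (run c σ) ≡ mm σ
  run-pure skip        _       = refl
  run-pure (set _ _)   _       = refl
  run-pure (c ⨟ d)     (p , q) = trans (run-pure d q) (run-pure c p)
  run-pure (if0 e c d) {σ} (p , q) with ⟦ e ⟧ σ
  ... | zero  = run-pure c p
  ... | suc _ = run-pure d q
  run-pure (for i x c) {σ} p = for-pure i c p (rg σ x)

  for-pure : ∀ i c {σ} → Pure c → ∀ j → mm (forState i c σ j) ≡ mm σ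
  for-pure i c p zero    = refl
  for-pure i c p (suc j) = trans (run-pure c p) (for-pure i c p j)

pick-ind : ∀ {A : Set} (P : A → Set) n {a b} → P a → P b → P (pick n a b)
pick-ind P zero    p q = p
pick-ind P (suc _) p q = q

pick-map : ∀ {A B : Set} (f : A → B) n {a b} → f (pick n a b) ≡ pick n (f a) (f b)
pick-map f zero    = refl
pick-map f (suc _) = refl

-- The excepted cells are those of the labels, which lie between the adjacency matrix and the
-- digits.
Frame : ℕ → (M M′ : ℕ → ℕ) → Set
Frame n M M′ = ∀ c → (∀ u → u < n → c ≢ n * n + u) → M′ c ≡ M c

frame-trans : ∀ {n M M′ M″} → Frame n M M′ → Frame n M′ M″ → Frame n M M″
frame-trans f g c h = trans (g c h) (f c h)

frame-put : ∀ {n M u v} → u < n → Frame n M (M [ n * n + u ≔ v ])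
frame-put u<n c h = ≔-other (≢-sym (h _ u<n))

digit-cell : ∀ n i u → u < n → n * n + n + i ≢ n * n + u
digit-cell n i u u<n e = <⇒≢ u<n (sym (≤-antisym
  (≤-trans (m≤m+n n i) (≤-reflexive (+-cancelˡ-≡ (n * n) (n + i) u (trans (sym (+-assoc (n * n) n i)) e)))) (<⇒≤ u<n)))

edge-cell-< : ∀ {n u v} → u < n → v < n → Σ[ u ] (λ _ → n) + v < n * n
edge-cell-< {n} {u} {v} u<n v<n = begin-strict
  Σ[ u ] (λ _ → n) + v  ≡⟨ cong (_+ v) (Σ-const u n) ⟩
  u * n + v             <⟨ +-monoʳ-< (u * n) v<n ⟩
  u * n + n             ≡⟨ +-comm (u * n) n ⟩
  suc u * n             ≤⟨ *-monoˡ-≤ n u<n ⟩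
  n * n                 ∎
  where open ≤-Reasoning

edge-cell : ∀ {n} u v → u < n → v < n → ∀ w → w < n → Σ[ u ] (λ _ → n) + v ≢ n * n + w
edge-cell {n} u v u<n v<n w _ = <⇒≢ (<-≤-trans (edge-cell-< u<n v<n) (m≤m+n (n * n) w))

record Layout (n : ℕ) (σ : State) : Set where
  constructor layout
  field
    r0  : rg σ 0 ≡ n
    r17 : rg σ 17 ≡ n * n
    r19 : rg σ 19 ≡ n * n + n

layout-run : ∀ {n σ} c → Fixes 0 c × Fixes 17 c × Fixes 19 c → Layout n σ → Layout n (run c σ)
layout-run c (f , g , h) (layout a b d) =
  layout (trans (run-fixes 0 c f) a) (trans (run-fixes 17 c g) b) (trans (run-fixes 19 c h) d)

layout-for : ∀ {n σ} i c → T (not (i ≡ᵇ 0)) × Fixes 0 c → T (not (i ≡ᵇ 17)) × Fixes 17 c → T (not (i ≡ᵇ 19)) × Fixes 19 c →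
             Layout n σ → ∀ j → Layout n (forState i c σ j)
layout-for i c f g h (layout a b d) j =
  layout (trans (for-fixes 0 i c f j) a) (trans (for-fixes 17 i c g j) b) (trans (for-fixes 19 i c h j) d)

place-frame : ∀ {n σ} → rg σ 17 ≡ n * n → rg σ 16 < n → Frame n (mm σ) (mm (run place σ))
place-frame {n} {σ} r17 u<n = pick-ind P (mm σ (rg σ 17 + rg σ 16))
  (pick-ind P (apart (rg σ 16) (rg σ 12)) written
    (pick-ind P (mm σ (Σ[ rg σ 12 ] (λ _ → rg σ 0) + rg σ 16)) kept
      (pick-ind P (rg σ 10) written (pick-ind P (rg σ 9) kept written)))) kept
  where
  P : State → Set
  P τ = Frame n (mm σ) (mm τ)
  kept : Frame n (mm σ) (mm σ)
  kept c _ = refl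
  written : Frame n (mm σ) (mm σ [ rg σ 17 + rg σ 16 ≔ rg σ 7 ])
  written = subst (λ N → Frame n (mm σ) (mm σ [ N + rg σ 16 ≔ rg σ 7 ])) (sym r17) (frame-put u<n)

place-for-frame : ∀ {n σ} → rg σ 17 ≡ n * n → ∀ j → j ≤ n → Frame n (mm σ) (mm (forState 16 place σ j))
place-for-frame r17 zero    _   c _ = refl
place-for-frame {n} {σ} r17 (suc j) j<n = frame-trans (place-for-frame r17 j (<⇒≤ j<n))
  (place-frame {σ = forState 16 place σ j ⟨ 16 ≔ j ⟩} (trans (for-fixes 17 16 place _ j) r17) j<n)

spread-frame : ∀ {n σ} → Layout n σ → Frame n (mm σ) (mm (run spread σ))
spread-frame {n} (layout r0 r17 _) = place-for-frame r17 _ (≤-reflexive r0)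

round-frame : ∀ {n σ} → Layout n σ → Frame n (mm σ) (mm (run round σ))
round-frame {n} {σ} L = pick-ind (λ τ → Frame n (mm σ) (mm τ)) (suc (rg τ 11) ∸ rg τ 0)
  (frame-trans found (spread-frame (layout-run findMin _ L))) found
  where
  τ : State
  τ = run findMin σ
  found : Frame n (mm σ) (mm τ)
  found c _ = cong (λ M → M c) (run-pure findMin {σ} _)

guess-for-frame : ∀ {n σ} → Layout n σ → ∀ j → Frame n (mm σ) (mm (forState 14 round σ j))
guess-for-frame L zero    c _ = refl
guess-for-frame {n} {σ} L (suc j) = frame-trans (guess-for-frame L j) (next-frame (layout-for 14 round _ _ _ L j))
  where
  next-frame : ∀ {τ} → Layout n τ → Frame n (mm τ) (mm (run round (τ ⟨ 14 ≔ j ⟩)))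
  next-frame {τ} (layout x y z) = round-frame {σ = τ ⟨ 14 ≔ j ⟩} (layout x y z)

-- Digit strings in memory and the reading position.

Reads : (ℕ → ℕ) → ℕ → List ℕ → Set
Reads D p []       = ⊤
Reads D p (d ∷ ds) = D p ≡ d × Reads D (suc p) ds

reads-++ˡ : ∀ {D p} ds {es} → Reads D p (ds ++ es) → Reads D p ds
reads-++ˡ []       _       = tt
reads-++ˡ (d ∷ ds) (e , r) = e , reads-++ˡ ds r

reads-++ʳ : ∀ {D p} ds {es} → Reads D p (ds ++ es) → Reads D (p + length ds) es
reads-++ʳ {D} {p} []       {es} r       = subst (λ q → Reads D q es) (sym (+-identityʳ p)) r
reads-++ʳ {D} {p} (d ∷ ds) {es} (_ , r) = subst (λ q → Reads D q es) (sym (+-suc p (length ds))) (reads-++ʳ ds r)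

-- c is the unread part of the current digit, e the number of omissions still to come.
Cursor : (ℕ → ℕ) → (c e p : ℕ) → List ℕ → Set
Cursor D c e p []       = e ≡ 0
Cursor D c e p (d ∷ ds) = c ≡ d × e ≡ suc (length ds) × Reads D (suc p) ds

cursor-start : ∀ {D p e} ds → Reads D p ds → e ≡ length ds → Cursor D (D p) e p ds
cursor-start []       _       e = e
cursor-start (d ∷ ds) (q , r) e = q , e , r

-- The labeller

module Machine (n : ℕ) (a : ℕ → ℕ → ℕ) (s : ℕ) (π : ℕ → ℕ)
  (a-sym  : ∀ u v → u < n → v < n → a u v ≡ a v u)
  (a-irr  : ∀ u → u < n → a u u ≡ 0)
  (size   : ∀ w → w < n → Σ[ n ] (λ u → pick (apart (π u) (π w)) 1 0) ≡ s)
  (clique : ∀ u v → u < n → v < n → u ≢ v → π u ≡ π v → a u v ≢ 0)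
  where

  open Partition n a s π a-sym a-irr size clique public
  open Consistent public

  Adjacent : State → Set
  Adjacent σ = ∀ u v → u < n → v < n → mm σ (Σ[ u ] (λ _ → n) + v) ≡ a u v

  Labels : State → (ℕ → ℕ) → Set
  Labels σ l = ∀ v → v < n → mm σ (n * n + v) ≡ l v

  digits : State → ℕ → ℕ
  digits σ i = mm σ (n * n + n + i)

  adjacent-frame : ∀ {σ τ} → Frame n (mm σ) (mm τ) → Adjacent σ → Adjacent τ
  adjacent-frame f A u v u<n v<n = trans (f _ (edge-cell u v u<n v<n)) (A u v u<n v<n)

  digits-frame : ∀ {σ τ} → Frame n (mm σ) (mm τ) → ∀ i → digits τ i ≡ digits σ i
  digits-frame f i = f _ (digit-cell n i)

  reads-frame : ∀ {σ τ} → Frame n (mm σ) (mm τ) → ∀ p ds → Reads (digits σ) p ds → Reads (digits τ) p ds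
  reads-frame         f p []       _       = tt
  reads-frame {σ} {τ} f p (d ∷ ds) (e , r) = trans (digits-frame {σ} {τ} f p) e , reads-frame {σ} {τ} f (suc p) ds r

  best : State → ℕ × ℕ
  best σ = rg σ 11 , rg σ 12

  degree-value : ∀ {τ l v} → Layout n τ → Adjacent τ → Labels τ l → v < n → rg τ 15 ≡ v →
                 ⟦ degree (var 15) ⟧ τ ≡ deg l v
  degree-value {τ} {l} {v} (layout r0 r17 _) A B v<n refl =
    trans (cong₂ (λ m N → Σ[ m ] λ u → pick (mm τ (N + u)) (pick (mm τ (Σ[ v ] (λ _ → m) + u)) 0 1) 0) r0 r17)
      (Σ-cong n λ u u<n → cong₂ (λ x y → pick x (pick y 0 1) 0) (B u u<n) (A v u v<n u<n))

  pickMin-value : ∀ {τ l v} → Layout n τ → Adjacent τ → Labels τ l → v < n → rg τ 15 ≡ v →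
                  best (run pickMin τ) ≡ minStep l v (best τ)
  pickMin-value {τ} {l} {v} L A B v<n e = begin
    best (run pickMin τ)
      ≡⟨ trans (pick-map best (mm τ (rg τ 17 + rg τ 15)))
               (cong (λ x → pick (mm τ (rg τ 17 + rg τ 15)) x (best τ)) (pick-map best (suc d ∸ rg τ 11))) ⟩
    pick (mm τ (rg τ 17 + rg τ 15)) (pick (suc d ∸ rg τ 11) (d , rg τ 15) (best τ)) (best τ)
      ≡⟨ cong (λ x → pick x (pick (suc d ∸ rg τ 11) (d , rg τ 15) (best τ)) (best τ))
           (trans (cong₂ (λ x y → mm τ (x + y)) (Layout.r17 L) e) (B v v<n)) ⟩
    pick (l v) (pick (suc d ∸ rg τ 11) (d , rg τ 15) (best τ)) (best τ)
      ≡⟨ cong₂ (λ x y → pick (l v) (pick (suc x ∸ rg τ 11) (x , y) (best τ)) (best τ)) (degree-value L A B v<n e) e ⟩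
    minStep l v (best τ) ∎
    where
    open ≡-Reasoning
    d : ℕ
    d = ⟦ degree (var 15) ⟧ τ

  layout-≔15 : ∀ {σ v} → Layout n σ → Layout n (σ ⟨ 15 ≔ v ⟩)
  layout-≔15 (layout x y z) = layout x y z

  minLoop-value : ∀ {σ l} → Layout n σ → Adjacent σ → Labels σ l → ∀ j → j ≤ n →
                  best (forState 15 pickMin σ j) ≡ iter j (minStep l) (best σ)
  minLoop-value L A B zero    _   = refl
  minLoop-value {σ} {l} L A B (suc j) j<n = trans
    (pickMin-value {τ ⟨ 15 ≔ j ⟩} {l} {j} (layout-≔15 (layout-for 15 pickMin _ _ _ L j))
      (λ u v u<n v<n → trans (same _) (A u v u<n v<n)) (λ v v<n → trans (same _) (B v v<n)) j<n refl)
    (cong (minStep l j) (minLoop-value L A B j (<⇒≤ j<n)))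
    where
    τ : State
    τ = forState 15 pickMin σ j
    same : ∀ c → mm τ c ≡ mm σ c
    same c = cong (λ M → M c) (for-pure 15 pickMin {σ} _ j)

  findMin-value : ∀ {σ l} → Layout n σ → Adjacent σ → Labels σ l → best (run findMin σ) ≡ argmin l
  findMin-value {σ} {l} L A B = trans
    (cong (λ m → best (forState 15 pickMin (σ ⟨ 11 ≔ rg σ 0 ⟩ ⟨ 12 ≔ 0 ⟩) m)) (Layout.r0 L))
    (trans (minLoop-value (layout (Layout.r0 L) (Layout.r17 L) (Layout.r19 L)) A B n ≤-refl)
           (cong (λ m → iter n (minStep l) (m , 0)) (Layout.r0 L)))

  module Spread (σ : State) (L : Layout n σ) (A : Adjacent σ) {l : ℕ → ℕ} (B : Labels σ l)
                {w m : ℕ} (w<n : w < n) (lw : l w ≡ 0) (r12 : rg σ 12 ≡ w) (r7 : rg σ 7 ≡ m) where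

    open Centre l w

    τ : ℕ → State
    τ = forState 16 place σ

    record Inv (j : ℕ) : Set where
      field
        labelled : ∀ v → v < j → mm (τ j) (n * n + v) ≡ relabel l w m v
        pending  : ∀ v → j ≤ v → v < n → mm (τ j) (n * n + v) ≡ l v
        cursor   : Cursor (digits σ) (rg (τ j) 9) (rg (τ j) 10) (rg (τ j) 8) (code j (n ∸ j))
        -- The position plus the number of digits left is invariant, so at the end the position has
        -- advanced by the whole code.
        position : rg (τ j) 8 + length (code j (n ∸ j)) ≡ rg σ 8 + length (code 0 n)

    open Inv

    module Step (j : ℕ) (j<n : j < n) (I : Inv j) where

      ρ : State
      ρ = τ j ⟨ 16 ≔ j ⟩

      AtCursor : List ℕ → Set
      AtCursor = Cursor (digits σ) (rg ρ 9) (rg ρ 10) (rg ρ 8)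

      ds : List ℕ
      ds = code (suc j) (n ∸ suc j)

      frame : Frame n (mm σ) (mm (τ j))
      frame = place-for-frame (Layout.r17 L) j (<⇒≤ j<n)

      n∸j : n ∸ j ≡ suc (n ∸ suc j)
      n∸j = +-∸-assoc 1 j<n

      cursor′ : AtCursor (code j (suc (n ∸ suc j)))
      cursor′ = subst (λ r → AtCursor (code j r)) n∸j (cursor I)

      position′ : rg (τ j) 8 + length (code j (suc (n ∸ suc j))) ≡ rg σ 8 + length (code 0 n)
      position′ = subst (λ r → rg (τ j) 8 + length (code j r) ≡ rg σ 8 + length (code 0 n)) n∸j (position I)

      at-label : mm ρ (rg ρ 17 + j) ≡ l j
      at-label = trans (cong (λ N → mm (τ j) (N + j)) (trans (for-fixes 17 16 place {σ} _ j) (Layout.r17 L)))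
                       (pending I j ≤-refl j<n)

      at-centre : rg ρ 12 ≡ w
      at-centre = trans (for-fixes 12 16 place {σ} _ j) r12

      at-edge : mm ρ (Σ[ rg ρ 12 ] (λ _ → rg ρ 0) + j) ≡ a w j
      at-edge = trans (cong₂ (λ x y → mm (τ j) (Σ[ x ] (λ _ → y) + j)) at-centre (trans (for-fixes 0 16 place {σ} _ j) (Layout.r0 L)))
                      (trans (frame _ (edge-cell w j w<n j<n)) (A w j w<n j<n))

      at-cell : rg ρ 17 + j ≡ n * n + j
      at-cell = cong (_+ j) (trans (for-fixes 17 16 place {σ} _ j) (Layout.r17 L))

      at-name : rg ρ 7 ≡ m
      at-name = trans (for-fixes 7 16 place {σ} _ j) r7

      advance-inv : ∀ {υ} → run place ρ ≡ υ →
                mm υ (n * n + j) ≡ relabel l w m j → (∀ v → v ≢ j → mm υ (n * n + v) ≡ mm (τ j) (n * n + v)) →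
                Cursor (digits σ) (rg υ 9) (rg υ 10) (rg υ 8) ds →
                rg υ 8 + length ds ≡ rg σ 8 + length (code 0 n) → Inv (suc j)
      advance-inv refl current elsewhere c p = record
        { labelled = upto
        ; pending  = λ v j<v v<n → trans (elsewhere v (>⇒≢ j<v)) (pending I v (<⇒≤ j<v) v<n)
        ; cursor   = c
        ; position = p
        }
        where
        upto : ∀ v → v < suc j → mm (run place ρ) (n * n + v) ≡ relabel l w m v
        upto v v<1+j with v ≟ j
        ... | yes refl = current
        ... | no v≢j   = trans (elsewhere v v≢j) (labelled I v (≤∧≢⇒< (s≤s⁻¹ v<1+j) v≢j))

      unchanged : run place ρ ≡ ρ → relabel l w m j ≡ l j → code j (suc (n ∸ suc j)) ≡ ds → Inv (suc j)
      unchanged e r c = advance-inv e (trans (pending I j ≤-refl j<n) (sym r)) (λ _ _ → refl)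
        (subst AtCursor c cursor′)
        (trans (cong (λ es → rg ρ 8 + length es) (sym c)) position′)

      written-here : ∀ {x} → (mm ρ [ rg ρ 17 + j ≔ x ]) (n * n + j) ≡ x
      written-here {x} = trans (cong (λ c → (mm ρ [ c ≔ x ]) (n * n + j)) at-cell) (≔-same (n * n + j))

      written-elsewhere : ∀ {x} v → v ≢ j → (mm ρ [ rg ρ 17 + j ≔ x ]) (n * n + v) ≡ mm ρ (n * n + v)
      written-elsewhere v v≢j = ≔-other λ e → v≢j (sym (+-cancelˡ-≡ (n * n) j v (trans (sym at-cell) e)))

      when-labelled : l j ≢ 0 → Inv (suc j)
      when-labelled h = unchanged (pick-nonzero λ z → h (trans (sym at-label) z)) (pick-nonzero h) (pick-nonzero h)

      module _ (h : l j ≡ 0) where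

        h′ : mm ρ (rg ρ 17 + j) ≡ 0
        h′ = trans at-label h

        when-centre : j ≡ w → Inv (suc j)
        when-centre j≡w = advance-inv
          (trans (pick-zero h′) (pick-≡ (trans j≡w (sym at-centre))))
          (trans written-here (trans at-name (sym (trans (pick-zero h) (pick-≡ (cong π j≡w))))))
          (λ v v≢j → written-elsewhere v v≢j)
          (subst AtCursor c cursor′)
          (trans (cong (λ es → rg ρ 8 + length es) (sym c)) position′)
          where
          c : code j (suc (n ∸ suc j)) ≡ ds
          c = trans (pick-zero h) (pick-≡ j≡w)

        module _ (j≢w : j ≢ w) where

          j≢w′ : j ≢ rg ρ 12
          j≢w′ e = j≢w (trans e at-centre)

          when-far : a w j ≡ 0 → Inv (suc j)
          when-far f = unchanged (trans (pick-zero h′) (trans (pick-≢ j≢w′) (pick-zero (trans at-edge f))))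
            (trans (pick-zero h) (trans (pick-≢ λ e → clique w j w<n j<n (≢-sym j≢w) (sym e) f) (sym h)))
            (trans (pick-zero h) (trans (pick-≢ j≢w) (pick-zero f)))

          module _ (f : a w j ≢ 0) where

            chosen : run place ρ ≡ pick (rg ρ 10) (run take ρ) (pick (rg ρ 9) (run omit ρ) (run take ρ))
            chosen = trans (pick-zero h′) (trans (pick-≢ j≢w′) (pick-nonzero λ z → f (trans (sym at-edge) z)))

            when-take : π j ≡ π w → Inv (suc j)
            when-take e = go ds refl
              where
              c : code j (suc (n ∸ suc j)) ≡ raise ds
              c = trans (pick-zero h) (trans (pick-≢ j≢w) (trans (pick-nonzero f) (pick-≡ e)))
              cur : AtCursor (raise ds)
              cur = subst AtCursor c cursor′
              length-raise : ∀ es → length (raise es) ≡ length es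
              length-raise []      = refl
              length-raise (_ ∷ _) = refl
              pos : rg ρ 8 + length ds ≡ rg σ 8 + length (code 0 n)
              pos = trans (cong (rg ρ 8 +_) (trans (sym (length-raise ds)) (cong length (sym c)))) position′
              taken-inv : run place ρ ≡ run take ρ → Cursor (digits σ) (rg ρ 9 ∸ 1) (rg ρ 10) (rg ρ 8) ds → Inv (suc j)
              taken-inv t cur′ = advance-inv t
                (trans written-here (trans at-name (sym (trans (pick-zero h) (pick-≡ e)))))
                (λ v v≢j → written-elsewhere v v≢j) cur′ pos
              go : ∀ es → ds ≡ es → Inv (suc j)
              -- No omission is due any more, so the vertex is taken whatever the digit register
              -- holds; in the other case the raised digit is nonzero and the last branch takes it.
              go [] q = taken-inv (trans chosen (pick-zero none)) (subst (Cursor (digits σ) _ _ _) (sym q) none)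
                where
                none : rg ρ 10 ≡ 0
                none = subst (λ es → AtCursor (raise es)) q cur
              go (d ∷ es) q with x , y , z ← subst (λ es → AtCursor (raise es)) q cur =
                taken-inv (trans chosen (trans (pick-nonzero λ v → 0≢1+n (trans (sym v) y)) (pick-nonzero λ v → 0≢1+n (trans (sym v) x))))
                  (subst (Cursor (digits σ) (rg ρ 9 ∸ 1) (rg ρ 10) (rg ρ 8)) (sym q) (cong (_∸ 1) x , y , z))

            when-omit : π j ≢ π w → Inv (suc j)
            when-omit ne = advance-inv (trans chosen (trans (pick-nonzero λ v → 0≢1+n (trans (sym v) y)) (pick-zero x)))
              (trans (pending I j ≤-refl j<n) (trans h (sym (trans (pick-zero h) (pick-≢ ne)))))
              (λ _ _ → refl) (next-cursor ds z (cong (_∸ 1) y))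
              (trans (sym (+-suc (rg ρ 8) (length ds))) (trans (cong (λ es → rg ρ 8 + length es) (sym c)) position′))
              where
              c : code j (suc (n ∸ suc j)) ≡ 0 ∷ ds
              c = trans (pick-zero h) (trans (pick-≢ j≢w) (trans (pick-nonzero f) (pick-≢ ne)))
              cur : AtCursor (0 ∷ ds)
              cur = subst AtCursor c cursor′
              x = proj₁ cur
              y = proj₁ (proj₂ cur)
              z = proj₂ (proj₂ cur)
              next-digit : mm ρ (rg ρ 19 + suc (rg ρ 8)) ≡ digits σ (suc (rg ρ 8))
              next-digit = trans (cong (λ N → mm (τ j) (N + suc (rg ρ 8))) (trans (for-fixes 19 16 place {σ} _ j) (Layout.r19 L)))
                                 (frame _ (digit-cell n (suc (rg ρ 8))))
              next-cursor : ∀ es → Reads (digits σ) (suc (rg ρ 8)) es → rg ρ 10 ∸ 1 ≡ length es →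
                Cursor (digits σ) (mm ρ (rg ρ 19 + suc (rg ρ 8))) (rg ρ 10 ∸ 1) (suc (rg ρ 8)) es
              next-cursor []       _       e = e
              next-cursor (d ∷ es) (q , r) e = trans next-digit q , e , r

      result : Inv (suc j)
      result with l j ≟ 0
      ... | no h = when-labelled h
      ... | yes h with j ≟ w
      ...   | yes e = when-centre h e
      ...   | no e with a w j ≟ 0
      ...     | yes f = when-far h e f
      ...     | no f with π j ≟ π w
      ...       | yes g = when-take h e f g
      ...       | no g  = when-omit h e f g

    inv : Cursor (digits σ) (rg σ 9) (rg σ 10) (rg σ 8) (code 0 n) → ∀ j → j ≤ n → Inv j
    inv c zero    _   = record { labelled = λ _ () ; pending = λ v _ → B v ; cursor = c ; position = refl }
    inv c (suc j) j<n = Step.result j j<n (inv c j (<⇒≤ j<n))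

    outcome : Cursor (digits σ) (rg σ 9) (rg σ 10) (rg σ 8) (code 0 n) →
              Labels (τ n) (relabel l w m) × rg (τ n) 8 ≡ rg σ 8 + length (code 0 n)
    outcome c = labelled (inv c n ≤-refl) ,
      trans (sym (+-identityʳ _)) (trans (cong (λ r → rg (τ n) 8 + length (code n r)) (sym (n∸n≡0 n))) (position (inv c n ≤-refl)))

  spread-value : ∀ {σ l} → Layout n σ → rg σ 3 ≡ s → Adjacent σ → Labels σ l → ∀ {w} → w < n → l w ≡ 0 →
    (∀ u v → u < n → v < n → π u ≡ π v → l u ≡ l v) → rg σ 12 ≡ w → rg σ 11 ≡ deg l w →
    Reads (digits σ) (rg σ 8) (Centre.code l w 0 n) →
    Labels (run spread σ) (relabel l w (suc (rg σ 7))) × rg (run spread σ) 8 ≡ rg σ 8 + length (Centre.code l w 0 n)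
  spread-value {σ} {l} L r3 A B {w} w<n lw whole r12 r11 R =
    subst (λ m → Labels (forState 16 place σ′ m) (relabel l w (suc (rg σ 7))) ×
                 rg (forState 16 place σ′ m) 8 ≡ rg σ 8 + length (Centre.code l w 0 n)) (sym (Layout.r0 L))
      (Spread.outcome σ′ (layout (Layout.r0 L) (Layout.r17 L) (Layout.r19 L)) A B w<n lw r12 refl cursor₀)
    where
    σ′ : State
    σ′ = σ ⟨ 7 ≔ suc (rg σ 7) ⟩ ⟨ 10 ≔ rg σ 11 ∸ (rg σ 3 ∸ 1) ⟩ ⟨ 9 ≔ mm σ (rg σ 19 + rg σ 8) ⟩
    cursor₀ : Cursor (digits σ) (mm σ (rg σ 19 + rg σ 8)) (rg σ 11 ∸ (rg σ 3 ∸ 1)) (rg σ 8) (Centre.code l w 0 n)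
    cursor₀ = subst (λ c → Cursor (digits σ) c (rg σ 11 ∸ (rg σ 3 ∸ 1)) (rg σ 8) (Centre.code l w 0 n))
      (cong (λ N → mm σ (N + rg σ 8)) (sym (Layout.r19 L)))
      (cursor-start (Centre.code l w 0 n) R
        (trans (cong₂ (λ x y → x ∸ (y ∸ 1)) r11 r3) (sym (Centre.length-code₀ l w w<n lw whole))))

  -- The link between the machine and the solution: the unread digits are what `plan` prescribes for
  -- the remaining rounds, starting from the labelling in memory.
  record Progress (j : ℕ) (τ : State) : Set where
    field
      {l}        : ℕ → ℕ
      consistent : Consistent l (rg τ 7)
      labels     : Labels τ l
      reads      : Reads (digits τ) (rg τ 8) (plan (n ∸ j) l (rg τ 7))
      remaining  : Σ[ n ] (unlabelled l) ≤ n ∸ j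

  round-progress : ∀ {j τ} → j < n → Layout n τ → rg τ 3 ≡ s → Adjacent τ → Progress j τ → Progress (suc j) (run round τ)
  round-progress {j} {τ} j<n L r3 A P = cases (next-centre l)
    where
    open Progress P
    υ : State
    υ = run findMin τ
    L′ : Layout n υ
    L′ = layout-run findMin _ L
    same : mm υ ≡ mm τ
    same = run-pure findMin {τ} _
    found : best υ ≡ argmin l
    found = findMin-value L A labels
    r7 : rg υ 7 ≡ rg τ 7
    r7 = run-fixes 7 findMin {τ} _
    r8 : rg υ 8 ≡ rg τ 8
    r8 = run-fixes 8 findMin {τ} _
    A′ : Adjacent υ
    A′ u v u<n v<n = trans (cong (λ M → M (Σ[ u ] (λ _ → n) + v)) same) (A u v u<n v<n)
    labels′ : Labels υ l
    labels′ v v<n = trans (cong (λ M → M (n * n + v)) same) (labels v v<n)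
    reads′ : Reads (digits υ) (rg υ 8) (plan (suc (n ∸ suc j)) l (rg τ 7))
    reads′ = subst (λ M → Reads (λ i → M (n * n + n + i)) (rg υ 8) (plan (suc (n ∸ suc j)) l (rg τ 7))) (sym same)
      (subst₂ (λ p r → Reads (digits τ) p (plan r l (rg τ 7))) (sym r8) (+-∸-assoc 1 j<n) reads)
    Goal : State → Set
    Goal = Progress (suc j)
    cases : Next l → Goal (run round τ)
    cases (finished all e) = subst Goal (sym (pick-∸-> (≤-reflexive (cong suc (sym (trans (cong proj₁ found) (trans e (sym (Layout.r0 L′)))))))))
      (record { consistent = subst (Consistent l) (sym r7) consistent
              ; labels = labels′
              ; reads = subst (λ m → Reads (digits υ) (rg υ 8) (plan (n ∸ suc j) l m)) (sym r7)
                  (subst (Reads (digits υ) (rg υ 8)) (pick-∸-> (s≤s (≤-reflexive (sym e)))) reads′)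
              ; remaining = ≤-trans (≤-reflexive (Σ-zero n λ v v<n → pick-nonzero (all v v<n))) z≤n })
    cases (centre w<n lw e _) = subst Goal (sym (pick-∸-≤ (subst₂ _<_ (sym b≡) (sym (Layout.r0 L′)) (deg-< l w w<n))))
      (record { consistent = subst (Consistent (relabel l w (suc (rg τ 7)))) (sym r7″) (relabel-consistent w<n lw consistent)
              ; labels = subst (λ x → Labels (run spread υ) (relabel l w (suc x))) r7 (proj₁ out)
              ; reads = subst (λ m → Reads (digits (run spread υ)) (rg (run spread υ) 8) (plan (n ∸ suc j) (relabel l w (suc (rg τ 7))) m)) (sym r7″)
                  (subst (λ p → Reads (digits (run spread υ)) p rest) (sym (proj₂ out))
                    (reads-frame {υ} {run spread υ} (spread-frame L′) (rg υ 8 + length now) rest (reads-++ʳ now reads″)))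
              ; remaining = s≤s⁻¹ (≤-trans (Σ-unlabelled-drop w<n lw) (≤-trans remaining (≤-reflexive (+-∸-assoc 1 j<n)))) })
      where
      w : ℕ
      w = proj₂ (argmin l)
      b≡ : rg υ 11 ≡ deg l w
      b≡ = trans (cong proj₁ found) e
      now rest : List ℕ
      now = Centre.code l w 0 n
      rest = plan (n ∸ suc j) (relabel l w (suc (rg τ 7))) (suc (rg τ 7))
      reads″ : Reads (digits υ) (rg υ 8) (now ++ rest)
      reads″ = subst (Reads (digits υ) (rg υ 8)) (pick-∸-≤ (subst (_< n) (sym e) (deg-< l w w<n))) reads′
      r7″ : rg (run spread υ) 7 ≡ suc (rg τ 7)
      r7″ = trans (for-fixes 7 16 place _ (rg υ 0)) (cong suc r7)
      out = spread-value L′ (trans (run-fixes 3 findMin {τ} _) r3) A′ labels′ w<n lw (whole consistent)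
        (cong proj₂ found) b≡ (reads-++ˡ now reads″)

  guess-progress : ∀ {σ} → Layout n σ → rg σ 3 ≡ s → Adjacent σ → Progress 0 σ →
                   ∀ j → j ≤ n → Progress j (forState 14 round σ j)
  guess-progress L r3 A P zero    _   = P
  guess-progress {σ} L r3 A P (suc j) j<n =
    round-progress {τ = forState 14 round σ j ⟨ 14 ≔ j ⟩} j<n
      (same-layout (layout-for 14 round _ _ _ L j))
      (trans (for-fixes 3 14 round _ j) r3)
      (adjacent-frame {σ} {forState 14 round σ j} (guess-for-frame L j) A)
      (same (guess-progress L r3 A P j (<⇒≤ j<n)))
    where
    same-layout : Layout n (forState 14 round σ j) → Layout n (forState 14 round σ j ⟨ 14 ≔ j ⟩)
    same-layout (layout x y z) = layout x y z
    same : Progress j (forState 14 round σ j) → Progress j (forState 14 round σ j ⟨ 14 ≔ j ⟩)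
    same P = record { consistent = consistent ; labels = labels ; reads = reads ; remaining = remaining }
      where open Progress P

  guess-value : ∀ {σ} → Layout n σ → rg σ 3 ≡ s → Adjacent σ → rg σ 7 ≡ 0 → rg σ 8 ≡ 0 → Labels σ (λ _ → 0) →
                Reads (digits σ) 0 (plan n (λ _ → 0) 0) →
                ∃[ l ] Consistent l (rg (run guess σ) 7) × Labels (run guess σ) l × (∀ v → v < n → l v ≢ 0)
  guess-value {σ} L r3 A r7 r8 B R = l , consistent , labels , λ v v<n z →
    0≢1+n (trans (sym (Σ≡0 n (unlabelled l) (n≤0⇒n≡0 (≤-trans remaining (≤-reflexive (n∸n≡0 n)))) v v<n)) (pick-zero z))
    where
    P : Progress n (run guess σ)
    P = subst (λ m → Progress n (forState 14 round σ m)) (sym (Layout.r0 L)) (guess-progress L r3 A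
      (record { consistent = subst (Consistent (λ _ → 0)) (sym r7) (record
                  { below = λ _ _ → z≤n ; whole = λ _ _ _ _ _ → refl ; pure = λ _ _ _ _ _ h → ⊥-elim (h refl) ; used = λ _ () })
              ; labels = B
              ; reads = subst₂ (λ p m → Reads (digits σ) p (plan n (λ _ → 0) m)) (sym r8) (sym r7) R
              ; remaining = ≤-trans (≤-reflexive (trans (Σ-const n 1) (*-identityʳ n))) ≤-refl }) n ≤-refl)
    open Progress P

-- The checker

violations : Expr
violations = bad-range ⊕ bad-size ⊕ bad-clique ⊕ (cut ⊖ (var 2 ⊕ var 2))

module Checker (n : ℕ) (a : ℕ → ℕ → ℕ) (K s m : ℕ) where

  rangeᵛ sizeᵛ cliqueᵛ cutᵛ : (ℕ → ℕ) → ℕ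
  rangeᵛ  l = Σ[ n ] λ v → pick (l v) 1 (l v ∸ m)
  sizeᵛ   l = Σ[ m ] λ i → apart (Σ[ n ] λ v → pick (apart (l v) (suc i)) 1 0) s
  cliqueᵛ l = ΣΣ n λ u v → pick (apart (l u) (l v)) (pick (apart u v) 0 (pick (a u v) 1 0)) 0
  cutᵛ    l = ΣΣ n (split a l)

  violationsᵛ : (ℕ → ℕ) → ℕ
  violationsᵛ l = rangeᵛ l + sizeᵛ l + cliqueᵛ l + (cutᵛ l ∸ (K + K))

  violations-value : ∀ {τ} → Layout n τ → rg τ 2 ≡ K → rg τ 3 ≡ s → rg τ 7 ≡ m →
    (∀ u v → u < n → v < n → mm τ (Σ[ u ] (λ _ → n) + v) ≡ a u v) →
    ⟦ violations ⟧ τ ≡ violationsᵛ (λ v → mm τ (n * n + v))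
  violations-value {τ} (layout r0 r17 _) r2 r3 r7 A =
    cong₂ _+_ (cong₂ _+_ (cong₂ _+_ range-value size-value) clique-value) (cong₂ _∸_ cut-value (cong₂ _+_ r2 r2))
    where
    l : ℕ → ℕ
    l v = mm τ (n * n + v)
    range-value : ⟦ bad-range ⟧ τ ≡ rangeᵛ l
    range-value = trans
      (cong₂ (λ x y → Σ[ x ] λ v → pick (mm τ (y + v)) 1 (mm τ (y + v) ∸ rg τ 7)) r0 r17)
      (cong (λ z → Σ[ n ] λ v → pick (l v) 1 (l v ∸ z)) r7)
    size-value : ⟦ bad-size ⟧ τ ≡ sizeᵛ l
    size-value = trans
      (cong₂ (λ x y → Σ[ rg τ 7 ] λ i → apart (Σ[ x ] λ v → pick (apart (mm τ (y + v)) (suc i)) 1 0) (rg τ 3)) r0 r17)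
      (cong₂ (λ x y → Σ[ x ] λ i → apart (Σ[ n ] λ v → pick (apart (l v) (suc i)) 1 0) y) r7 r3)
    clique-value : ⟦ bad-clique ⟧ τ ≡ cliqueᵛ l
    clique-value = trans
      (cong₂ (λ x y → ΣΣ x λ u v → pick (apart (mm τ (y + u)) (mm τ (y + v)))
        (pick (apart u v) 0 (pick (mm τ (Σ[ u ] (λ _ → x) + v)) 1 0)) 0) r0 r17)
      (ΣΣ-cong n λ u v u<n v<n → cong (λ x → pick (apart (l u) (l v)) (pick (apart u v) 0 (pick x 1 0)) 0) (A u v u<n v<n))
    cut-value : ⟦ cut ⟧ τ ≡ cutᵛ l
    cut-value = trans
      (cong₂ (λ x y → ΣΣ x λ u v → pick (mm τ (Σ[ u ] (λ _ → x) + v)) 0 (pick (apart (mm τ (y + u)) (mm τ (y + v))) 0 1)) r0 r17)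
      (ΣΣ-cong n λ u v u<n v<n → cong (λ x → pick x 0 (pick (apart (l u) (l v)) 0 1)) (A u v u<n v<n))

  module _ {l π : ℕ → ℕ} (l≡ : ∀ v → v < n → l v ≡ suc (π v)) where

    private
      cut≡ : cutᵛ l ≡ cutᵛ π
      cut≡ = ΣΣ-cong n λ u v u<n v<n → cong₂ (λ x y → pick (a u v) 0 (pick (apart x y) 0 1)) (l≡ u u<n) (l≡ v v<n)

      count≡ : ∀ i → Σ[ n ] (λ v → pick (apart (l v) (suc i)) 1 0) ≡ Σ[ n ] (λ v → pick (apart (π v) i) 1 0)
      count≡ i = Σ-cong n λ v v<n → cong (λ x → pick (apart x (suc i)) 1 0) (l≡ v v<n)

    violations-none : Clustering n a K s m π → violationsᵛ l ≡ 0
    violations-none C = cong₂ _+_ (cong₂ _+_ (cong₂ _+_ ranges sizes′) cliques) cuts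
      where
      ranges : rangeᵛ l ≡ 0
      ranges = Σ-zero n λ v v<n → trans (cong (λ x → pick x 1 (x ∸ m)) (l≡ v v<n)) (m≤n⇒m∸n≡0 (range C v v<n))
      sizes′ : sizeᵛ l ≡ 0
      sizes′ = Σ-zero m λ i i<m → trans (cong (λ x → apart x s) (trans (count≡ i) (sizes C i i<m))) (apart-refl s)
      cliques : cliqueᵛ l ≡ 0
      cliques = Σ-zero n λ u u<n → Σ-zero n λ v v<n → term u v u<n v<n
        where
        term : ∀ u v → u < n → v < n → pick (apart (l u) (l v)) (pick (apart u v) 0 (pick (a u v) 1 0)) 0 ≡ 0
        term u v u<n v<n with l u ≟ l v
        ... | no ne = pick-≢ ne
        ... | yes e with u ≟ v
        ...   | yes e′ = trans (pick-≡ e) (pick-≡ e′)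
        ...   | no ne  = trans (pick-≡ e) (trans (pick-≢ ne) (pick-nonzero
          (clique C u v u<n v<n ne (suc-injective (trans (sym (l≡ u u<n)) (trans e (l≡ v v<n)))))))
      cuts : cutᵛ l ∸ (K + K) ≡ 0
      cuts = m≤n⇒m∸n≡0 (≤-trans (≤-reflexive cut≡) (budget C))

    violations-sound : violationsᵛ l ≡ 0 → Clustering n a K s m π
    violations-sound z = record
      { range  = λ v v<n → m∸n≡0⇒m≤n (trans (cong (λ x → pick x 1 (x ∸ m)) (sym (l≡ v v<n))) (Σ≡0 n _ z-range v v<n))
      ; sizes  = λ i i<m → trans (sym (count≡ i)) (apart≡0 _ s (Σ≡0 m _ z-size i i<m))
      ; clique = λ u v u<n v<n u≢v e x → 0≢1+n (trans (sym (Σ≡0 n _ (Σ≡0 n _ z-clique u u<n) v v<n))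
          (trans (pick-≡ (trans (l≡ u u<n) (trans (cong suc e) (sym (l≡ v v<n))))) (trans (pick-≢ u≢v) (pick-zero x))))
      ; budget = ≤-trans (≤-reflexive (sym cut≡)) (m∸n≡0⇒m≤n (m+n≡0⇒n≡0 (rangeᵛ l + sizeᵛ l + cliqueᵛ l) z))
      }
      where
      z₃ : rangeᵛ l + sizeᵛ l + cliqueᵛ l ≡ 0
      z₃ = m+n≡0⇒m≡0 _ z
      z-clique : cliqueᵛ l ≡ 0
      z-clique = m+n≡0⇒n≡0 (rangeᵛ l + sizeᵛ l) z₃
      z-size : sizeᵛ l ≡ 0
      z-size = m+n≡0⇒n≡0 (rangeᵛ l) (m+n≡0⇒m≡0 (rangeᵛ l + sizeᵛ l) z₃)
      z-range : rangeᵛ l ≡ 0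
      z-range = m+n≡0⇒m≡0 (rangeᵛ l) (m+n≡0⇒m≡0 (rangeᵛ l + sizeᵛ l) z₃)

  -- Soundness does not depend on how the labelling arose: without violations every label is
  -- positive, and `pred` turns labels into parts.
  clustering-found : ∀ {l} → violationsᵛ l ≡ 0 → Clustering n a K s m (pred ∘ l)
  clustering-found {l} z = violations-sound labelled z
    where
    labelled : ∀ v → v < n → l v ≡ suc (pred (l v))
    labelled v v<n with l v | Σ≡0 n _ (m+n≡0⇒m≡0 (rangeᵛ l) (m+n≡0⇒m≡0 (rangeᵛ l + sizeᵛ l) (m+n≡0⇒m≡0 _ z))) v v<n
    ... | suc x | _ = refl

module Optimum (n : ℕ) (a : ℕ → ℕ → ℕ) (K s m₀ : ℕ) (π : ℕ → ℕ) (C : Clustering n a K s m₀ π)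
  (a-sym : ∀ u v → u < n → v < n → a u v ≡ a v u) (a-irr : ∀ u → u < n → a u u ≡ 0) where

  open Machine n a s π a-sym a-irr (λ w w<n → sizes C (π w) (range C w w<n)) (clique C) public

  -- Such a labelling is `π` with its parts renamed in the order of their discovery. Cut edges are
  -- therefore the same, and `used` supplies a representative of each part from which its size is
  -- inherited.
  consistent-clustering : ∀ {l m} → Consistent l m → (∀ v → v < n → l v ≢ 0) → Clustering n a K s m (pred ∘ l)
  consistent-clustering {l} {m} I all = record
    { range  = λ v v<n → subst (_≤ m) (sym (l≡ v v<n)) (below I v v<n)
    ; sizes  = size′
    ; clique = λ u v u<n v<n u≢v e → clique C u v u<n v<n u≢v (pred-same u v u<n v<n e)
    ; budget = ≤-trans (≤-reflexive (ΣΣ-cong n cut-term)) (budget C)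
    }
    where
    l≡ : ∀ v → v < n → suc (pred (l v)) ≡ l v
    l≡ v v<n with l v | all v v<n
    ... | zero  | h = ⊥-elim (h refl)
    ... | suc _ | _ = refl
    pred-same : ∀ u v → u < n → v < n → pred (l u) ≡ pred (l v) → π u ≡ π v
    pred-same u v u<n v<n e = pure I u v u<n v<n (trans (sym (l≡ u u<n)) (trans (cong suc e) (l≡ v v<n))) (all u u<n)
    same-pred : ∀ u v → u < n → v < n → π u ≡ π v → pred (l u) ≡ pred (l v)
    same-pred u v u<n v<n e = cong pred (whole I u v u<n v<n e)
    cut-term : ∀ u v → u < n → v < n → split a (pred ∘ l) u v ≡ split a π u v
    cut-term u v u<n v<n = cong (pick (a u v) 0) term
      where
      term : pick (apart (pred (l u)) (pred (l v))) 0 1 ≡ pick (apart (π u) (π v)) 0 1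
      term with π u ≟ π v
      ... | yes e = trans (pick-≡ (same-pred u v u<n v<n e)) (sym (pick-≡ e))
      ... | no ne = trans (pick-≢ (ne ∘ pred-same u v u<n v<n)) (sym (pick-≢ ne))
    size′ : ∀ i → i < m → Σ[ n ] (λ v → pick (apart (pred (l v)) i) 1 0) ≡ s
    size′ i i<m with w , w<n , e ← used I i i<m = trans (Σ-cong n term) (sizes C (π w) (range C w w<n))
      where
      term : ∀ v → v < n → pick (apart (pred (l v)) i) 1 0 ≡ pick (apart (π v) (π w)) 1 0
      term v v<n with π v ≟ π w
      ... | yes q = trans (pick-≡ (trans (same-pred v w v<n w<n q) (cong pred e))) (sym (pick-≡ q))
      ... | no ne = trans (pick-≢ (λ q → ne (pred-same v w v<n w<n (trans q (sym (cong pred e)))))) (sym (pick-≢ ne))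

-- The odometer

-- Division rounded down, for positive `s`, in exactly the form in which the program computes it.
quot : ℕ → ℕ → ℕ
quot K s = Σ[ K ] λ j → pick (Σ[ suc j ] (λ _ → s) ∸ K) 1 0

module _ (K s : ℕ) where

  private
    f : ℕ → ℕ
    f j = pick (Σ[ suc j ] (λ _ → s) ∸ K) 1 0

    f-≤ : ∀ j → f j ≤ 1
    f-≤ j = pick-ind (_≤ 1) (Σ[ suc j ] (λ _ → s) ∸ K) ≤-refl z≤n

    f-one : ∀ j → suc j * s ≤ K → f j ≡ 1
    f-one j h = pick-∸-≤ (≤-trans (≤-reflexive (Σ-const (suc j) s)) h)

    upto-* : ∀ B → Σ[ B ] f * s ≤ K
    upto-* zero    = z≤n
    upto-* (suc B) with suc B * s ≤? K
    ... | yes h = ≤-trans (*-monoˡ-≤ s {Σ[ suc B ] f} {suc B} (≤-trans (Σ-≤ (suc B) {B = 1} λ j _ → f-≤ j) (≤-reflexive (*-identityʳ (suc B))))) h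
    ... | no h  = subst (λ x → (Σ[ B ] f + x) * s ≤ K)
      (sym (pick-∸-> (<-≤-trans (≰⇒> h) (≤-reflexive (sym (Σ-const (suc B) s))))))
      (subst (λ x → x * s ≤ K) (sym (+-identityʳ (Σ[ B ] f))) (upto-* B))

    upto-full : ∀ B → B * s ≤ K → B ≤ Σ[ B ] f
    upto-full zero    h = z≤n
    upto-full (suc B) h = ≤-trans (≤-reflexive (+-comm 1 B))
      (+-mono-≤ (upto-full B (≤-trans (m≤n+m _ s) h)) (≤-reflexive (sym (f-one B h))))

    Σ-extend : ∀ {A B} → A ≤′ B → Σ[ A ] f ≤ Σ[ B ] f
    Σ-extend ≤′-refl     = ≤-refl
    Σ-extend (≤′-step h) = ≤-trans (Σ-extend h) (m≤m+n _ _)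

  quot-* : quot K s * s ≤ K
  quot-* = upto-* K

  quot-max : ∀ q → 1 ≤ s → q * s ≤ K → q ≤ quot K s
  -- Candidates up to `K` are enough, because `q ≤ q * s ≤ K`.
  quot-max q 1≤s h = ≤-trans (upto-full q h) (Σ-extend (≤⇒≤′ (≤-trans (m≤m*n q s {{>-nonZero 1≤s}}) h)))

  quot-≤ : quot K s ≤ K
  quot-≤ = ≤-trans (Σ-≤ K {B = 1} λ j _ → f-≤ j) (≤-reflexive (*-identityʳ K))

quot-one : ∀ K → quot K 1 ≡ K
quot-one K = ≤-antisym (quot-≤ K 1) (quot-max K 1 K ≤-refl (≤-reflexive (*-identityʳ K)))

-- After an overflow the digit cells are all zero; as the next size uses no more digits, its initial
-- string is already in place.
quot-anti : ∀ K s → 1 ≤ s → quot K (suc s) ≤ quot K s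
quot-anti K s 1≤s = quot-max K s _ 1≤s (≤-trans (*-monoʳ-≤ (quot K (suc s)) (n≤1+n s)) (quot-* K (suc s)))

zeros : ℕ → List ℕ
zeros L = replicate L 0

module Digits (s : ℕ) where

  increment : List ℕ → List ℕ
  increment []       = []
  increment (d ∷ ds) = pick (s ∸ suc d) (0 ∷ increment ds) (suc d ∷ ds)

  carry : List ℕ → ℕ
  carry []       = 1
  carry (d ∷ ds) = pick (s ∸ suc d) (carry ds) 0

  val : List ℕ → ℕ
  val []       = 0
  val (d ∷ ds) = d + val ds * s

  length-increment : ∀ ds → length (increment ds) ≡ length ds
  length-increment []       = refl
  length-increment (d ∷ ds) with s ∸ suc d
  ... | zero  = cong suc (length-increment ds)
  ... | suc _ = refl

  increment-valid : ∀ {ds} → All (_< s) ds → All (_< s) (increment ds)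
  increment-valid []                = []
  increment-valid {d ∷ ds} (p ∷ ps) with s ∸ suc d in e
  ... | zero  = ≤-trans (s≤s z≤n) p ∷ increment-valid ps
  ... | suc _ = ≰⇒> (λ h → 0≢1+n (trans (sym (m≤n⇒m∸n≡0 h)) e)) ∷ ps

  val-< : ∀ {ds} → All (_< s) ds → val ds < s ^ length ds
  val-< []                = s≤s z≤n
  val-< {d ∷ ds} (p ∷ ps) = begin
    suc d + val ds * s       ≤⟨ +-monoˡ-≤ (val ds * s) p ⟩
    suc (val ds) * s         ≤⟨ *-monoˡ-≤ s (val-< ps) ⟩
    s ^ length ds * s        ≡⟨ *-comm (s ^ length ds) s ⟩
    s * s ^ length ds        ∎
    where open ≤-Reasoning

  -- The odometer runs through the strings by increasing `val`, and a surviving carry means that the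
  -- last string has just been tried.
  carry-cases : ∀ {ds} → All (_< s) ds →
    (carry ds ≡ 0 × val (increment ds) ≡ suc (val ds)) ⊎
    (carry ds ≡ 1 × suc (val ds) ≡ s ^ length ds × increment ds ≡ zeros (length ds))
  carry-cases []                = inj₂ (refl , refl , refl)
  carry-cases {d ∷ ds} (p ∷ ps) with s ∸ suc d in e
  ... | suc _ = inj₁ (refl , refl)
  ... | zero with carry-cases ps | ≤-antisym p (m∸n≡0⇒m≤n e)
  ...   | inj₁ (c , v)     | q = inj₁ (c , trans (cong (_* s) v) (cong (_+ val ds * s) (sym q)))
  ...   | inj₂ (c , v , z) | q = inj₂ (c , trans (cong (_+ val ds * s) q) (trans (cong (_* s) v) (*-comm (s ^ length ds) s)) , cong (0 ∷_) z)

  digit-order : ∀ {d e x y} → x < y → d < s → d + x * s < e + y * s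
  digit-order {d} {e} {x} {y} x<y d<s =
    <-≤-trans (+-monoˡ-< (x * s) d<s) (≤-trans (*-monoˡ-≤ s x<y) (m≤n+m (y * s) e))

  -- Lets the search argue with numbers: once the value of a target string is reached, the digits
  -- are that string.
  val-injective : ∀ {ds es} → All (_< s) ds → All (_< s) es → length ds ≡ length es → val ds ≡ val es → ds ≡ es
  val-injective []                []                _ _ = refl
  val-injective {d ∷ ds} {e ∷ es} (p ∷ ps) (q ∷ qs) l v with <-cmp (val ds) (val es)
  ... | tri< h _ _ = ⊥-elim (<⇒≢ (digit-order h p) v)
  ... | tri> _ _ h = ⊥-elim (<⇒≢ (digit-order h q) (sym v))
  ... | tri≈ _ h _ = cong₂ _∷_ (+-cancelʳ-≡ _ d e (trans v (cong (λ x → e + x * s) (sym h))))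
                       (val-injective ps qs (suc-injective l) h)

-- `iter` exposes the last iteration, whereas a carry travels from the first digit onwards; this
-- form exposes the first iteration.
iterFrom : ∀ {A : Set} → ℕ → ℕ → (ℕ → A → A) → A → A
iterFrom j zero    f x = x
iterFrom j (suc r) f x = iterFrom (suc j) r f (f j x)

iter-split : ∀ {A : Set} j r f (x : A) → iter (j + r) f x ≡ iterFrom j r f (iter j f x)
iter-split j zero    f x = cong (λ k → iter k f x) (+-identityʳ j)
iter-split j (suc r) f x = trans (cong (λ k → iter k f x) (+-suc j r)) (iter-split (suc j) r f x)

module OdometerLoop (n s L : ℕ) where

  open Digits s

  bumpAt : ℕ → State → State
  bumpAt j σ = run bump (σ ⟨ 14 ≔ j ⟩)

  record Setup (σ : State) : Set where
    constructor setup
    field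
      r3  : rg σ 3 ≡ s
      r4  : rg σ 4 ≡ L
      r19 : rg σ 19 ≡ n * n + n

  -- The cells that may change are those of digits j, j + 1, …, and what is written there is less than s.
  Touched : ℕ → (M M′ : ℕ → ℕ) → Set
  Touched j M M′ = ∀ c → M′ c ≡ M c ⊎ (M′ c < s × n * n + n + j ≤ c)

  record Outcome (j : ℕ) (σ τ : State) (ds : List ℕ) : Set where
    constructor outcome
    field
      flag    : rg τ 13 ≡ carry ds
      reads   : Reads (λ i → mm τ (n * n + n + i)) j (increment ds)
      touched : Touched j (mm σ) (mm τ)

  -- Beyond the last digit, or once the carry is gone, `bump` leaves the state as it is and only the
  -- loop index changes.
  idle : ∀ r j {σ} → (rg σ 4 ≤ j ⊎ rg σ 13 ≡ 0) →
         mm (iterFrom j r bumpAt σ) ≡ mm σ × rg (iterFrom j r bumpAt σ) 13 ≡ rg σ 13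
  idle zero    j h = refl , refl
  idle (suc r) j {σ} h = subst (λ τ → mm (iterFrom (suc j) r bumpAt τ) ≡ mm σ × rg (iterFrom (suc j) r bumpAt τ) 13 ≡ rg σ 13)
    (sym (skips h)) (idle r (suc j) {σ ⟨ 14 ≔ j ⟩} (later h))
    where
    ρ : State
    ρ = σ ⟨ 14 ≔ j ⟩
    later : rg σ 4 ≤ j ⊎ rg σ 13 ≡ 0 → rg σ 4 ≤ suc j ⊎ rg σ 13 ≡ 0
    later (inj₁ x) = inj₁ (m≤n⇒m≤1+n x)
    later (inj₂ x) = inj₂ x
    skips : rg σ 4 ≤ j ⊎ rg σ 13 ≡ 0 → bumpAt j σ ≡ ρ
    skips (inj₁ x) = pick-∸-> (s≤s x)
    skips (inj₂ x) = pick-ind (λ τ → τ ≡ ρ) (suc j ∸ rg σ 4) (pick-zero x) refl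

  reads-same : ∀ {M M′ : ℕ → ℕ} p ds → (∀ i → p ≤ i → M′ i ≡ M i) → Reads M p ds → Reads M′ p ds
  reads-same p []       h _       = tt
  reads-same p (d ∷ ds) h (e , r) = trans (h p ≤-refl) e , reads-same (suc p) ds (λ i p<i → h i (<⇒≤ p<i)) r

  written : ∀ {σ j v} → Setup σ → (mm σ [ rg σ 19 + j ≔ v ]) (n * n + n + j) ≡ v
  written {σ} {j} {v} S = trans (cong (λ N → (mm σ [ N + j ≔ v ]) (n * n + n + j)) (Setup.r19 S)) (≔-same (n * n + n + j))

  unwritten : ∀ {σ j v} → Setup σ → ∀ c → c ≢ n * n + n + j → (mm σ [ rg σ 19 + j ≔ v ]) c ≡ mm σ c
  unwritten {σ} {j} S c h = ≔-other λ e → h (trans (sym e) (cong (_+ j) (Setup.r19 S)))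

  later-cell : ∀ {i j} → j < i → n * n + n + i ≢ n * n + n + j
  later-cell j<i e = >⇒≢ j<i (+-cancelˡ-≡ (n * n + n) _ _ e)

  step-touched : ∀ {σ j v} → Setup σ → v < s → Touched j (mm σ) (mm σ [ rg σ 19 + j ≔ v ])
  step-touched {σ} {j} S v<s c with c ≟ n * n + n + j
  ... | yes refl = inj₂ (≤-trans (s≤s (≤-reflexive (written S))) v<s , ≤-refl)
  ... | no ne    = inj₁ (unwritten S c ne)

  touched-trans : ∀ {j M M′ M″} → Touched j M M′ → Touched (suc j) M′ M″ → Touched j M M″
  touched-trans t u c with u c
  ... | inj₂ (x , y) = inj₂ (x , ≤-trans (+-monoʳ-≤ (n * n + n) (n≤1+n _)) y)
  ... | inj₁ e with t c
  ...   | inj₁ e′      = inj₁ (trans e e′)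
  ...   | inj₂ (x , y) = inj₂ (≤-trans (s≤s (≤-reflexive e)) x , y)

  bump-list : ∀ r j {σ} ds → Setup σ → rg σ 13 ≡ 1 → 1 ≤ s → j + length ds ≡ L → length ds ≤ r →
              Reads (λ i → mm σ (n * n + n + i)) j ds → Outcome j σ (iterFrom j r bumpAt σ) ds
  bump-list r j {σ} [] S c 1≤s e _ R with m , f ← idle r j {σ} (inj₁ (≤-reflexive (trans (Setup.r4 S) (trans (sym e) (+-identityʳ j))))) =
    outcome (trans f c) tt λ a → inj₁ (cong (λ M → M a) m)
  bump-list (suc r) j {σ} (d ∷ ds) S c 1≤s e (s≤s l≤r) (q , R) = go (s ∸ suc d) refl
    where
    ρ : State
    ρ = σ ⟨ 14 ≔ j ⟩
    S′ : Setup ρ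
    S′ = setup (Setup.r3 S) (Setup.r4 S) (Setup.r19 S)
    j<L : j < rg σ 4
    j<L = subst (j <_) (trans e (sym (Setup.r4 S))) (m<m+n j (s≤s z≤n))
    test : rg ρ 3 ∸ suc (mm ρ (rg ρ 19 + j)) ≡ s ∸ suc d
    test = cong₂ (λ x y → x ∸ suc y) (Setup.r3 S) (trans (cong (λ N → mm σ (N + j)) (Setup.r19 S)) q)
    wrapped stopped : State
    wrapped = rg ρ ▸ mm ρ [ rg ρ 19 + j ≔ 0 ]
    stopped = (rg ρ ▸ mm ρ [ rg ρ 19 + j ≔ suc (mm ρ (rg ρ 19 + j)) ]) ⟨ 13 ≔ 0 ⟩
    active : bumpAt j σ ≡ pick (s ∸ suc d) wrapped stopped
    active = trans (pick-∸-≤ j<L) (trans (pick-nonzero λ z → 0≢1+n (trans (sym z) c)) (cong (λ t → pick t wrapped stopped) test))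
    Goal : List ℕ → ℕ → State → Set
    Goal es k τ = rg (iterFrom (suc j) r bumpAt τ) 13 ≡ k ×
                  Reads (λ i → mm (iterFrom (suc j) r bumpAt τ) (n * n + n + i)) j es ×
                  Touched j (mm σ) (mm (iterFrom (suc j) r bumpAt τ))
    pack : Goal (increment (d ∷ ds)) (carry (d ∷ ds)) (bumpAt j σ) → Outcome j σ (iterFrom (suc j) r bumpAt (bumpAt j σ)) (d ∷ ds)
    pack (x , y , z) = outcome x y z
    go : ∀ t → s ∸ suc d ≡ t → Outcome j σ (iterFrom (suc j) r bumpAt (bumpAt j σ)) (d ∷ ds)
    go zero z = pack (subst₂ (λ es k → Goal es k (bumpAt j σ)) (sym (pick-zero z)) (sym (pick-zero z))
      (subst (Goal (0 ∷ increment ds) (carry ds)) (sym (trans active (pick-zero z)))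
        (Outcome.flag rest ,
         (trans (kept (Outcome.touched rest (n * n + n + j))) (written S′) , Outcome.reads rest) ,
         touched-trans {M = mm σ} {M′ = mm wrapped} (step-touched {ρ} S′ 1≤s) (Outcome.touched rest))))
      where
      rest : Outcome (suc j) wrapped (iterFrom (suc j) r bumpAt wrapped) ds
      rest = bump-list r (suc j) {wrapped} ds (setup (Setup.r3 S) (Setup.r4 S) (Setup.r19 S)) c 1≤s
        (trans (sym (+-suc j (length ds))) e) l≤r
        (reads-same (suc j) ds (λ i j<i → unwritten S′ _ (later-cell j<i)) R)
      final = iterFrom (suc j) r bumpAt wrapped
      kept : mm final (n * n + n + j) ≡ mm wrapped (n * n + n + j) ⊎
             (mm final (n * n + n + j) < s × n * n + n + suc j ≤ n * n + n + j) →
             mm final (n * n + n + j) ≡ mm wrapped (n * n + n + j)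
      kept (inj₁ x)       = x
      kept (inj₂ (_ , h)) = ⊥-elim (<⇒≱ (+-monoʳ-< (n * n + n) (n<1+n j)) h)
    go (suc t) z = pack (subst₂ (λ es k → Goal es k (bumpAt j σ)) (sym (pick-nonzero nz)) (sym (pick-nonzero nz))
      (subst (Goal (suc d ∷ ds) 0) (sym (trans active (pick-nonzero nz)))
        (proj₂ still ,
         (trans (cong (λ M → M (n * n + n + j)) (proj₁ still)) (trans (written S′) (cong suc at-j)) ,
          reads-same (suc j) ds (λ i j<i → trans (cong (λ M → M (n * n + n + i)) (proj₁ still)) (unwritten S′ _ (later-cell j<i))) R) ,
         λ a → subst (λ M → M a ≡ mm σ a ⊎ (M a < s × n * n + n + j ≤ a)) (sym (proj₁ still))
           (step-touched S′ (≤-trans (s≤s (≤-reflexive (cong suc at-j))) d+1<s) a))))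
      where
      nz : s ∸ suc d ≢ 0
      nz h = 0≢1+n (trans (sym h) z)
      d+1<s : suc d < s
      d+1<s = ≰⇒> λ h → nz (m≤n⇒m∸n≡0 h)
      at-j : mm ρ (rg ρ 19 + j) ≡ d
      at-j = trans (cong (λ N → mm σ (N + j)) (Setup.r19 S)) q
      still : mm (iterFrom (suc j) r bumpAt stopped) ≡ mm stopped × rg (iterFrom (suc j) r bumpAt stopped) 13 ≡ 0
      still = idle r (suc j) {stopped} (inj₂ refl)

  odometer-value : ∀ {σ} ds → Setup σ → 1 ≤ s → length ds ≡ L → L ≤ rg σ 2 →
                   Reads (λ i → mm σ (n * n + n + i)) 0 ds → Outcome 0 σ (run odometer σ) ds
  odometer-value {σ} ds (setup a b c) 1≤s e L≤K R = pack (subst (λ τ → Outcome 0 σ′ τ ds) (sym (iter-split 0 (rg σ 2) bumpAt σ′))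
    (bump-list (rg σ 2) 0 {σ′} ds (setup a b c) refl 1≤s e (≤-trans (≤-reflexive e) L≤K) R))
    where
    σ′ : State
    σ′ = σ ⟨ 13 ≔ 1 ⟩
    pack : Outcome 0 σ′ (run odometer σ) ds → Outcome 0 σ (run odometer σ) ds
    pack (outcome x y z) = outcome x y z

-- Correctness of the search

erasing : State → ℕ → State
erasing = forState 15 (put (cell-label (var 15)) zero)

erase-cells : ∀ {n σ} → rg σ 17 ≡ n * n → ∀ j →
  (∀ v → v < j → mm (erasing σ j) (n * n + v) ≡ 0) ×
  (∀ c → (∀ v → v < j → c ≢ n * n + v) → mm (erasing σ j) c ≡ mm σ c)
erase-cells r17 zero = (λ _ ()) , λ _ _ → refl
erase-cells {n} {σ} r17 (suc j) with below , above ← erase-cells {n} {σ} r17 j = below′ , above′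
  where
  τ : State
  τ = erasing σ j
  at-cell : rg τ 17 + j ≡ n * n + j
  at-cell = cong (_+ j) (trans (for-fixes 17 15 (put (cell-label (var 15)) zero) {σ} _ j) r17)
  below′ : ∀ v → v < suc j → mm (erasing σ (suc j)) (n * n + v) ≡ 0
  below′ v v<1+j with v ≟ j
  ... | yes refl = trans (cong (λ c → if c ≡ᵇ n * n + v then 0 else mm τ (n * n + v)) at-cell) (≔-same (n * n + v))
  ... | no v≢j   = trans (≔-other (λ e → v≢j (sym (+-cancelˡ-≡ (n * n) j v (trans (sym at-cell) e)))))
                     (below v (≤∧≢⇒< (s≤s⁻¹ v<1+j) v≢j))
  above′ : ∀ c → (∀ v → v < suc j → c ≢ n * n + v) → mm (erasing σ (suc j)) c ≡ mm σ c
  above′ c h = trans (≔-other (λ e → h j (n<1+n j) (trans (sym e) at-cell))) (above c λ v v<j → h v (m<n⇒m<1+n v<j))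

reads-prefix : ∀ {D : ℕ → ℕ} p {L L′} → L′ ≤ L → Reads D p (zeros L) → Reads D p (zeros L′)
reads-prefix p z≤n     r       = tt
reads-prefix p (s≤s h) (e , r) = e , reads-prefix (suc p) h r

zeros-valid : ∀ {s} L → 1 ≤ s → All (_< s) (zeros L)
zeros-valid L 1≤s = replicate⁺ L 1≤s

val-zeros : ∀ s L → Digits.val s (zeros L) ≡ 0
val-zeros s zero    = refl
val-zeros s (suc L) = cong (_* s) (val-zeros s L)

-- With the commands as variables, `refl` is checked without unfolding the concrete ones.
body-phases : ∀ {A : Set} (c₁ c₂ c₃ c₄ c₅ c₆ : Cmd) (f : State → A) σ →
  f (run (c₁ ⨟ c₂ ⨟ c₃ ⨟ c₄ ⨟ c₅ ⨟ c₆) σ) ≡ f (run c₆ (run c₅ (run c₄ (run c₃ (run c₂ (run c₁ σ))))))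
body-phases c₁ c₂ c₃ c₄ c₅ c₆ f σ = refl

-- Keeps the type checker from unfolding the phases of the body into one another.
opaque

  after : Cmd → State → State
  after = run

  after-body : ∀ σ → run body σ ≡ after reset (after advance (after odometer (after erase (after check (after guess σ)))))
  after-body = body-phases guess check erase odometer advance reset (λ τ → τ)

  after-fixes : ∀ x c {σ} → Fixes x c → rg (after c σ) x ≡ rg σ x
  after-fixes = run-fixes

  after-pure : ∀ c {σ} → Pure c → mm (after c σ) ≡ mm σ
  after-pure = run-pure

  after-guess : ∀ σ → run guess σ ≡ after guess σ
  after-guess σ = refl

  after-guess-frame : ∀ {n σ} → Layout n σ → Frame n (mm σ) (mm (after guess σ))
  after-guess-frame {σ = σ} L = guess-for-frame L (rg σ 0)

  after-check : ∀ σ → rg (after check σ) 6 ≡ pick (⟦ violations ⟧ σ) 1 (rg σ 6)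
  after-check σ = pick-map (λ ω → rg ω 6) (⟦ violations ⟧ σ)

  after-erase : ∀ {n σ} → rg σ 17 ≡ n * n → ∀ m → rg σ 0 ≡ m →
    (∀ v → v < m → mm (after erase σ) (n * n + v) ≡ 0) ×
    (∀ c → (∀ v → v < m → c ≢ n * n + v) → mm (after erase σ) c ≡ mm σ c)
  after-erase {n} {σ} r17 _ refl = erase-cells {n} {σ} r17 (rg σ 0)

  after-odometer : ∀ n s L {σ} ds → OdometerLoop.Setup n s L σ → 1 ≤ s → length ds ≡ L → L ≤ rg σ 2 →
    Reads (λ i → mm σ (n * n + n + i)) 0 ds → OdometerLoop.Outcome n s L 0 σ (after odometer σ) ds
  after-odometer = OdometerLoop.odometer-value

  enlarged : State → State
  enlarged σ = σ ⟨ 3 ≔ suc (rg σ 3) ⟩ ⟨ 4 ≔ quot (rg σ 2) (suc (rg σ 3)) ⟩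

  enlarged-regs : ∀ σ → mm (enlarged σ) ≡ mm σ × rg (enlarged σ) 0 ≡ rg σ 0 × rg (enlarged σ) 2 ≡ rg σ 2 ×
    rg (enlarged σ) 3 ≡ suc (rg σ 3) × rg (enlarged σ) 4 ≡ quot (rg σ 2) (suc (rg σ 3)) ×
    rg (enlarged σ) 5 ≡ rg σ 5 × rg (enlarged σ) 17 ≡ rg σ 17 × rg (enlarged σ) 19 ≡ rg σ 19
  enlarged-regs σ = refl , refl , refl , refl , refl , refl , refl , refl

  advance-still : ∀ σ → rg σ 13 ≡ 0 → after advance σ ≡ σ
  advance-still σ e = pick-zero e

  advance-enlarge : ∀ σ → rg σ 13 ≡ 1 → suc (rg σ 3) ≤ suc (rg σ 0) → after advance σ ≡ enlarged σ
  advance-enlarge σ c h = trans (pick-nonzero λ e → 0≢1+n (trans (sym e) c)) (pick-∸-> (s≤s h))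

  advance-finish : ∀ σ → rg σ 13 ≡ 1 → suc (rg σ 0) < suc (rg σ 3) → rg (after advance σ) 5 ≡ 0
  advance-finish σ c h = cong (λ ω → rg ω 5)
    (trans (pick-nonzero λ e → 0≢1+n (trans (sym e) c)) (pick-∸-≤ {a = enlarged σ ⟨ 5 ≔ 0 ⟩} h))

  after-reset : ∀ σ → mm (after reset σ) ≡ mm σ
  after-reset σ = refl

  scratch : ∀ σ → All (λ x → rg (after reset σ) x ≡ 0) (1 ∷ 7 ∷ 8 ∷ 9 ∷ 10 ∷ 11 ∷ 12 ∷ 13 ∷ 14 ∷ 15 ∷ 16 ∷ 18 ∷ [])
  scratch σ = refl ∷ refl ∷ refl ∷ refl ∷ refl ∷ refl ∷ refl ∷ refl ∷ refl ∷ refl ∷ refl ∷ refl ∷ []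

after-layout : ∀ {n σ} c → Fixes 0 c × Fixes 17 c × Fixes 19 c → Layout n σ → Layout n (after c σ)
after-layout c (f , g , h) (layout a b d) =
  layout (trans (after-fixes 0 c f) a) (trans (after-fixes 17 c g) b) (trans (after-fixes 19 c h) d)

module Search {n : ℕ} (G : Graph n) (k : ℕ) where

  K limit : ℕ
  K = k ⊓ (n * n)
  -- The largest address held in a variable is `n * n + n`; the 2 leaves room for sizes up to
  -- `n + 1` and for the flags when `n = 0`.
  limit = n * n + n + 2

  a : ℕ → ℕ → ℕ
  a u v = mem (input G k) (Σ[ u ] (λ _ → n) + v)

  represents : Represents (adj G) a
  represents u v = trans (cong (λ x → mem (input G k) (x + toℕ v)) (Σ-const (toℕ u) n)) (input-adj G k u v)

  a-sym : ∀ u v → u < n → v < n → a u v ≡ a v u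
  a-sym u v u<n v<n = at-Fin {P = λ u → a u v ≡ a v u} (λ i → at-Fin {P = λ v → a (toℕ i) v ≡ a v (toℕ i)}
    (λ j → trans (represents i j) (trans (cong bit (Graph.sym G i j)) (sym (represents j i)))) v v<n) u u<n

  a-irr : ∀ u → u < n → a u u ≡ 0
  a-irr = at-Fin {P = λ u → a u u ≡ 0} λ i → trans (represents i i) (cong bit (Graph.irrefl G i))

  Adjacent : State → Set
  Adjacent σ = ∀ u v → u < n → v < n → mm σ (Σ[ u ] (λ _ → n) + v) ≡ a u v

  digits : State → ℕ → ℕ
  digits σ i = mm σ (n * n + n + i)

  -- The state at the head of the outer loop when the string `ds` is about to be tried for size `s`.
  record Canon (s : ℕ) (ds : List ℕ) (σ : State) : Set where
    field
      lay   : Layout n σ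
      r2    : rg σ 2 ≡ K
      r3    : rg σ 3 ≡ s
      r4    : rg σ 4 ≡ quot K s
      r5    : rg σ 5 ≡ 1
      r7    : rg σ 7 ≡ 0
      r8    : rg σ 8 ≡ 0
      adjc  : Adjacent σ
      blank : ∀ v → v < n → mm σ (n * n + v) ≡ 0
      reads : Reads (digits σ) 0 ds
      len   : length ds ≡ quot K s
      valid : All (_< s) ds
      1≤s   : 1 ≤ s
      s≤1+n : s ≤ suc n
      bnd   : Bounded limit σ

  open Canon

  violated : State → ℕ
  violated σ = ⟦ violations ⟧ (after guess σ)

  K≤limit : K ≤ limit
  K≤limit = ≤-trans (m⊓n≤n k (n * n)) (≤-trans (m≤m+n (n * n) n) (m≤m+n _ 2))

  n≤limit : n ≤ limit
  n≤limit = ≤-trans (m≤n+m n (n * n)) (m≤m+n _ 2)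

  2+n≤limit : suc (suc n) ≤ limit
  2+n≤limit = ≤-trans (≤-reflexive (+-comm 2 n)) (+-monoˡ-≤ 2 (m≤n+m n (n * n)))

  1≤limit : 1 ≤ limit
  1≤limit = ≤-trans (s≤s z≤n) 2+n≤limit

  module Body {s : ℕ} {ds : List ℕ} {σ : State} (C : Canon s ds σ) where

    open Digits s

    σ₁ σ₂ σ₃ σ₄ σ₅ τ : State
    σ₁ = after guess σ
    σ₂ = after check σ₁
    σ₃ = after erase σ₂
    σ₄ = after odometer σ₃
    σ₅ = after advance σ₄
    τ  = after reset σ₅

    layout₁ : Layout n σ₁
    layout₁ = after-layout guess _ (lay C)

    layout₂ : Layout n σ₂
    layout₂ = after-layout check _ layout₁

    layout₃ : Layout n σ₃
    layout₃ = after-layout erase _ layout₂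

    layout₄ : Layout n σ₄
    layout₄ = after-layout odometer _ layout₃

    fixed₃ : ∀ x → Fixes x (guess ⨟ check ⨟ erase) → rg σ₃ x ≡ rg σ x
    fixed₃ x (f , g , h) = trans (after-fixes x erase h) (trans (after-fixes x check g) (after-fixes x guess f))

    fixed₄ : ∀ x → Fixes x (guess ⨟ check ⨟ erase) → Fixes x odometer → rg σ₄ x ≡ rg σ x
    fixed₄ x f g = trans (after-fixes x odometer g) (fixed₃ x f)

    adjacent₁ : Adjacent σ₁
    adjacent₁ u v u<n v<n = trans (after-guess-frame (lay C) _ (edge-cell u v u<n v<n)) (adjc C u v u<n v<n)

    violated-value : violated σ ≡ Checker.violationsᵛ n a K s (rg σ₁ 7) (λ v → mm σ₁ (n * n + v))
    violated-value = Checker.violations-value n a K s (rg σ₁ 7) layout₁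
      (trans (after-fixes 2 guess {σ} _) (r2 C)) (trans (after-fixes 3 guess {σ} _) (r3 C)) refl adjacent₁

    hit-sound : violated σ ≡ 0 → ∃[ π ] Clustering n a K s (rg σ₁ 7) π
    hit-sound z = _ , Checker.clustering-found n a K s (rg σ₁ 7) (trans (sym violated-value) z)

    answer : rg τ 6 ≡ pick (violated σ) 1 (rg σ 6)
    answer = trans (after-fixes 6 reset _) (trans (after-fixes 6 advance _) (trans (after-fixes 6 odometer _) (trans (after-fixes 6 erase _)
      (trans (after-check σ₁) (cong (pick (violated σ) 1) (after-fixes 6 guess {σ} _))))))

    -- Guessing alters label cells only, and these were blank before; erasing them thus restores the
    -- whole memory.
    same₃ : ∀ c → mm σ₃ c ≡ mm σ c
    same₃ c = by-cases (c <? n * n) (c <? n * n + n)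
      where
      erased : (∀ v → v < n → mm σ₃ (n * n + v) ≡ 0) × (∀ c → (∀ v → v < n → c ≢ n * n + v) → mm σ₃ c ≡ mm σ₂ c)
      erased = after-erase {n} {σ₂} (Layout.r17 layout₂) n (Layout.r0 layout₂)
      outside : (∀ v → v < n → c ≢ n * n + v) → mm σ₃ c ≡ mm σ c
      outside h = trans (proj₂ erased c h) (trans (cong (λ M → M c) (after-pure check {σ₁} _)) (after-guess-frame (lay C) c h))
      by-cases : Dec (c < n * n) → Dec (c < n * n + n) → mm σ₃ c ≡ mm σ c
      by-cases (yes h) _ = outside λ v _ e → <⇒≢ (<-≤-trans h (m≤m+n (n * n) v)) e
      by-cases (no _) (no h) = outside λ v v<n e → h (subst (_< n * n + n) (sym e) (+-monoʳ-< (n * n) v<n))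
      by-cases (no l) (yes h) = subst (λ x → mm σ₃ x ≡ mm σ x) (m+[n∸m]≡n (≮⇒≥ l))
        (trans (proj₁ erased (c ∸ n * n) v<n) (sym (blank C (c ∸ n * n) v<n)))
        where
        v<n : c ∸ n * n < n
        v<n = +-cancelˡ-< (n * n) _ _ (subst (_< n * n + n) (sym (m+[n∸m]≡n (≮⇒≥ l))) h)

    turned : OdometerLoop.Outcome n s (quot K s) 0 σ₃ σ₄ ds
    turned = after-odometer n s (quot K s) ds
      (OdometerLoop.setup (trans (fixed₃ 3 _) (r3 C)) (trans (fixed₃ 4 _) (r4 C)) (Layout.r19 layout₃))
      (1≤s C) (len C) (≤-trans (quot-≤ K s) (≤-reflexive (sym (trans (fixed₃ 2 _) (r2 C)))))
      (OdometerLoop.reads-same n s (quot K s) {digits σ} {digits σ₃} 0 ds (λ i _ → same₃ _) (reads C))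

    open OdometerLoop.Outcome turned renaming (flag to flag₄; reads to reads₄; touched to touched₄)

    low : ∀ c → c < n * n + n → mm σ₄ c ≡ mm σ c
    low c h with touched₄ c
    ... | inj₁ e       = trans e (same₃ c)
    ... | inj₂ (_ , g) = ⊥-elim (<⇒≱ h (≤-trans (m≤m+n _ 0) g))

    cell-≤ : ∀ c → mm σ₄ c ≤ limit
    cell-≤ c with touched₄ c
    ... | inj₁ e       = ≤-trans (≤-reflexive (trans e (same₃ c))) (Bounded.cells (bnd C) c)
    ... | inj₂ (h , _) = ≤-trans (<⇒≤ h) (≤-trans (s≤1+n C) (≤-trans (n≤1+n _) 2+n≤limit))

    canon-τ : ∀ {s′ ds′} → mm σ₅ ≡ mm σ₄ → Layout n σ₅ → rg σ₅ 2 ≡ K → rg σ₅ 3 ≡ s′ → rg σ₅ 4 ≡ quot K s′ → rg σ₅ 5 ≡ 1 →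
      Reads (digits σ₄) 0 ds′ → length ds′ ≡ quot K s′ → All (_< s′) ds′ → 1 ≤ s′ → s′ ≤ suc n → Canon s′ ds′ τ
    canon-τ {s′} {ds′} m L q2 q3 q4 q5 R l V 1≤ ≤n = record
      { lay = L′ ; r2 = p2 ; r3 = p3 ; r4 = p4 ; r5 = p5 ; r7 = All.lookup (scratch σ₅) (there (here refl))
      ; r8 = All.lookup (scratch σ₅) (there (there (here refl)))
      ; adjc = λ u v u<n v<n → trans (memory _) (trans (low _ (<-≤-trans (edge-cell-< u<n v<n) (m≤m+n _ n))) (adjc C u v u<n v<n))
      ; blank = λ v v<n → trans (memory _) (trans (low _ (+-monoʳ-< (n * n) v<n)) (blank C v v<n))
      ; reads = subst (λ M → Reads (λ i → M (n * n + n + i)) 0 ds′) (sym (trans (after-reset σ₅) m)) R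
      ; len = l ; valid = V ; 1≤s = 1≤ ; s≤1+n = ≤n
      ; bnd = bounded (λ x x<V → All.lookup (registers (scratch σ₅)) (∈-upTo⁺ x<V)) λ c → ≤-trans (≤-reflexive (memory c)) (cell-≤ c)
      }
      where
      L′ : Layout n τ
      L′ = after-layout reset _ L
      p2 : rg τ 2 ≡ K
      p2 = trans (after-fixes 2 reset _) q2
      p3 : rg τ 3 ≡ s′
      p3 = trans (after-fixes 3 reset _) q3
      p4 : rg τ 4 ≡ quot K s′
      p4 = trans (after-fixes 4 reset _) q4
      p5 : rg τ 5 ≡ 1
      p5 = trans (after-fixes 5 reset _) q5
      memory : ∀ c → mm τ c ≡ mm σ₄ c
      memory c = cong (λ M → M c) (trans (after-reset σ₅) m)
      is : ∀ {x y} → x ≡ y → y ≤ limit → x ≤ limit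
      is e h = ≤-trans (≤-reflexive e) h
      nil : ∀ {x} → x ≡ 0 → x ≤ limit
      nil e = is e z≤n
      ans-≤ : rg τ 6 ≤ limit
      ans-≤ = is answer (pick-ind (_≤ limit) (violated σ) 1≤limit (Bounded.regs (bnd C) 6 (≤ᵇ⇒≤ 7 20 _)))
      registers : All (λ x → rg τ x ≡ 0) (1 ∷ 7 ∷ 8 ∷ 9 ∷ 10 ∷ 11 ∷ 12 ∷ 13 ∷ 14 ∷ 15 ∷ 16 ∷ 18 ∷ []) →
                  All (λ x → rg τ x ≤ limit) (upTo vars)
      registers (e₁ ∷ e₇ ∷ e₈ ∷ e₉ ∷ e₁₀ ∷ e₁₁ ∷ e₁₂ ∷ e₁₃ ∷ e₁₄ ∷ e₁₅ ∷ e₁₆ ∷ e₁₈ ∷ []) =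
        is (Layout.r0 L′) n≤limit ∷ nil e₁ ∷ is p2 K≤limit ∷ is p3 (≤-trans ≤n (≤-trans (n≤1+n _) 2+n≤limit)) ∷
        is p4 (≤-trans (quot-≤ K s′) K≤limit) ∷ is p5 1≤limit ∷ ans-≤ ∷
        nil e₇ ∷ nil e₈ ∷ nil e₉ ∷ nil e₁₀ ∷ nil e₁₁ ∷ nil e₁₂ ∷ nil e₁₃ ∷ nil e₁₄ ∷ nil e₁₅ ∷ nil e₁₆ ∷
        is (Layout.r17 L′) (≤-trans (m≤m+n (n * n) n) (m≤m+n _ 2)) ∷ nil e₁₈ ∷ is (Layout.r19 L′) (m≤m+n _ 2) ∷ []

    data Successor : Set where
      turn   : carry ds ≡ 0 → val (increment ds) ≡ suc (val ds) → Canon s (increment ds) τ → Successor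
      enlarge : suc (val ds) ≡ s ^ quot K s → suc s ≤ suc n → Canon (suc s) (zeros (quot K (suc s))) τ → Successor
      finish : suc (val ds) ≡ s ^ quot K s → s ≡ suc n → rg τ 5 ≡ 0 → Successor

    successor : Successor
    successor with carry-cases (valid C)
    ... | inj₁ (c , v) = turn c v (canon-τ (cong mm still) (subst (Layout n) (sym still) layout₄)
        (trans (cong (λ ω → rg ω 2) still) (trans (fixed₄ 2 _ _) (r2 C)))
        (trans (cong (λ ω → rg ω 3) still) (trans (fixed₄ 3 _ _) (r3 C)))
        (trans (cong (λ ω → rg ω 4) still) (trans (fixed₄ 4 _ _) (r4 C)))
        (trans (cong (λ ω → rg ω 5) still) (trans (fixed₄ 5 _ _) (r5 C)))
        reads₄ (trans (length-increment ds) (len C)) (increment-valid (valid C)) (1≤s C) (s≤1+n C))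
      where
      still : σ₅ ≡ σ₄
      still = advance-still σ₄ (trans flag₄ c)
    ... | inj₂ (c , v , z) = over (suc s ≤? suc n)
      where
      q2 : rg σ₄ 2 ≡ K
      q2 = trans (fixed₄ 2 _ _) (r2 C)
      q3 : rg σ₄ 3 ≡ s
      q3 = trans (fixed₄ 3 _ _) (r3 C)
      value : suc (val ds) ≡ s ^ quot K s
      value = trans v (cong (s ^_) (len C))
      over : Dec (suc s ≤ suc n) → Successor
      over (yes h) with m , e0 , e2 , e3 , e4 , e5 , e17 , e19 ← enlarged-regs σ₄ =
        enlarge value h (canon-τ (trans (cong mm larger) m)
          (subst (Layout n) (sym larger) (layout (trans e0 (Layout.r0 layout₄)) (trans e17 (Layout.r17 layout₄)) (trans e19 (Layout.r19 layout₄))))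
          (trans (cong (λ ω → rg ω 2) larger) (trans e2 q2))
          (trans (cong (λ ω → rg ω 3) larger) (trans e3 (cong suc q3)))
          (trans (cong (λ ω → rg ω 4) larger) (trans e4 (cong₂ (λ x y → quot x (suc y)) q2 q3)))
          (trans (cong (λ ω → rg ω 5) larger) (trans e5 (trans (fixed₄ 5 _ _) (r5 C))))
          (reads-prefix 0 (quot-anti K s (1≤s C)) (subst (Reads (digits σ₄) 0) (trans z (cong zeros (len C))) reads₄))
          (length-replicate (quot K (suc s))) (zeros-valid (quot K (suc s)) (s≤s z≤n)) (s≤s z≤n) h)
        where
        larger : σ₅ ≡ enlarged σ₄
        larger = advance-enlarge σ₄ (trans flag₄ c) (subst₂ _≤_ (cong suc (sym q3)) (cong suc (sym (Layout.r0 layout₄))) h)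
      over (no h) = finish value (≤-antisym (s≤1+n C) (s≤s⁻¹ (≰⇒> h)))
        (trans (after-fixes 5 reset _) (advance-finish σ₄ (trans flag₄ c)
          (subst₂ _≤_ (cong (λ x → suc (suc x)) (sym (Layout.r0 layout₄))) (cong suc (sym q3)) (≰⇒> h))))

  -- All that the search has to know about a solution: a string of the right shape that passes the
  -- check whenever it is tried.
  record Target (s : ℕ) (es : List ℕ) : Set where
    field
      t-len   : length es ≡ quot K s
      t-valid : All (_< s) es
      t-pos   : 1 ≤ s
      t-size  : s ≤ suc n
      t-hit   : ∀ {σ} → Canon s es σ → violated σ ≡ 0

  open Target

  module _ {s m π} (1≤s : 1 ≤ s) (s≤ : s ≤ suc n) (D : Clustering n a K s m π) where

    open Optimum n a K s m π D a-sym a-irr hiding (Adjacent; digits)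

    script padded : List ℕ
    script = plan n (λ _ → 0) 0
    -- The odometer only visits strings of length `quot K s`; the plan never reads the padding.
    padded = script ++ zeros (quot K s ∸ length script)

    unstarted : Consistent (λ _ → 0) 0
    unstarted = record { below = λ _ _ → z≤n ; whole = λ _ _ _ _ _ → refl ; pure = λ _ _ _ _ _ h → ⊥-elim (h refl) ; used = λ _ () }

    script-≤ : length script ≤ quot K s
    script-≤ = quot-max K s (length script) 1≤s (*-cancelˡ-≤ 2 (begin
      2 * (length script * s)      ≡⟨ *-assoc 2 (length script) s ⟨
      2 * length script * s        ≡⟨ *-comm (2 * length script) s ⟩
      s * (2 * length script)      ≡⟨ *-assoc s 2 (length script) ⟨
      s * 2 * length script        ≡⟨ cong (_* length script) (trans (*-comm s 2) (cong (s +_) (+-identityʳ s))) ⟩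
      (s + s) * length script      ≤⟨ plan-length n unstarted ⟩
      -- With no vertex labelled, the potential is the full double count of deleted edges.
      Φ (λ _ → 0)                  ≡⟨ ΣΣ-cong n (λ u v _ _ → trans (+-identityʳ _) (+-identityʳ _)) ⟩
      ΣΣ n (split a π)             ≤⟨ Clustering.budget D ⟩
      K + K                        ≡⟨ cong (K +_) (+-identityʳ K) ⟨
      2 * K                        ∎))
      where open ≤-Reasoning

    target : Target s padded
    target = record
      { t-len   = trans (length-++ script) (trans (cong (length script +_) (length-replicate _)) (m+[n∸m]≡n script-≤))
      ; t-valid = ++⁺ (plan-digits n unstarted) (zeros-valid _ 1≤s)
      ; t-pos   = 1≤s
      ; t-size  = s≤
      ; t-hit   = hit
      }
      where
      hit : ∀ {σ} → Canon s padded σ → violated σ ≡ 0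
      hit {σ} C with l , I , labels , all ← subst
          (λ σ₁ → ∃[ l ] Consistent l (rg σ₁ 7) × Labels σ₁ l × (∀ v → v < n → l v ≢ 0)) (after-guess σ)
          (guess-value (lay C) (r3 C) (adjc C) (r7 C) (r8 C) (blank C) (reads-++ˡ script (reads C))) =
        trans (Body.violated-value C) (Checker.violations-none n a K s (rg (after guess σ) 7)
          (λ v v<n → trans (labels v v<n) (suc-pred′ (l v) (all v v<n))) (consistent-clustering I all))
        where
        suc-pred′ : ∀ x → x ≢ 0 → x ≡ suc (pred x)
        suc-pred′ zero    h = ⊥-elim (h refl)
        suc-pred′ (suc x) _ = refl

  clustering-size : ∀ {s m π} → 1 ≤ n → Clustering n a K s m π → 1 ≤ s × s ≤ suc n
  clustering-size {s} {m} {π} 1≤n D = subst (λ s → 1 ≤ s × s ≤ suc n) (Clustering.sizes D (π 0) (Clustering.range D 0 1≤n))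
    ( ≤-trans (≤-reflexive (sym (pick-≡ {x = π 0} refl))) (Σ-term n (λ v → pick (apart (π v) (π 0)) 1 0) 1≤n)
    , ≤-trans (Σ-≤ n {B = 1} λ v _ → pick-ind (_≤ 1) (apart (π v) (π 0)) ≤-refl z≤n) (≤-trans (≤-reflexive (*-identityʳ n)) (n≤1+n n)))

  UCED⇒target : UCED G k → ∃[ s ] ∃[ es ] Target s es
  UCED⇒target U with s , m , π , D ← UCED⇒clustering G a represents U with n ≟ 0
  ... | no n≢0 with 1≤s , s≤ ← clustering-size (n≢0⇒n>0 n≢0) D = s , _ , target 1≤s s≤ D
  -- Without vertices the given clustering has size 0, or no cliques and an arbitrary size; it is
  -- replaced by zero cliques of size 1.
  ... | yes n≡0 = 1 , _ , target {m = 0} {π = π} ≤-refl (s≤s z≤n) record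
    { range  = λ v v<n → ⊥-elim (none v v<n)
    ; sizes  = λ _ ()
    ; clique = λ u _ u<n → ⊥-elim (none u u<n)
    ; budget = Clustering.budget D
    }
    where
    none : ∀ v → ¬ v < n
    none v v<n = n≮0 (subst (v <_) n≡0 v<n)

  -- Invariants and termination of the search.

  bodyStep : State → State
  bodyStep σ = after reset (after advance (after odometer (after erase (after check (after guess σ)))))

  Sound : State → Set
  Sound σ = rg σ 6 ≡ 0 ⊎ (rg σ 6 ≡ 1 × UCED G k)

  -- No target has been passed without success: in the lexicographic order of size and value, each
  -- lies at or after the current string.
  Ahead : ℕ → ℕ → State → Set
  Ahead s x σ = ∀ {s′ es} → Target s′ es → rg σ 6 ≡ 1 ⊎ (s < s′ ⊎ (s ≡ s′ × x ≤ Digits.val s es))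

  UCED-weaken : UCED G K → UCED G k
  UCED-weaken (F , F⊆G , few , U) = F , F⊆G , ≤-trans few (m⊓n≤m k (n * n)) , U

  module _ {s ds σ} (C : Canon s ds σ) where

    open Digits s

    sound-step : Sound σ → Sound (bodyStep σ)
    sound-step S = go (violated σ) S refl
      where
      go : ∀ x → Sound σ → violated σ ≡ x → Sound (bodyStep σ)
      go zero _ e = inj₂ (trans (Body.answer C) (pick-zero e) ,
        UCED-weaken (clustering⇒UCED G a represents (proj₂ (Body.hit-sound C e))))
      go (suc x) (inj₁ z)       e = inj₁ (trans (Body.answer C) (trans (cong (λ y → pick y 1 (rg σ 6)) e) z))
      go (suc x) (inj₂ (z , U)) e = inj₂ (trans (Body.answer C) (trans (cong (λ y → pick y 1 (rg σ 6)) e) z) , U)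

    found-stays : rg σ 6 ≡ 1 → rg (bodyStep σ) 6 ≡ 1
    found-stays e = trans (Body.answer C) (pick-ind (_≡ 1) (violated σ) refl e)

    target-reached : ∀ {es} → Target s es → val ds ≡ val es → rg (bodyStep σ) 6 ≡ 1
    target-reached T e with refl ← val-injective (valid C) (t-valid T) (trans (len C) (sym (t-len T))) e =
      trans (Body.answer C) (pick-zero (t-hit T C))

    ahead-turn : Ahead s (val ds) σ → Ahead s (suc (val ds)) (bodyStep σ)
    ahead-turn A T with A T
    ... | inj₁ e               = inj₁ (found-stays e)
    ... | inj₂ (inj₁ h)        = inj₂ (inj₁ h)
    ... | inj₂ (inj₂ (refl , h)) with m≤n⇒m<n∨m≡n h
    ...   | inj₁ l = inj₂ (inj₂ (refl , l))
    ...   | inj₂ e = inj₁ (target-reached T e)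

    -- At the last string for `s`, a target of size `s` that has not been passed can only be this
    -- very string.
    ahead-over : suc (val ds) ≡ s ^ quot K s → Ahead s (val ds) σ →
                 ∀ {s′ es} → Target s′ es → rg (bodyStep σ) 6 ≡ 1 ⊎ s < s′
    ahead-over v A {s′} {es} T with A T
    ... | inj₁ e               = inj₁ (found-stays e)
    ... | inj₂ (inj₁ h)        = inj₂ h
    ... | inj₂ (inj₂ (refl , h)) = inj₁ (target-reached T (≤-antisym h (s≤s⁻¹ (≤-trans (val-< (t-valid T))
                                   (≤-reflexive (trans (cong (s ^_) (t-len T)) (sym v)))))))

  bodyCost : ℕ
  bodyCost = atMost (runMono body) limit

  Decided : State → Set
  Decided σ = Sound σ × (∀ {s es} → Target s es → rg σ 6 ≡ 1)

  Halts : ℕ → State → Set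
  Halts J σ = ∀ S → S ∼ σ → ∃[ t ] ∃[ S′ ] ∃[ τ ]
    (⟪ while 5 (compile body vars) ⟫ S ⇓[ t ] S′) × S′ ∼ τ × t ≤ 1 + J * (2 + bodyCost) × Decided τ

  halts-stop : ∀ {σ} → rg σ 5 ≡ 0 → Decided σ → Halts 0 σ
  halts-stop {σ} e D S (r , m) = 1 , S , σ , b-exit (trans (r 5 (≤ᵇ⇒≤ 6 20 _)) e) , (r , m) , ≤-refl , D

  canon-tame : ∀ {s ds σ} → Canon s ds σ → Tame limit limit σ
  canon-tame C = tame ≤-refl (≤-trans (≤-reflexive (Layout.r0 (lay C))) n≤limit) (≤-trans (≤-reflexive (r2 C)) K≤limit) (bnd C)

  NextRun : State → State → Set
  NextRun S υ = ∃[ t ] ∃[ T ] (⟪ compile body vars ⟫ S ⇓[ t ] T) × T ∼ υ × t ≤ bodyCost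

  run-next : ∀ {s ds σ S} → Canon s ds σ → S ∼ σ → NextRun S (bodyStep σ)
  run-next {σ = σ} {S} C a = subst (NextRun S) (after-body σ) (run-within body a (runMono-≤ body body-static (canon-tame C)))

  halts-step : ∀ {s ds σ J} → Canon s ds σ → Halts J (bodyStep σ) → Halts (suc J) σ
  halts-step {σ = σ} {J} C H S S∼σ = first (run-next C S∼σ)
    where
    Result : State → Set
    Result υ = ∃[ t ] ∃[ S′ ] ∃[ τ ] (⟪ while 5 (compile body vars) ⟫ υ ⇓[ t ] S′) × S′ ∼ τ × t ≤ 1 + suc J * (2 + bodyCost) × Decided τ
    Rest : State → Set
    Rest υ = ∃[ t ] ∃[ S′ ] ∃[ τ ] (⟪ while 5 (compile body vars) ⟫ υ ⇓[ t ] S′) × S′ ∼ τ × t ≤ 1 + J * (2 + bodyCost) × Decided τ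
    add-step : ∀ J {B c t} → c ≤ B → t ≤ 1 + J * (2 + B) → c + (1 + t) ≤ suc J * (2 + B)
    add-step J {B} {c} {t} c≤ t≤ = begin
      c + (1 + t)                     ≤⟨ +-mono-≤ c≤ (s≤s t≤) ⟩
      B + (2 + J * (2 + B))           ≡⟨ +-assoc B 2 _ ⟨
      B + 2 + J * (2 + B)             ≡⟨ cong (_+ J * (2 + B)) (+-comm B 2) ⟩
      2 + B + J * (2 + B)             ∎
      where open ≤-Reasoning
    second : ∀ {c S₁} → ⟪ compile body vars ⟫ S ⇓[ c ] S₁ → c ≤ bodyCost → Rest S₁ → Result S
    second r₁ c≤ (t , S₂ , τ , r₂ , a₂ , t≤ , D) =
      _ , S₂ , τ , b-loop (trans (proj₁ S∼σ 5 (≤ᵇ⇒≤ 6 20 _)) (r5 C)) r₁ r₂ , a₂ , s≤s (add-step J c≤ t≤) , D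
    first : NextRun S (bodyStep σ) → Result S
    first (c , S₁ , r₁ , a₁ , c≤) = second r₁ c≤ (H S₁ a₁)

  -- The number of strings for the `d` sizes following `s`.
  later : ℕ → ℕ → ℕ
  later zero    s = 0
  later (suc d) s = suc s ^ quot K (suc s) + later d (suc s)

  -- `r` strings of size `s` remain after the current one, and `d` sizes after `s`; the recursion is
  -- lexicographic in `d` and `r`.
  search : ∀ d s r {ds σ} → s + d ≡ suc n → Digits.val s ds + suc r ≡ s ^ quot K s → Canon s ds σ → Sound σ →
           Ahead s (Digits.val s ds) σ → Halts (suc r + later d s) σ
  search d s r {ds} {σ} e v C S A = go r v (Body.successor C)
    where
    open Digits s
    overflow : ∀ r → val ds + suc r ≡ s ^ quot K s → suc (val ds) ≡ s ^ quot K s → r ≡ 0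
    overflow r v w = suc-injective (+-cancelˡ-≡ (val ds) (suc r) 1 (trans v (trans (sym w) (+-comm 1 (val ds)))))
    go : ∀ r → val ds + suc r ≡ s ^ quot K s → Body.Successor C → Halts (suc r + later d s) σ
    go zero v (Body.turn c w C′) = ⊥-elim (<⇒≱ (val-< (valid C′)) (≤-reflexive
      (trans (cong (s ^_) (len C′)) (trans (sym v) (trans (+-comm (val ds) 1) (sym w))))))
    go (suc r) v (Body.turn c w C′) = halts-step {J = suc r + later d s} C (search d s r e
      (trans (cong (_+ suc r) w) (trans (sym (+-suc (val ds) (suc r))) v)) C′ (sound-step C S)
      (subst (λ x → Ahead s x (bodyStep σ)) (sym w) (ahead-turn C A)))
    go r v (Body.finish w s≡ q) with refl ← overflow r v w =
      subst (λ J → Halts (suc J) σ) (sym (none d e)) (halts-step {J = 0} C (halts-stop q (sound-step C S , all)))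
      where
      none : ∀ d → s + d ≡ suc n → later d s ≡ 0
      none zero    _ = refl
      none (suc d) e = ⊥-elim (<⇒≢ (m<m+n s (s≤s z≤n)) (trans s≡ (sym e)))
      all : ∀ {s′ es} → Target s′ es → rg (bodyStep σ) 6 ≡ 1
      all T with ahead-over C w A T
      ... | inj₁ q = q
      ... | inj₂ h = ⊥-elim (<⇒≱ h (≤-trans (t-size T) (≤-reflexive (sym s≡))))
    go r v (Body.enlarge w h C′) with refl ← overflow r v w = grow d e
      where
      grow : ∀ d → s + d ≡ suc n → Halts (suc (later d s)) σ
      grow zero    e = ⊥-elim (<⇒≱ h (≤-reflexive (trans (sym e) (+-identityʳ s))))
      grow (suc d) e = halts-step {J = suc s ^ quot K (suc s) + later d (suc s)} C (subst (λ J → Halts (J + later d (suc s)) (bodyStep σ)) full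
        (search d (suc s) (pred (suc s ^ quot K (suc s))) (trans (sym (+-suc s d)) e)
          (trans (cong (_+ suc (pred (suc s ^ quot K (suc s)))) (val-zeros (suc s) (quot K (suc s)))) full)
          C′ (sound-step C S) ahead))
        where
        full : suc (pred (suc s ^ quot K (suc s))) ≡ suc s ^ quot K (suc s)
        full = suc-pred _ {{m^n≢0 (suc s) (quot K (suc s))}}
        ahead : Ahead (suc s) (Digits.val (suc s) (zeros (quot K (suc s)))) (bodyStep σ)
        ahead T with ahead-over C w A T
        ... | inj₁ q = inj₁ q
        ... | inj₂ h with m≤n⇒m<n∨m≡n h
        ...   | inj₁ l = inj₂ (inj₁ l)
        ...   | inj₂ q = inj₂ (inj₂ (q , ≤-trans (≤-reflexive (val-zeros (suc s) (quot K (suc s)))) z≤n))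

-- The prelude and the time bound

record Tally (n k t : ℕ) (σ : State) : Set where
  constructor tallied
  field
    r0  : rg σ 0 ≡ n
    r17 : rg σ 17 ≡ t
    r1  : rg σ 1 ≡ k ∸ t
    r2  : rg σ 2 ≡ k ⊓ t

tally-step : ∀ {n k t σ} → Tally n k t σ → Tally n k (suc t) (run tally σ)
tally-step {n} {k} {t} {σ} (tallied r0 r17 r1 r2) = go (rg σ 1) refl
  where
  ρ : State
  ρ = σ ⟨ 17 ≔ suc (rg σ 17) ⟩
  go : ∀ x → rg σ 1 ≡ x → Tally n k (suc t) (run tally σ)
  go zero e = subst (Tally n k (suc t)) (cong (λ y → pick y ρ (run (set 1 (var 1 ⊖ one) ⨟ set 2 (suc (var 2))) ρ)) (sym e))
    (tallied r0 (cong suc r17) (trans e (sym (m≤n⇒m∸n≡0 (m≤n⇒m≤1+n k≤t))))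
      (trans r2 (trans (m≤n⇒m⊓n≡m k≤t) (sym (m≤n⇒m⊓n≡m (m≤n⇒m≤1+n k≤t))))))
    where
    k≤t : k ≤ t
    k≤t = m∸n≡0⇒m≤n (trans (sym r1) e)
  go (suc x) e = subst (Tally n k (suc t)) (cong (λ y → pick y ρ (run (set 1 (var 1 ⊖ one) ⨟ set 2 (suc (var 2))) ρ)) (sym e))
    (tallied r0 (cong suc r17) (trans (cong (_∸ 1) r1) (trans (∸-+-assoc k t 1) (cong (k ∸_) (+-comm t 1))))
      (trans (cong suc (trans r2 (m≥n⇒m⊓n≡n (<⇒≤ t<k)))) (sym (m≥n⇒m⊓n≡n t<k))))
    where
    t<k : t < k
    t<k = m∸n≢0⇒n<m λ z → 0≢1+n (trans (sym z) (trans (sym r1) e))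

tally-row : ∀ {n k t σ} → Tally n k t σ → ∀ j → Tally n k (t + j) (forState 16 tally σ j)
tally-row {n} {k} {t} {σ} T zero = subst (λ x → Tally n k x σ) (sym (+-identityʳ t)) T
tally-row {n} {k} {t} {σ} T (suc j) = subst (λ x → Tally n k x (forState 16 tally σ (suc j))) (sym (+-suc t j))
  (tally-step (same (tally-row T j)))
  where
  same : ∀ {τ} → Tally n k (t + j) τ → Tally n k (t + j) (τ ⟨ 16 ≔ j ⟩)
  same (tallied a b c d) = tallied a b c d

tally-all : ∀ {n k σ} → Tally n k 0 σ → ∀ j → Tally n k (j * n) (forState 15 (for 16 0 tally) σ j)
tally-all T zero = T
tally-all {n} {k} {σ} T (suc j) = subst (λ x → Tally n k x (forState 15 (for 16 0 tally) σ (suc j))) (+-comm (j * n) n)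
  (row (same (tally-all T j)))
  where
  same : ∀ {τ} → Tally n k (j * n) τ → Tally n k (j * n) (τ ⟨ 15 ≔ j ⟩)
  same (tallied a b c d) = tallied a b c d
  row : ∀ {τ} → Tally n k (j * n) τ → Tally n k (j * n + n) (run (for 16 0 tally) τ)
  row {τ} T = subst (λ x → Tally n k (j * n + n) (forState 16 tally τ x)) (sym (Tally.r0 T)) (tally-row T n)

-- The loop of a subtraction is as long as its second operand, which here is 1. The cost is
-- therefore a closed number, however large `k` is.
tally-cost : ∀ σ → runCost tally σ ≤ 30
tally-cost σ with rg σ 1
... | zero  = ≤ᵇ⇒≤ _ 30 _
... | suc _ = ≤ᵇ⇒≤ _ 30 _

row-cost : ∀ σ {n} → rg σ 0 ≡ n → runCost (for 16 0 tally) σ ≤ 3 + n * 35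
row-cost σ refl = s≤s (s≤s (loopCost-≤ 0 (rg σ 0) {B = 33} λ j _ →
  s≤s (s≤s (+-monoˡ-≤ 1 (tally-cost (forState 16 tally σ j ⟨ 16 ≔ j ⟩))))))

count-cost : ∀ σ {n} → rg σ 0 ≡ n → runCost count σ ≤ 3 + n * (8 + n * 35)
count-cost σ {n} refl = s≤s (s≤s (≤-trans (loopCost-≤ 0 n {B = 2 + (3 + n * 35 + 1)} λ j _ →
    s≤s (s≤s (+-monoˡ-≤ 1 (row-cost (forState 15 (for 16 0 tally) σ j ⟨ 15 ≔ j ⟩) (for-fixes 0 15 (for 16 0 tally) {σ} _ j)))))
  (≤-reflexive (cong (λ x → 1 + n * (2 + (2 + x))) (+-comm (3 + n * 35) 1)))))

extend-cost : ∀ σ {n} → rg σ 0 ≡ n → runCost extend σ ≤ 3 + n * 8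
extend-cost σ refl = s≤s (s≤s (loopCost-≤ 0 (rg σ 0) {B = 6} λ j _ → ≤-refl))

-- The generic `runCost-≤` would give a bound in the largest register, which at this stage may still
-- be `k`; hence the bound by hand in terms of `n` alone.
prelude-cost : ∀ σ {n} → rg σ 0 ≡ n → runCost prelude σ ≤ 35 * (suc n * (suc n * 1))
prelude-cost σ {n} e = begin
  runCost count σ + (2 + (runCost extend σ₂ + 14))     ≤⟨ +-mono-≤ (count-cost σ e) (+-monoʳ-≤ 2 (+-monoˡ-≤ 14 (extend-cost σ₂ e₂))) ⟩
  -- The summand `13 + 54 * n` completes the left-hand side to 35 times the square of `n + 1`.
  3 + n * (8 + n * 35) + (2 + (3 + n * 8 + 14))        ≤⟨ m≤m+n _ (13 + 54 * n) ⟩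
  3 + n * (8 + n * 35) + (2 + (3 + n * 8 + 14)) + (13 + 54 * n) ≡⟨ identity n ⟩
  35 * (suc n * (suc n * 1))                           ∎
  where
  open ≤-Reasoning
  σ₂ : State
  σ₂ = run (set 19 (var 17)) (run count σ)
  e₂ : rg σ₂ 0 ≡ n
  e₂ = trans (run-fixes 0 count {σ} _) e
  identity : ∀ n → 3 + n * (8 + n * 35) + (2 + (3 + n * 8 + 14)) + (13 + 54 * n) ≡ 35 * (suc n * (suc n * 1))
  identity = solve-∀

extend-value : ∀ {σ} j → rg (forState 15 (set 19 (suc (var 19))) σ j) 19 ≡ rg σ 19 + j
extend-value zero = sym (+-identityʳ _)
extend-value {σ} (suc j) = trans (cong suc (extend-value {σ} j)) (sym (+-suc _ j))

four-phases : ∀ (c₁ c₂ c₃ c₄ : Cmd) σ → run (c₁ ⨟ c₂ ⨟ c₃ ⨟ c₄) σ ≡ run c₄ (run c₃ (run c₂ (run c₁ σ)))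
four-phases c₁ c₂ c₃ c₄ σ = refl

opaque
  unfolding after

  after-prelude : ∀ σ → run prelude σ ≡ after settle (after extend (after (set 19 (var 17)) (after count σ)))
  after-prelude = four-phases count (set 19 (var 17)) extend settle

  after-count : ∀ {n k σ} → Tally n k 0 σ → Tally n k (n * n) (after count σ)
  after-count {n} {k} {σ} T = subst (λ x → Tally n k (n * n) (forState 15 (for 16 0 tally) σ x)) (sym (Tally.r0 T)) (tally-all T n)

  after-extend : ∀ σ → rg (after extend σ) 19 ≡ rg σ 19 + rg σ 0
  after-extend σ = extend-value {σ} (rg σ 0)

  after-copy : ∀ σ → rg (after (set 19 (var 17)) σ) 19 ≡ rg σ 17
  after-copy σ = refl

  settled : ∀ σ → rg (after settle σ) 1 ≡ 0 × rg (after settle σ) 3 ≡ 1 × rg (after settle σ) 4 ≡ rg σ 2 ×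
                  rg (after settle σ) 5 ≡ 1 × rg (after settle σ) 15 ≡ 0 × rg (after settle σ) 16 ≡ 0
  settled σ = refl , refl , refl , refl , refl , refl

reads-zeros : ∀ (D : ℕ → ℕ) p L → (∀ i → D i ≡ 0) → Reads D p (zeros L)
reads-zeros D p zero    h = tt
reads-zeros D p (suc L) h = h p , reads-zeros D (suc p) L h

module Start {n : ℕ} (G : Graph n) (k : ℕ) where

  open Search G k public

  σ₀ σ₁ σ₂ σ₃ σ₄ : State
  σ₀ = reg (input G k) ▸ mem (input G k)
  σ₁ = after count σ₀
  σ₂ = after (set 19 (var 17)) σ₁
  σ₃ = after extend σ₂
  σ₄ = after settle σ₃

  counted : Tally n k (n * n) σ₁
  counted = after-count (tallied refl refl refl (sym (⊓-zeroʳ k)))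

  memory : ∀ c → mm σ₄ c ≡ mem (input G k) c
  memory c = cong (λ M → M c) (trans (after-pure settle {σ₃} _) (trans (after-pure extend {σ₂} _)
    (trans (after-pure (set 19 (var 17)) {σ₁} _) (after-pure count {σ₀} _))))

  fixed : ∀ x → Fixes x settle × Fixes x extend × Fixes x (set 19 (var 17)) → rg σ₄ x ≡ rg σ₁ x
  fixed x (f , g , h) = trans (after-fixes x settle {σ₃} f) (trans (after-fixes x extend {σ₂} g) (after-fixes x (set 19 (var 17)) {σ₁} h))

  unused : ∀ x → Fixes x settle × Fixes x extend × Fixes x (set 19 (var 17)) → Fixes x count → rg (σ₀) x ≡ 0 → rg σ₄ x ≡ 0
  unused x f g e = trans (fixed x f) (trans (after-fixes x count {σ₀} g) e)

  canon-start : Canon 1 (zeros (quot K 1)) σ₄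
  canon-start with e1 , e3 , e4 , e5 , e15 , e16 ← settled σ₃ = record
    { lay = layout p0 p17 p19 ; r2 = p2 ; r3 = e3 ; r4 = trans p4 (sym (quot-one K)) ; r5 = e5
    ; r7 = unused 7 _ _ refl ; r8 = unused 8 _ _ refl
    ; adjc = λ u v _ _ → memory _
    ; blank = λ v _ → trans (memory _) (input-end G k _ (m≤m+n (n * n) v))
    ; reads = reads-zeros _ 0 (quot K 1) λ i → trans (memory _) (input-end G k _ (≤-trans (m≤m+n (n * n) n) (m≤m+n _ i)))
    ; len = length-replicate (quot K 1) ; valid = zeros-valid (quot K 1) ≤-refl ; 1≤s = ≤-refl ; s≤1+n = s≤s z≤n
    ; bnd = bounded (λ x x<V → All.lookup registers (∈-upTo⁺ x<V))
        λ c → ≤-trans (≤-reflexive (memory c)) (≤-trans (input-≤ G k c) 1≤limit)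
    }
    where
    p0 : rg σ₄ 0 ≡ n
    p0 = trans (fixed 0 _) (Tally.r0 counted)
    p17 : rg σ₄ 17 ≡ n * n
    p17 = trans (fixed 17 _) (Tally.r17 counted)
    p2 : rg σ₄ 2 ≡ K
    p2 = trans (fixed 2 _) (Tally.r2 counted)
    p4 : rg σ₄ 4 ≡ K
    p4 = trans e4 (trans (sym (after-fixes 2 settle {σ₃} _)) p2)
    p19 : rg σ₄ 19 ≡ n * n + n
    p19 = trans (after-fixes 19 settle {σ₃} _) (trans (after-extend σ₂)
      (cong₂ _+_ (trans (after-copy σ₁) (Tally.r17 counted)) (trans (after-fixes 0 (set 19 (var 17)) {σ₁} _) (Tally.r0 counted))))
    is : ∀ {x y} → x ≡ y → y ≤ limit → x ≤ limit
    is e h = ≤-trans (≤-reflexive e) h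
    nil : ∀ {x} → x ≡ 0 → x ≤ limit
    nil e = is e z≤n
    registers : All (λ x → rg σ₄ x ≤ limit) (upTo vars)
    registers = is p0 n≤limit ∷ nil e1 ∷ is p2 K≤limit ∷ is e3 1≤limit ∷ is p4 K≤limit ∷ is e5 1≤limit ∷
      nil (unused 6 _ _ refl) ∷ nil (unused 7 _ _ refl) ∷ nil (unused 8 _ _ refl) ∷ nil (unused 9 _ _ refl) ∷
      nil (unused 10 _ _ refl) ∷ nil (unused 11 _ _ refl) ∷ nil (unused 12 _ _ refl) ∷ nil (unused 13 _ _ refl) ∷
      nil (unused 14 _ _ refl) ∷ nil e15 ∷ nil e16 ∷ is p17 (≤-trans (m≤m+n (n * n) n) (m≤m+n _ 2)) ∷
      nil (unused 18 _ _ refl) ∷ is p19 (m≤m+n _ 2) ∷ []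

  -- Size 1 has just one string, all zeros; `later n 1` counts those of the sizes 2 to `n + 1`.
  rounds : ℕ
  rounds = 1 + later n 1

  start-halts : Halts rounds σ₄
  start-halts = search n 1 0 refl (trans (cong (_+ 1) (val-zeros 1 (quot K 1))) (sym (^-zeroˡ (quot K 1))))
    canon-start (inj₁ (unused 6 _ _ refl)) ahead
    where
    ahead : Ahead 1 (Digits.val 1 (zeros (quot K 1))) σ₄
    ahead T with m≤n⇒m<n∨m≡n (Target.t-pos T)
    ... | inj₁ l = inj₂ (inj₁ l)
    ... | inj₂ e = inj₂ (inj₂ (e , ≤-trans (≤-reflexive (val-zeros 1 (quot K 1))) z≤n))

  prelude-run : ∃[ t ] ∃[ S ] (⟪ compile prelude vars ⟫ σ₀ ⇓[ t ] S) × S ∼ σ₄ × t ≤ 35 * (suc n * (suc n * 1))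
  prelude-run = subst (λ σ → ∃[ t ] ∃[ S ] (⟪ compile prelude vars ⟫ σ₀ ⇓[ t ] S) × S ∼ σ × t ≤ 35 * (suc n * (suc n * 1)))
    (after-prelude σ₀) (run-within prelude ((λ _ _ → refl) , refl) (prelude-cost σ₀ refl))

  total : ℕ
  total = 35 * (suc n * (suc n * 1)) + (1 + rounds * (2 + bodyCost) + 2)

  Answered : State → Set
  Answered S = (rg S 0 ≡ 1 × UCED G k) ⊎ (rg S 0 ≡ 0 × ¬ UCED G k)

  decided : ∀ τ → Decided τ → (rg τ 6 ≡ 1 × UCED G k) ⊎ (rg τ 6 ≡ 0 × ¬ UCED G k)
  decided τ (inj₂ p , _) = inj₁ p
  decided τ (inj₁ z , h) = inj₂ (z , λ U → 0≢1+n (trans (sym z) (h (proj₂ (proj₂ (UCED⇒target U))))))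

  MainRun : Set
  MainRun = ∃[ t ] ∃[ S ] (⟪ main ⟫ σ₀ ⇓[ t ] S) × Answered S × t ≤ total

  main-run : MainRun
  main-run = first prelude-run
    where
    Finished : State → State → Set
    Finished S τ = ∃[ t ] ∃[ S′ ] (⟪ compile (set 0 (var 6)) vars ⟫ S ⇓[ t ] S′) × S′ ∼ (τ ⟨ 0 ≔ rg τ 6 ⟩) × t ≤ 2
    finish : ∀ {S τ} → S ∼ τ → Finished S τ
    finish a = run-within (set 0 (var 6)) a ≤-refl
    move-answer : ∀ {x y} → x ≡ y → (y ≡ 1 × UCED G k) ⊎ (y ≡ 0 × ¬ UCED G k) → (x ≡ 1 × UCED G k) ⊎ (x ≡ 0 × ¬ UCED G k)
    move-answer refl p = p
    third : ∀ {s t S₁ S₂} → ⟪ compile prelude vars ⟫ σ₀ ⇓[ s ] S₁ → s ≤ 35 * (suc n * (suc n * 1)) →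
      ⟪ while 5 (compile body vars) ⟫ S₁ ⇓[ t ] S₂ → t ≤ 1 + rounds * (2 + bodyCost) → ∀ τ → Decided τ → Finished S₂ τ →
      MainRun
    third r₁ s≤ r₂ t≤ τ D (_ , S′ , r₃ , a₃ , u≤) =
      _ , S′ , b-seq r₁ (b-seq r₂ r₃) , move-answer (proj₁ a₃ 0 (≤ᵇ⇒≤ 1 20 _)) (decided τ D) , +-mono-≤ s≤ (+-mono-≤ t≤ u≤)
    second : ∀ {s S₁} → ⟪ compile prelude vars ⟫ σ₀ ⇓[ s ] S₁ → s ≤ 35 * (suc n * (suc n * 1)) →
      (∃[ t ] ∃[ S′ ] ∃[ τ ] (⟪ while 5 (compile body vars) ⟫ S₁ ⇓[ t ] S′) × S′ ∼ τ × t ≤ 1 + rounds * (2 + bodyCost) × Decided τ) →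
      MainRun
    second r₁ s≤ (t , S₂ , τ , r₂ , a₂ , t≤ , D) = third r₁ s≤ r₂ t≤ τ D (finish a₂)
    first : (∃[ t ] ∃[ S ] (⟪ compile prelude vars ⟫ σ₀ ⇓[ t ] S) × S ∼ σ₄ × t ≤ 35 * (suc n * (suc n * 1))) →
      MainRun
    first (s , S₁ , r₁ , a₁ , s≤) = second r₁ s≤ (start-halts S₁ a₁)

-- From 3 on, passing to the next `s` multiplies it by at most 4/3, less than 1.47. The first three
-- cases are computed; the tightest in ratio is 3 against the cube of 1.47, about 3.18.
base-bound : ∀ s → 1 ≤ s → s * 100 ^ s ≤ 147 ^ s
base-bound 1 _ = ≤ᵇ⇒≤ _ _ _
base-bound 2 _ = ≤ᵇ⇒≤ _ _ _
base-bound 3 _ = ≤ᵇ⇒≤ _ _ _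
base-bound (suc s@(suc (suc (suc r)))) _ = begin
  suc s * (100 * 100 ^ s)       ≡⟨ rearrange (suc s) (100 ^ s) ⟩
  suc s * 100 * 100 ^ s         ≤⟨ *-monoˡ-≤ (100 ^ s) growing ⟩
  147 * s * 100 ^ s             ≡⟨ *-assoc 147 s (100 ^ s) ⟩
  147 * (s * 100 ^ s)           ≤⟨ *-monoʳ-≤ 147 (base-bound s (s≤s z≤n)) ⟩
  147 * 147 ^ s                 ∎
  where
  open ≤-Reasoning
  rearrange : ∀ x y → x * (100 * y) ≡ x * 100 * y
  rearrange = solve-∀
  slack : ∀ r → suc (3 + r) * 100 + (41 + 47 * r) ≡ 147 * (3 + r)
  slack = solve-∀
  growing : suc s * 100 ≤ 147 * s
  growing = ≤-trans (m≤m+n _ (41 + 47 * r)) (≤-reflexive (slack r))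

-- s ^ (1/s) is largest at s = 3, and 3 < 1.47³.
power-bound : ∀ {s q k} → 1 ≤ s → q * s ≤ k → s ^ q * 100 ^ k ≤ 147 ^ k
power-bound {s} {q} {k} 1≤s h = begin
  -- Of the exponent `k`, the part `q * s` pays for the strings, `s` units for each digit; the rest
  -- `r` only needs `100 ≤ 147`.
  s ^ q * 100 ^ k                               ≡⟨ cong (λ x → s ^ q * 100 ^ x) (m+[n∸m]≡n h) ⟨
  s ^ q * 100 ^ (q * s + r)                     ≡⟨ cong (s ^ q *_) (^-distribˡ-+-* 100 (q * s) r) ⟩
  s ^ q * (100 ^ (q * s) * 100 ^ r)             ≡⟨ *-assoc (s ^ q) _ _ ⟨
  s ^ q * 100 ^ (q * s) * 100 ^ r               ≡⟨ cong (_* 100 ^ r) (combine s q) ⟩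
  (s * 100 ^ s) ^ q * 100 ^ r                   ≤⟨ *-mono-≤ (^-monoˡ-≤ q (base-bound s 1≤s)) (^-monoˡ-≤ r (≤ᵇ⇒≤ 100 147 _)) ⟩
  (147 ^ s) ^ q * 147 ^ r                       ≡⟨ cong (_* 147 ^ r) (trans (^-*-assoc 147 s q) (cong (147 ^_) (*-comm s q))) ⟩
  147 ^ (q * s) * 147 ^ r                       ≡⟨ ^-distribˡ-+-* 147 (q * s) r ⟨
  147 ^ (q * s + r)                             ≡⟨ cong (147 ^_) (m+[n∸m]≡n h) ⟩
  147 ^ k                                       ∎
  where
  open ≤-Reasoning
  r : ℕ
  r = k ∸ q * s
  combine : ∀ s q → s ^ q * 100 ^ (q * s) ≡ (s * 100 ^ s) ^ q
  combine s zero    = refl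
  combine s (suc q) = trans (cong (s * s ^ q *_) (^-distribˡ-+-* 100 s (q * s)))
    (trans (*-swap-mid s (s ^ q) (100 ^ s) (100 ^ (q * s))) (cong (s * 100 ^ s *_) (combine s q)))

module Bounds {n : ℕ} (G : Graph n) (k : ℕ) where

  open Start G k

  quot-power : ∀ s → 1 ≤ s → s ^ quot K s * 100 ^ k ≤ 147 ^ k
  quot-power s 1≤s = power-bound {s} {quot K s} {k} 1≤s (≤-trans (quot-* K s) (m⊓n≤m k (n * n)))

  later-bound : ∀ d s → later d s * 100 ^ k ≤ d * 147 ^ k
  later-bound zero    s = z≤n
  later-bound (suc d) s = ≤-trans (≤-reflexive (*-distribʳ-+ (100 ^ k) (suc s ^ quot K (suc s)) (later d (suc s))))
    (+-mono-≤ (quot-power (suc s) (s≤s z≤n)) (later-bound d (suc s)))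

  rounds-bound : rounds * 100 ^ k ≤ suc n * 147 ^ k
  rounds-bound = +-mono-≤ (^-monoˡ-≤ k (≤ᵇ⇒≤ 100 147 _)) (later-bound n 1)

opaque

  -- Collects the prelude, the constant overhead of a round, the cost of the body with `limit`
  -- bounded by `3 * (1 + n) ^ 2`, and a last factor `1 + n` for the number of sizes.
  poly : Mono
  poly = ((35 ·B^ 2) ⊞ (const 5 ⊞ (runMono body ⊚ (3 ·B^ 2)))) ⊠ idᵐ

  poly-≥ : ∀ n → (35 * (suc n * (suc n * 1)) + (5 + atMost (runMono body) (n * n + n + 2))) * suc n ≤ atMost poly n
  poly-≥ n = ≤-⊠ ((35 ·B^ 2) ⊞ (const 5 ⊞ (runMono body ⊚ (3 ·B^ 2)))) idᵐ {b = n}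
    (≤-⊞ (35 ·B^ 2) (const 5 ⊞ (runMono body ⊚ (3 ·B^ 2))) {b = n} ≤-refl
      (≤-⊞ (const 5) (runMono body ⊚ (3 ·B^ 2)) {5} {b = n} (≤-const 5 ≤-refl)
        (≤-⊚ (runMono body) (3 ·B^ 2) {b = n} ≤-refl limit≤)))
    (≤-reflexive (sym (trans (+-identityʳ _) (^-identityʳ (suc n)))))
    where
    identity : ∀ n → n * n + n + 2 + (2 * n * n + 5 * n + 1) ≡ 3 * (suc n * (suc n * 1))
    identity = solve-∀
    limit≤ : n * n + n + 2 ≤ 3 * (suc n * (suc n * 1))
    limit≤ = ≤-trans (m≤m+n _ (2 * n * n + 5 * n + 1)) (≤-reflexive (identity n))

-- As there is at least one round, the costs outside the loop may be charged to every round; the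
-- time is then a cost per round multiplied by the number of rounds.
time-bound : ∀ {n J p b w x y} → 1 ≤ J → J * x ≤ suc n * y → w ≤ p + (1 + J * (2 + b) + 2) →
             w * x ≤ (p + (5 + b)) * suc n * y
time-bound {n} {J} {p} {b} {w} {x} {y} 1≤J J≤ w≤ = begin
  w * x                                  ≤⟨ *-monoˡ-≤ x (≤-trans w≤ per-round) ⟩
  (p + (5 + b)) * J * x                  ≡⟨ *-assoc (p + (5 + b)) J x ⟩
  (p + (5 + b)) * (J * x)                ≤⟨ *-monoʳ-≤ (p + (5 + b)) J≤ ⟩
  (p + (5 + b)) * (suc n * y)            ≡⟨ *-assoc (p + (5 + b)) (suc n) y ⟨
  (p + (5 + b)) * suc n * y              ∎
  where
  open ≤-Reasoning
  identity : ∀ p b J → p * J + (3 * J + J * (2 + b)) ≡ (p + (5 + b)) * J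
  identity = solve-∀
  scale : ∀ z → z ≤ z * J
  scale z = m≤m*n z J {{>-nonZero 1≤J}}
  per-round : p + (1 + J * (2 + b) + 2) ≤ (p + (5 + b)) * J
  per-round = begin
    p + (1 + J * (2 + b) + 2)            ≡⟨ cong (p +_) (+-comm (1 + J * (2 + b)) 2) ⟩
    p + (3 + J * (2 + b))                ≤⟨ +-mono-≤ (scale p) (+-monoˡ-≤ (J * (2 + b)) (scale 3)) ⟩
    p * J + (3 * J + J * (2 + b))        ≡⟨ identity p b J ⟩
    (p + (5 + b)) * J                    ∎

regroup : ∀ p n y → atMost p n * y ≡ Mono.coeff p * y * suc n ^ Mono.degree p
regroup (C ·B^ d) n y = identity C (suc n ^ d) y
  where
  identity : ∀ a b c → a * b * c ≡ a * c * b
  identity = solve-∀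

total-bound : ∀ {n} (G : Graph n) k {t} → t ≤ Start.total G k →
              t * 100 ^ k ≤ Mono.coeff poly * 147 ^ k * suc n ^ Mono.degree poly
total-bound {n} G k {t} h = ≤-trans
  (time-bound {n} {Start.rounds G k} {35 * (suc n * (suc n * 1))} {atMost (runMono body) (n * n + n + 2)} {t} {100 ^ k} {147 ^ k}
    (s≤s z≤n) (Bounds.rounds-bound G k) h)
  (≤-trans (*-monoˡ-≤ (147 ^ k) (poly-≥ n)) (≤-reflexive (regroup poly n (147 ^ k))))

-- The power of 1.47 is expressed in natural numbers by multiplying the time by `100 ^ k`. One
-- program and one polynomial serve all inputs, and `suc n` keeps the polynomial factor positive for
-- the empty graph.
theorem66 : ∃[ P ] ∃[ C ] ∃[ c ]
    (∀ (n k : ℕ) .{{_ : NonZero k}} (G : Graph n) →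
    ∃[ t ] ∃[ y ]
    (P ⊢ input G k ⇓[ t ] y) ×
    Answers y (UCED G k) ×
    t * 100 ^ k ≤ C * 147 ^ k * suc n ^ c)
theorem66 = program , Mono.coeff poly , Mono.degree poly , λ n k G → conclude G k (Start.main-run G k)
  where
  conclude : ∀ {n} (G : Graph n) k →
    Start.MainRun G k →
    ∃[ t ] ∃[ y ] (program ⊢ input G k ⇓[ t ] y) × Answers y (UCED G k) ×
      t * 100 ^ k ≤ Mono.coeff poly * 147 ^ k * suc n ^ Mono.degree poly
  conclude G k (t , S , r , A , t≤) = t , at (size main) S , asm-halts main r , A , total-bound G k t≤
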